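{- Every $\mathit{LTL}^{\Box\bigcirc}_{\mathit{bool}}$ ontology-mediated instance query (OMIQ) $\boldsymbol q=(\mathcal O,\varkappa)$ is $\mathrm{FO}(\mathrm{RPR})$-rewritable and $\mathrm{MSO}(<)$-rewritable; consequently, answering any such OMIQ (for fixed $\boldsymbol q$: given a data instance $\mathcal A$ and $\ell\in\mathrm{tem}(\mathcal A)$, decide whether $\ell\in\mathrm{ans}(\boldsymbol q,\mathcal A)$) is in $\mathrm{NC}^1$ for data complexity.
   Context: Fix a countably infinite set of atomic concepts. Temporal concepts (LTL-formulas) are given by $\varkappa::=\top\mid A_i\mid\neg\varkappa\mid\varkappa_1\land\varkappa_2\mid\varkappa_1\lor\varkappa_2\mid\bigcirc_F\varkappa\mid\Diamond_F\varkappa\mid\Box_F\varkappa\mid\varkappa_1\,\mathcal U\,\varkappa_2\mid\bigcirc_P\varkappa\mid\Diamond_P\varkappa\mid\Box_P\varkappa\mid\varkappa_1\,\mathcal S\,\varkappa_2$. An interpretation $\mathfrak M$ assigns to each atomic concept $A$ a set $A^{\mathfrak M}\subseteq\mathbb Z$. Extensions: $\top^{\mathfrak M}=\mathbb Z$, Booleans set-theoretically (negation is complement in $\mathbb Z$), $(\bigcirc_F\varkappa)^{\mathfrak M}=\{n\mid n+1\in\varkappa^{\mathfrak M}\}$, $(\Box_F\varkappa)^{\mathfrak M}=\{n\mid k\in\varkappa^{\mathfrak M}\ \forall k>n\}$, $(\Diamond_F\varkappa)^{\mathfrak M}=\{n\mid\exists k>n,\ k\in\varkappa^{\mathfrak M}\}$,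 $(\varkappa_1\,\mathcal U\,\varkappa_2)^{\mathfrak M}=\{n\mid\exists k>n,\ k\in\varkappa_2^{\mathfrak M}\text{ and }m\in\varkappa_1^{\mathfrak M}\text{ for all }n<m<k\}$, and symmetrically for the past operators $\bigcirc_P,\Box_P,\Diamond_P,\mathcal S$. An $\mathit{LTL}^{\Box\bigcirc}_{\mathit{bool}}$ ontology $\mathcal O$ is a finite set of clauses $C_1\land\dots\land C_k\to C_{k+1}\lor\dots\lor C_{k+m}$, $k,m\ge0$ (empty $\land$ is $\top$, empty $\lor$ is $\bot$), where each $C_i$ is a basic temporal concept, i.e. an atomic concept prefixed by a sequence of operators from $\Box_F,\Box_P,\bigcirc_F,\bigcirc_P$. A clause is true in $\mathfrak M$ if $\bigcap_{i\le k}C_i^{\mathfrak M}\subseteq\bigcup_{j=1}^{m}C_{k+j}^{\mathfrak M}$ (empty $\bigcap$ is $\mathbb Z$, empty $\bigcup$ is $\emptyset$); $\mathfrak M$ is a model of $\mathcal O$ if all its clauses are true in $\mathfrak M$. An $\mathit{LTL}^{\Box\bigcirc}_{\mathit{bool}}$ OMIQ is a pair $\boldsymbol q=(\mathcal O,\varkappa)$ with such an ontology $\mathcal O$ and an arbitrary temporal concept $\varkappa$. A data instance $\mathcal A$ is a finite set of ground atoms $A_i(\ell)$, $\ell\in\mathbb Z$; it is assumed throughout that the least integer $\min\mathcal A$ occurring in it is $0$ and the greatest one satisfies $\max\mathcal A\ge1$; $\mathrm{tem}(\mathcal A)=\{n\in\mathbb Z\mid\min\mathcal A\le n\le\max\mathcal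 A\}$. $\mathfrak M$ is a model of $(\mathcal O,\mathcal A)$ if it is a model of $\mathcal O$ and $\ell\in A^{\mathfrak M}$ for all $A(\ell)\in\mathcal A$. $\mathrm{ans}(\boldsymbol q,\mathcal A)=\{\ell\in\mathrm{tem}(\mathcal A)\mid\ell\in\varkappa^{\mathfrak M}\text{ for every model }\mathfrak M\text{ of }(\mathcal O,\mathcal A)\}$. Data complexity: $\boldsymbol q$ is fixed and only the data ($\mathcal A$, $\ell$) is the input. $\mathfrak S_{\mathcal A}$ is the finite first-order structure with domain $\mathrm{tem}(\mathcal A)$ ordered by $<$ in which $A(\ell)$ holds iff $A(\ell)\in\mathcal A$. For a class $\mathcal L$ of formulas, $\boldsymbol q$ is $\mathcal L$-rewritable if there is a constant-free $\mathcal L$-formula $\boldsymbol Q(t)$ with one free variable such that $\mathrm{ans}(\boldsymbol q,\mathcal A)=\{\ell\in\mathrm{tem}(\mathcal A)\mid\mathfrak S_{\mathcal A}\models\boldsymbol Q(\ell)\}$ for every data instance $\mathcal A$. $\mathrm{MSO}(<)$-formulas are built from atoms $A(t)$ and $t<t'$ using the Booleans, first-order quantifiers, and second-order quantifiers $\forall A,\exists A$ over unary predicates. $\mathrm{FO}(\mathrm{RPR})$ extends first-order logic over the unary predicates and the successor relation with relational primitive recursion: if $\Theta_1,\dots,\Theta_n,\Psi$ are $\mathrm{FO}(\mathrm{RPR})$-formulas, one may form $$\big[\,Q_i(\boldsymbol z_i,t)\equiv\Theta_i(\boldsymbol z_i,t,Q_1(\boldsymbol z_1,t-1),\dots,Q_n(\boldsymbol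 z_n,t-1)),\ 1\le i\le n\,\big]\ \Psi(\boldsymbol z,\boldsymbol z_1,\dots,\boldsymbol z_n),$$ where the bracketed part defines the relations $Q_i$ used in $\Psi$ by recursion on $t=0,1,2,\dots$ in $\mathrm{tem}(\mathcal A)$, with all $Q_i(\boldsymbol z_i,-1)$ taken to be false; each relation variable $Q_i$ occurs in only one recursive definition. -}

module Defs where

open import Data.Bool.Base using (Bool; true; false; not; _∧_; _∨_)
open import Data.Empty using (⊥)
open import Data.Fin.Base as Fin using (Fin; zero; suc; toℕ; fromℕ<; splitAt)
open import Data.Fin.Properties using (toℕ<n) renaming (_≟_ to _≟ᶠ_)
import Data.Fin.Subset as Subset
open import Data.Integer.Base as ℤ using (ℤ; 0ℤ; +_)
open import Data.List.Base as List
  using (List; []; _∷_; _++_; length; reverse; concat; concatMap; tabulate; drop; head)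
open import Data.List.Membership.Propositional using () renaming (_∈_ to _∈ˡ_)
open import Data.List.Relation.Unary.All using (All)
open import Data.List.Relation.Unary.Any using (Any)
open import Data.Maybe.Base using (Maybe; just; nothing)
open import Data.Nat.Base using (ℕ; zero; suc; _+_; _*_; _^_; _⊔_; _≤_)
open import Data.Nat.Logarithm using (⌈log₂_⌉)
open import Data.Nat.Properties using (<⇒≤)
open import Data.Product.Base using (Σ; Σ-syntax; ∃; ∃-syntax; _×_; _,_; proj₂)
open import Data.Sum.Base using (_⊎_; inj₁; inj₂; [_,_])
open import Data.Vec.Base as Vec using (Vec; []; _∷_; lookup)
import Data.Vec.Functional as Fun
open import Function.Base using (_∘_)
open import Function.Bundles using (_⇔_; _↔_)
open import Level using (0ℓ) renaming (suc to lsuc)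
open import Relation.Binary.PropositionalEquality using (_≡_)
open import Relation.Nullary using (¬_)
open import Relation.Nullary.Decidable using (⌊_⌋)
open import Relation.Unary using (Pred; _∈_; ∁; _∩_; _∪_; U)

------------------------------------------------------------------------
-- Temporal concepts

infix  9 ○F_ ◇F_ □F_ ○P_ ◇P_ □P_ ¬′_
infixr 7 _∧′_
infixr 6 _∨′_
infix  8 _𝒰_ _𝒮_

data Concept : Set where
  ⊤′             : Concept
  atom           : ℕ → Concept
  ¬′_            : Concept → Concept
  _∧′_ _∨′_      : Concept → Concept → Concept
  ○F_ ◇F_ □F_    : Concept → Concept
  _𝒰_            : Concept → Concept → Concept
  ○P_ ◇P_ □P_    : Concept → Concept
  _𝒮_            : Concept → Concept → Concept

Interpretation : Set₁
Interpretation = ℕ → Pred ℤ 0ℓ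

⟦_⟧ : Concept → Interpretation → Pred ℤ 0ℓ
⟦ ⊤′ ⟧      M = U
⟦ atom i ⟧  M = M i
⟦ ¬′ κ ⟧    M = ∁ (⟦ κ ⟧ M)
⟦ κ ∧′ ϰ ⟧  M = ⟦ κ ⟧ M ∩ ⟦ ϰ ⟧ M
⟦ κ ∨′ ϰ ⟧  M = ⟦ κ ⟧ M ∪ ⟦ ϰ ⟧ M
⟦ ○F κ ⟧    M n = ℤ.suc n ∈ ⟦ κ ⟧ M
⟦ ◇F κ ⟧    M n = ∃[ k ] n ℤ.< k × k ∈ ⟦ κ ⟧ M
⟦ □F κ ⟧    M n = ∀ k → n ℤ.< k → k ∈ ⟦ κ ⟧ M
⟦ κ 𝒰 ϰ ⟧   M n = ∃[ k ] n ℤ.< k × k ∈ ⟦ ϰ ⟧ M ×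
                         (∀ m → n ℤ.< m → m ℤ.< k → m ∈ ⟦ κ ⟧ M)
⟦ ○P κ ⟧    M n = ℤ.pred n ∈ ⟦ κ ⟧ M
⟦ ◇P κ ⟧    M n = ∃[ k ] k ℤ.< n × k ∈ ⟦ κ ⟧ M
⟦ □P κ ⟧    M n = ∀ k → k ℤ.< n → k ∈ ⟦ κ ⟧ M
⟦ κ 𝒮 ϰ ⟧   M n = ∃[ k ] k ℤ.< n × k ∈ ⟦ ϰ ⟧ M ×
                         (∀ m → k ℤ.< m → m ℤ.< n → m ∈ ⟦ κ ⟧ M)

------------------------------------------------------------------------
-- Ontologies and queries

data Operator : Set where
  □ᶠ □ᵖ ○ᶠ ○ᵖ : Operator

data Basic : Set where
  atom  : ℕ → Basic
  _·_   : Operator → Basic → Basic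

⌜_⌝ : Basic → Concept
⌜ atom i ⌝ = atom i
⌜ □ᶠ · C ⌝ = □F ⌜ C ⌝
⌜ □ᵖ · C ⌝ = □P ⌜ C ⌝
⌜ ○ᶠ · C ⌝ = ○F ⌜ C ⌝
⌜ ○ᵖ · C ⌝ = ○P ⌜ C ⌝

record Clause : Set where
  constructor _⇒_
  field
    premises    : List Basic
    conclusions : List Basic

Ontology : Set
Ontology = List Clause

record OMIQ : Set where
  constructor ⟨_,_⟩
  field
    ontology : Ontology
    query    : Concept

TrueIn : Interpretation → Clause → Set
TrueIn M (Cs ⇒ Ds) =
  ∀ n → All (λ C → n ∈ ⟦ ⌜ C ⌝ ⟧ M) Cs → Any (λ D → n ∈ ⟦ ⌜ D ⌝ ⟧ M) Ds

------------------------------------------------------------------------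
-- Data instances and certain answers

-- The pair (i , ℓ) stands for the ground atom A_i(ℓ).
record Data : Set where
  field
    atoms : List (ℕ × ℤ)

  timestamps : List ℤ
  timestamps = List.map proj₂ atoms

  field
    min∈  : 0ℤ ∈ˡ timestamps
    min≤  : All (0ℤ ℤ.≤_) timestamps
    max   : ℕ
    max∈  : (+ max) ∈ˡ timestamps
    ≤max  : All (ℤ._≤ + max) timestamps
    1≤max : 1 ≤ max

-- tem(𝒜) = {0, …, max 𝒜}
Tem : Data → Set
Tem 𝒜 = Fin (suc (Data.max 𝒜))

time : (𝒜 : Data) → Tem 𝒜 → ℤ
time _ ℓ = + toℕ ℓ

record Model (𝒪 : Ontology) (𝒜 : Data) (M : Interpretation) : Set where
  field
    ontology : All (TrueIn M) 𝒪
    facts    : ∀ {i ℓ} → (i , ℓ) ∈ˡ Data.atoms 𝒜 → ℓ ∈ M i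

ans : OMIQ → (𝒜 : Data) → Pred (Tem 𝒜) (lsuc 0ℓ)
ans ⟨ 𝒪 , κ ⟩ 𝒜 ℓ = ∀ M → Model 𝒪 𝒜 M → time 𝒜 ℓ ∈ ⟦ κ ⟧ M

------------------------------------------------------------------------
-- Rewritability

record Structure : Set₁ where
  field
    size  : ℕ
    unary : ℕ → Pred (Fin size) 0ℓ

𝔖 : Data → Structure
𝔖 𝒜 = record
  { size  = suc (Data.max 𝒜)
  ; unary = λ i ℓ → (i , time 𝒜 ℓ) ∈ˡ Data.atoms 𝒜
  }

-- Formulas with one free individual variable.
record Logic : Set₁ where
  field
    Formula : Set
    Holds   : Formula → (𝔄 : Structure) → Pred (Fin (Structure.size 𝔄)) 0ℓ

_-rewritable_ : Logic → OMIQ → Set₁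
L -rewritable q =
  Σ[ Q ∈ Formula ] (∀ 𝒜 (ℓ : Tem 𝒜) → ℓ ∈ ans q 𝒜 ⇔ Holds Q (𝔖 𝒜) ℓ)
  where open Logic L

------------------------------------------------------------------------
-- MSO(<)

-- s set variables and n individual variables are in scope, as de Bruijn
-- indices.
data MSO (s n : ℕ) : Set where
  pred         : ℕ → Fin n → MSO s n
  var          : Fin s → Fin n → MSO s n
  _<′_         : Fin n → Fin n → MSO s n
  ¬′_          : MSO s n → MSO s n
  _∧′_ _∨′_    : MSO s n → MSO s n → MSO s n
  ∀₁ ∃₁        : MSO s (suc n) → MSO s n
  ∀₂ ∃₂        : MSO (suc s) n → MSO s n

module _ (𝔄 : Structure) where
  open Structure 𝔄

  satMSO : ∀ {s n} → MSO s n → Vec (Subset.Subset size) s → Vec (Fin size) n → Set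
  satMSO (pred i x)  V v = unary i (lookup v x)
  satMSO (var X x)   V v = lookup v x Subset.∈ lookup V X
  satMSO (x <′ y)    V v = lookup v x Fin.< lookup v y
  satMSO (¬′ φ)      V v = ¬ satMSO φ V v
  satMSO (φ ∧′ ψ)    V v = satMSO φ V v × satMSO ψ V v
  satMSO (φ ∨′ ψ)    V v = satMSO φ V v ⊎ satMSO ψ V v
  satMSO (∀₁ φ)      V v = ∀ d → satMSO φ V (d ∷ v)
  satMSO (∃₁ φ)      V v = ∃[ d ] satMSO φ V (d ∷ v)
  satMSO (∀₂ φ)      V v = ∀ S → satMSO φ (S ∷ V) v
  satMSO (∃₂ φ)      V v = ∃[ S ] satMSO φ (S ∷ V) v

MSO[<] : Logic
MSO[<] = record
  { Formula = MSO 0 1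
  ; Holds   = λ Q 𝔄 ℓ → satMSO 𝔄 Q [] (ℓ ∷ [])
  }

------------------------------------------------------------------------
-- FO(RPR)

-- Δ lists the arities of the relation variables in scope.
--
-- `rec a Θ Ψ` is [ Q_i(z_i,t) ≡ Θ_i(z_i, t, Q_1(·,t-1), …, Q_m(·,t-1)) ] Ψ
-- with z_i of length a i.  The argument t is put first, so Q_i(z_i,t) is
-- written Q_i applied to t ∷ z_i, and Θ_i has the individual variables
-- t ∷ z_i.  Inside the Θs the only available form of Q_i is Q_i(·,t-1),
-- that is, a relation variable of arity a i; inside Ψ it is Q_i itself,
-- of arity suc (a i).
data FORPR {r} (Δ : Fun.Vector ℕ r) (n : ℕ) : Set where
  pred       : ℕ → Fin n → FORPR Δ n
  succ       : Fin n → Fin n → FORPR Δ n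
  _≈′_       : Fin n → Fin n → FORPR Δ n
  rel        : (Q : Fin r) → Vec (Fin n) (Δ Q) → FORPR Δ n
  ¬′_        : FORPR Δ n → FORPR Δ n
  _∧′_ _∨′_  : FORPR Δ n → FORPR Δ n → FORPR Δ n
  ∀₁ ∃₁      : FORPR Δ (suc n) → FORPR Δ n
  rec        : ∀ {m} (a : Fun.Vector ℕ m) →
               (∀ i → FORPR (a Fun.++ Δ) (suc (a i))) →
               FORPR ((suc ∘ a) Fun.++ Δ) n → FORPR Δ n

Relations : ℕ → ∀ {r} → Fun.Vector ℕ r → Set₁
Relations N Δ = ∀ Q → Pred (Vec (Fin N) (Δ Q)) 0ℓ

_⊕_ : ∀ {N m r} {a : Fun.Vector ℕ m} {Δ : Fun.Vector ℕ r} →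
      Relations N a → Relations N Δ → Relations N (a Fun.++ Δ)
_⊕_ {N} {m} {a = a} {Δ} R S Q =
  [_,_] {C = λ P → Pred (Vec (Fin N) ([ a , Δ ] P)) 0ℓ} R S (splitAt m Q)

module _ {N m} {a : Fun.Vector ℕ m} (step : Fin N → Relations N a → Relations N a) where

  -- `before k` is Q(·,k-1).
  before : ∀ k → .(k ≤ N) → Relations N a
  before zero    _   = λ _ _ → ⊥
  before (suc k) k<N = step (fromℕ< k<N) (before k (<⇒≤ k<N))

  recursive : Relations N (suc ∘ a)
  recursive Q (t ∷ z) = before (suc (toℕ t)) (toℕ<n t) Q z

module _ (𝔄 : Structure) where
  open Structure 𝔄

  satFORPR : ∀ {r} {Δ : Fun.Vector ℕ r} {n} →
             FORPR Δ n → Relations size Δ → Vec (Fin size) n → Set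
  satFORPR (pred i x)   R v = unary i (lookup v x)
  satFORPR (succ x y)   R v = toℕ (lookup v y) ≡ suc (toℕ (lookup v x))
  satFORPR (x ≈′ y)     R v = lookup v x ≡ lookup v y
  satFORPR (rel Q xs)   R v = R Q (Vec.map (lookup v) xs)
  satFORPR (¬′ φ)       R v = ¬ satFORPR φ R v
  satFORPR (φ ∧′ ψ)     R v = satFORPR φ R v × satFORPR ψ R v
  satFORPR (φ ∨′ ψ)     R v = satFORPR φ R v ⊎ satFORPR ψ R v
  satFORPR (∀₁ φ)       R v = ∀ d → satFORPR φ R (d ∷ v)
  satFORPR (∃₁ φ)       R v = ∃[ d ] satFORPR φ R (d ∷ v)
  satFORPR (rec a Θ Ψ)  R v =
    satFORPR Ψ (recursive (λ t P i z → satFORPR (Θ i) (P ⊕ R) (t ∷ z)) ⊕ R) v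

FO[RPR] : Logic
FO[RPR] = record
  { Formula = FORPR Fun.[] 1
  ; Holds   = λ Q 𝔄 ℓ → satFORPR 𝔄 Q (λ ()) (ℓ ∷ [])
  }

------------------------------------------------------------------------
-- Boolean circuits of fan-in at most two

data Gate (n s : ℕ) : Set where
  const       : Bool → Gate n s
  input       : Fin n → Gate n s
  neg         : Fin s → Gate n s
  conj disj   : Fin s → Fin s → Gate n s

-- A circuit with n inputs and s gates, in topological order.  A gate refers
-- to earlier gates by de Bruijn index: zero is the gate just before it.
infixl 5 _▷_

data Circuit (n : ℕ) : ℕ → Set where
  []   : Circuit n 0
  _▷_  : ∀ {s} → Circuit n s → Gate n s → Circuit n (suc s)

gateValue : ∀ {n s} → Vec Bool n → Vec Bool s → Gate n s → Bool
gateValue x vs (const b)   = b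
gateValue x vs (input i)   = lookup x i
gateValue x vs (neg g)     = not (lookup vs g)
gateValue x vs (conj g h)  = lookup vs g ∧ lookup vs h
gateValue x vs (disj g h)  = lookup vs g ∨ lookup vs h

values : ∀ {n s} → Circuit n s → Vec Bool n → Vec Bool s
values []      x = []
values (C ▷ g) x = gateValue x (values C x) g ∷ values C x

gateDepth : ∀ {n s} → Vec ℕ s → Gate n s → ℕ
gateDepth ds (const b)   = 0
gateDepth ds (input i)   = 0
gateDepth ds (neg g)     = suc (lookup ds g)
gateDepth ds (conj g h)  = suc (lookup ds g ⊔ lookup ds h)
gateDepth ds (disj g h)  = suc (lookup ds g ⊔ lookup ds h)

depths : ∀ {n s} → Circuit n s → Vec ℕ s
depths []      = []
depths (C ▷ g) = gateDepth (depths C) g ∷ depths C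

-- The output gate is the last one.
output : ∀ {n s} → Circuit n (suc s) → Vec Bool n → Bool
output C x = Vec.head (values C x)

depth : ∀ {n s} → Circuit n (suc s) → ℕ
depth C = Vec.head (depths C)

------------------------------------------------------------------------
-- Deterministic multitape Turing machines

-- `nothing` is the blank.
Symbol : Set
Symbol = Maybe Bool

data Move : Set where
  left stay right : Move

-- A two-way infinite tape, blank outside the two lists; `lefts` is listed
-- from the head outwards.
record Tape : Set where
  constructor tape
  field
    lefts   : List Symbol
    current : Symbol
    rights  : List Symbol

act : Symbol × Move → Tape → Tape
act (c , left)  (tape []       _ as)       = tape [] nothing (c ∷ as)
act (c , left)  (tape (b ∷ bs) _ as)       = tape bs b (c ∷ as)
act (c , stay)  (tape bs       _ as)       = tape bs c as
act (c , right) (tape bs       _ [])       = tape (c ∷ bs) nothing []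
act (c , right) (tape bs       _ (a ∷ as)) = tape (c ∷ bs) a as

blank : Tape
blank = tape [] nothing []

load : List Bool → Tape
load []       = blank
load (b ∷ bs) = tape [] (just b) (List.map just bs)

-- Three input tapes and any number of work tapes.  A transition either
-- halts with a verdict or continues.
record Machine : Set₁ where
  field
    State  : Set
    finite : ∃[ k ] (State ↔ Fin k)
    start  : State
    work   : ℕ
    δ      : State → Vec Symbol (3 + work) →
             Bool ⊎ (State × Vec (Symbol × Move) (3 + work))

  run : ℕ → State → Vec Tape (3 + work) → Maybe Bool
  run zero    s ts = nothing
  run (suc k) s ts with δ s (Vec.map Tape.current ts)
  ... | inj₁ b        = just b
  ... | inj₂ (s′ , α) = run k s′ (Vec.zipWith act α ts)

  runOn : ℕ → List Bool → List Bool → List Bool → Maybe Bool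
  runOn k x y z =
    run k start (load x ∷ load y ∷ load z ∷ Vec.replicate work blank)

------------------------------------------------------------------------
-- Uniform NC¹

increment : List Bool → List Bool
increment []           = true ∷ []
increment (false ∷ bs) = true ∷ bs
increment (true ∷ bs)  = false ∷ increment bs

binaryLSB : ℕ → List Bool
binaryLSB zero    = []
binaryLSB (suc n) = increment (binaryLSB n)

-- Most significant bit first, without leading zeros.
binary : ℕ → List Bool
binary n = reverse (binaryLSB n)

label : ∀ {n s} → Gate n s → List Bool
label (conj _ _) = false ∷ false ∷ false ∷ []
label (disj _ _) = false ∷ false ∷ true ∷ []
label (neg _)    = false ∷ true ∷ false ∷ []
label (const b)  = false ∷ true ∷ true ∷ b ∷ []
label (input i)  = true ∷ binary (toℕ i)

-- The label of the gate reached along a path from a given gate towards the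
-- inputs; false leads to the first argument of a gate, true to the second.
labelFrom : ∀ {n s} → Circuit n s → Fin s → List Bool → Maybe (List Bool)
labelFrom (C ▷ g)        (suc i) p           = labelFrom C i p
labelFrom (C ▷ g)        zero    []          = just (label g)
labelFrom (C ▷ neg g)    zero    (false ∷ p) = labelFrom C g p
labelFrom (C ▷ conj g h) zero    (false ∷ p) = labelFrom C g p
labelFrom (C ▷ conj g h) zero    (true  ∷ p) = labelFrom C h p
labelFrom (C ▷ disj g h) zero    (false ∷ p) = labelFrom C g p
labelFrom (C ▷ disj g h) zero    (true  ∷ p) = labelFrom C h p
labelFrom _              _       _           = nothing

record Family : Set where
  field
    size    : ℕ → ℕ
    circuit : ∀ n → Circuit n (suc (size n))

-- DLOGTIME-uniformity in the sense of Ruzzo's U_E: the extended connection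
-- language, with gates addressed by their paths from the output gate, is
-- decided in time linear in the length of ⟨n, p, y⟩, where n is written in
-- binary.  In a circuit of logarithmic depth, paths and labels have length
-- O(log n), so this is time O(log n).
Uniform : Family → Set₁
Uniform 𝒞 =
  Σ[ T ∈ Machine ] Σ[ c ∈ ℕ ] ∀ n p y → Σ[ b ∈ Bool ]
    Machine.runOn T (c * (length (binary n) + length p + length y) + c)
                  (binary n) p y ≡ just b ×
    (b ≡ true ⇔ labelFrom (circuit n) zero p ≡ just y)
  where open Family 𝒞

Language : Set₂
Language = Pred (List Bool) (lsuc 0ℓ)

record NC¹ (L : Language) : Set₁ where
  field
    family     : Family

  open Family family

  field
    polySize   : ∃[ c ] ∀ n → size n ≤ n ^ c + c
    logDepth   : ∃[ c ] ∀ n → depth (circuit n) ≤ c * ⌈log₂ n ⌉ + c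
    uniform    : Uniform family
    recognises : ∀ w → w ∈ L ⇔ output (circuit (length w)) (Vec.fromList w) ≡ true

------------------------------------------------------------------------
-- Query answering as a language

-- Row t lists the truth values of A_0(t), A_1(t), …; atoms beyond its end
-- are absent.
Rows : Data → Set
Rows 𝒜 = Tem 𝒜 → List Bool

Represents : (𝒜 : Data) → Rows 𝒜 → Set
Represents 𝒜 ρ =
  ∀ t i → (i , time 𝒜 t) ∈ˡ Data.atoms 𝒜 ⇔ head (drop i (ρ t)) ≡ just true

-- Tokens have two bits: 1b opens a row, with b marking the row of ℓ, and 0b
-- is an entry b of the current row.
encode : (𝒜 : Data) → Rows 𝒜 → Tem 𝒜 → List Bool
encode 𝒜 ρ ℓ = concat (tabulate λ t →
  true ∷ ⌊ t ≟ᶠ ℓ ⌋ ∷ concatMap (λ b → false ∷ b ∷ []) (ρ t))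

Answering : OMIQ → Language
Answering q w =
  Σ[ 𝒜 ∈ Data ] Σ[ ρ ∈ Rows 𝒜 ] Σ[ ℓ ∈ Tem 𝒜 ]
    Represents 𝒜 ρ × w ≡ encode 𝒜 ρ ℓ × ℓ ∈ ans q 𝒜

{-# OPTIONS --safe #-}
module Submission where

-- Call the set of subformulas of 𝒪 and κ true at a point of an interpretation
-- its type there.  If two interpretations have the same type at a point, then
-- the first one up to that point followed by the second one keeps all types of
-- both.  Hence a finite sequence of types is realised on {0, …, max 𝒜} by one
-- model of 𝒪 as soon as each two neighbours are realised, next to each other,
-- in some model: whether 𝒜 has a model refuting κ at ℓ is a question of
-- reachability in a finite automaton, whose transitions exist by excluded
-- middle and are never computed.  FO(RPR) defines the reachable states by
-- recursion and MSO(<) as the least closed family of sets.  The encodings of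
-- the positive instances thus form a regular language, and the powers of the
-- transition relation of its automaton, computed by halving intervals, are
-- formulas of logarithmic depth.  A path in such a formula spells out the bits
-- of an interval, so one pass over n, the path and the label, with a finite
-- memory, decides the connection language.

open import Defs
open import Axiom.ExcludedMiddle using (ExcludedMiddle)
open import Data.Product.Base using (_×_)
open import Level using (0ℓ)
open import Relation.Unary using (_∈_)

-- Certain answers quantify over interpretations of all of ℤ, yet neither the past before 0 nor the
-- future after the last time point is ever represented. Until and Since are strict, and their truth
-- values at a point belong to its type; so equal types at one single point suffice for gluing, and
-- the model behind the last transition brings along a future in which every eventuality is already
-- fulfilled. Hence the automaton needs no acceptance condition: every run is realised, and an
-- answer is certain exactly when there is no run at all. The circuit part is shaped by uniformity.
-- Gates are addressed by paths, so the formulas are trees, each subtree being given by a bounded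
-- tuple of states, a depth and an interval. The depth is the number of binary digits of n, so that
-- n, the path and the label of an input gate (a position in binary, highest digit first) can be
-- read in step.

module Classical (em : ExcludedMiddle 0ℓ) where

  open import Data.Bool.Base using (Bool; true; false)
  open import Data.Empty using (⊥-elim)
  open import Function.Bundles using (_⇔_; mk⇔; Equivalence)
  open import Relation.Binary.PropositionalEquality using (_≡_; refl; sym; trans)
  open import Relation.Nullary using (¬_; yes; no; does)
  open import Relation.Nullary.Decidable using (decidable-stable)

  open Equivalence using (to; from)

  stable : {A : Set} → ¬ ¬ A → A
  stable = decidable-stable em

  decide : Set → Bool
  decide A = does (em {A})

  decide⇔ : ∀ {A} → decide A ≡ true ⇔ A
  decide⇔ {A} with em {A}
  ... | yes a = mk⇔ (λ _ → a) (λ _ → refl)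
  ... | no ¬a = mk⇔ (λ ()) (λ a → ⊥-elim (¬a a))

  decide-false : ∀ {A} → ¬ A → decide A ≡ false
  decide-false {A} ¬a with em {A}
  ... | yes a = ⊥-elim (¬a a)
  ... | no _  = refl

  decide-cong : ∀ {A B} → A ⇔ B → decide A ≡ decide B
  decide-cong {A} {B} e with em {A} | em {B}
  ... | yes _ | yes _ = refl
  ... | no _  | no _  = refl
  ... | yes a | no ¬b = ⊥-elim (¬b (to e a))
  ... | no ¬a | yes b = ⊥-elim (¬a (from e b))

  decide-injective : ∀ {A B} → decide A ≡ decide B → A ⇔ B
  decide-injective e = mk⇔
    (λ a → to decide⇔ (trans (sym e) (from decide⇔ a)))
    (λ b → to decide⇔ (trans e (from decide⇔ b)))

-- Finite types.

module FiniteSets where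

  open import Data.Bool.Base using (Bool)
  open import Data.Fin.Base using (Fin; zero; suc)
  open import Data.Fin.Properties using (1↔⊤; 2↔Bool; *↔×; +↔⊎)
  open import Data.Maybe.Base using (Maybe; just; nothing)
  open import Data.Nat.Base using (zero; suc; _+_; _*_)
  open import Data.Product.Base using (∃-syntax; _×_; _,_)
  open import Data.Product.Function.NonDependent.Propositional using (_×-↔_)
  open import Data.Sum.Base using (_⊎_; inj₁; inj₂)
  open import Data.Sum.Function.Propositional using (_⊎-↔_)
  open import Data.Unit.Base using (⊤; tt)
  open import Data.Vec.Base using (Vec; []; _∷_; head; tail)
  open import Function.Bundles using (_↔_; mk↔ₛ′)
  open import Function.Construct.Composition using (_↔-∘_)
  open import Function.Construct.Identity using (↔-id)
  open import Function.Construct.Symmetry using (↔-sym)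
  open import Relation.Binary.PropositionalEquality using (refl)

  -- The form that `Machine` demands of its states. The bijection is also used to code types and
  -- automaton states as elements of `Fin k`.
  Finite : Set → Set
  Finite A = ∃[ k ] (A ↔ Fin k)

  finite-↔ : ∀ {A B : Set} → A ↔ B → Finite B → Finite A
  finite-↔ e (k , f) = k , f ↔-∘ e

  finite-Fin : ∀ k → Finite (Fin k)
  finite-Fin k = k , ↔-id (Fin k)

  finite-⊤ : Finite ⊤
  finite-⊤ = 1 , ↔-sym 1↔⊤

  finite-Bool : Finite Bool
  finite-Bool = 2 , ↔-sym 2↔Bool

  infixr 4 _×ᶠ_
  infixr 3 _⊎ᶠ_

  _×ᶠ_ : ∀ {A B : Set} → Finite A → Finite B → Finite (A × B)
  (k , e) ×ᶠ (l , f) = k * l , ↔-sym *↔× ↔-∘ (e ×-↔ f)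

  _⊎ᶠ_ : ∀ {A B : Set} → Finite A → Finite B → Finite (A ⊎ B)
  (k , e) ⊎ᶠ (l , f) = k + l , ↔-sym +↔⊎ ↔-∘ (e ⊎-↔ f)

  finite-Maybe : ∀ {A : Set} → Finite A → Finite (Maybe A)
  finite-Maybe F = finite-↔
    (mk↔ₛ′ (λ { nothing → inj₁ tt ; (just a) → inj₂ a })
           (λ { (inj₁ _) → nothing ; (inj₂ a) → just a })
           (λ { (inj₁ _) → refl ; (inj₂ _) → refl })
           (λ { nothing → refl ; (just _) → refl }))
    (finite-⊤ ⊎ᶠ F)

  finite-Vec : ∀ {A : Set} → Finite A → ∀ n → Finite (Vec A n)
  finite-Vec F zero = finite-↔
    (mk↔ₛ′ (λ _ → tt) (λ _ → []) (λ _ → refl) (λ { [] → refl })) finite-⊤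
  finite-Vec F (suc n) = finite-↔
    (mk↔ₛ′ (λ xs → head xs , tail xs) (λ (x , xs) → x ∷ xs) (λ _ → refl) (λ { (_ ∷ _) → refl }))
    (F ×ᶠ finite-Vec F n)

-- Automata that read one time point per step.

module Automata where

  open import Data.Bool.Base using (Bool; true; false)
  open import Data.Fin.Base using (Fin)
  open import Data.Nat.Base using (ℕ; zero; suc; _<_)
  open import Data.Nat.Properties using (≤-refl; m<n⇒m<1+n)
  open import Data.Product.Base using (∃-syntax; _×_; _,_)
  open import Relation.Binary.PropositionalEquality using (_≡_; refl; cong)

  -- A nondeterministic automaton reading one time point per step.  A letter is
  -- the set of atoms holding there, together with whether the point is the one
  -- asked about: state q cannot read atom i if forbids q i, and it can read the
  -- marked point only if refutes q.
  record Automaton : Set where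
    field
      states   : ℕ
      start    : Fin states
      δ        : Fin states → Fin states → Bool
      forbids  : Fin states → ℕ → Bool
      refutes  : Fin states → Bool
      bound    : ℕ
      bounded  : ∀ q {i} → forbids q i ≡ true → i < bound

    -- Open-world reading: an atom absent from the data imposes nothing.
    Reads : (ℕ → Set) → Set → Fin states → Set
    Reads P marked q = (∀ i → P i → forbids q i ≡ false) × (marked → refutes q ≡ true)

    post : (Fin states → Set) → (Fin states → Set) → Fin states → Set
    post S C q = (∃[ p ] S p × δ p q ≡ true) × C q

    reach : (Fin states → Set) → (ℕ → Fin states → Set) → ℕ → Fin states → Set
    reach S C zero    = S
    reach S C (suc t) = post (reach S C t) (C t)

    -- The index counts the points already read: the state at time `t` is found at index `suc t`,
    -- and index 0 is `start`, before any point.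
    Reach : (ℕ → Fin states → Set) → ℕ → Fin states → Set
    Reach = reach (_≡ start)

    reach-mono : ∀ {S C D} n → (∀ t q → t < n → C t q → D t q) →
                 ∀ q → reach S C n q → reach S D n q
    reach-mono zero    h q r = r
    reach-mono (suc n) h q ((p , r , d) , c) =
      (p , reach-mono n (λ t q l → h t q (m<n⇒m<1+n l)) p r , d) , h n q ≤-refl c

    -- `reach` unfolds at its last letter, whereas a left fold over rows consumes the first; this
    -- mediates between them.
    reach-shift : ∀ {S C} t → reach S C (suc t) ≡ reach (post S (C 0)) (λ s → C (suc s)) t
    reach-shift zero = refl
    reach-shift {C = C} (suc t) = cong (λ S → post S (C (suc t))) (reach-shift t)

-- Temporal formulas, gluing of models, and the automaton of types.

module Temporal where

  open import Data.Bool.Base using (Bool; true; false; if_then_else_)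
  open import Data.Bool.Properties using () renaming (_≟_ to _≟ᵇ_)
  open import Data.Empty using (⊥; ⊥-elim)
  open import Data.Integer.Base as ℤ using (ℤ; +_; 1ℤ)
  import Data.Integer.Properties as ℤ
  open import Data.List.Base as List using (List; []; _∷_; _++_)
  open import Data.List.Membership.Propositional using () renaming (_∈_ to _∈ˡ_)
  open import Data.List.Membership.Propositional.Properties using (∈-++⁺ˡ; ∈-++⁺ʳ; ∈-++⁻)
  open import Data.List.Relation.Unary.All as All using (All; []; _∷_)
  open import Data.List.Relation.Unary.Any as Any using (Any; here; there)
  open Automata
  open FiniteSets
  open import Data.Fin.Base using (Fin; zero; suc; toℕ)
  open import Data.Fin.Properties using (toℕ<n)
  open import Data.List.Relation.Unary.All.Properties using (¬Any⇒All¬; All¬⇒¬Any)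
  open import Data.Nat.ListAction using (sum)
  import Data.Nat.Properties as ℕ
  open import Data.Vec.Base as Vec using (Vec)
  open import Data.Vec.Properties using (lookup∘tabulate; tabulate-cong)
  open import Data.List.Membership.Propositional.Properties using (∈-map⁺; ∈-lookup)
  open import Data.List.Relation.Unary.Any.Properties using (lookup-index)
  open import Data.Nat.Base as ℕ using (ℕ; zero; suc)
  open import Data.Product.Base using (∃-syntax; _×_; _,_; proj₁; proj₂)
  open import Data.Sum.Base using (_⊎_; inj₁; inj₂)
  open import Data.Unit.Base using (⊤; tt)
  open import Function.Base using (_∘_; flip; case_of_)
  open import Function.Bundles using (_⇔_; mk⇔; Equivalence; module Injection)
  open import Function.Properties.Inverse using (↔⇒↣)
  open import Function.Construct.Composition using (_⇔-∘_)
  open import Function.Construct.Symmetry using (⇔-sym)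
  open import Function.Construct.Identity using (⇔-id)
  open import Relation.Binary.Core using (Rel)
  open import Relation.Binary.Definitions using (tri<; tri≈; tri>)
  open import Relation.Binary.Structures using (IsStrictTotalOrder)
  import Relation.Binary.Construct.Flip.EqAndOrd as Flip
  open import Relation.Binary.PropositionalEquality using (_≡_; refl; sym; trans; cong; subst)
  open import Relation.Nullary using (¬_; yes; no; does)
  open import Relation.Unary using (Pred; _∈_)

  open Equivalence using (to; from)

  ¬-cong : {A B : Set} → A ⇔ B → (¬ A) ⇔ (¬ B)
  ¬-cong e = mk⇔ (_∘ from e) (_∘ to e)

  ×-cong : {A B C D : Set} → A ⇔ B → C ⇔ D → (A × C) ⇔ (B × D)
  ×-cong e f = mk⇔ (λ (a , c) → to e a , to f c) (λ (b , d) → from e b , from f d)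

  -- Strict Until over an arbitrary order, and its behaviour under gluing.

  module Until (_≺_ : Rel ℤ 0ℓ) where

    Until : Pred ℤ 0ℓ → Pred ℤ 0ℓ → Pred ℤ 0ℓ
    Until P Q n = ∃[ k ] n ≺ k × Q k × (∀ m → n ≺ m → m ≺ k → P m)

    until-cong : ∀ {P P′ Q Q′ : Pred ℤ 0ℓ} {n} →
                 (∀ m → n ≺ m → P m ⇔ P′ m) → (∀ m → n ≺ m → Q m ⇔ Q′ m) →
                 Until P Q n ⇔ Until P′ Q′ n
    until-cong p q = mk⇔
      (λ (k , n≺k , Qk , h) → k , n≺k , to (q k n≺k) Qk , λ m l r → to (p m l) (h m l r))
      (λ (k , n≺k , Qk , h) → k , n≺k , from (q k n≺k) Qk , λ m l r → from (p m l) (h m l r))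

  module GlueUntil {_≺_ : Rel ℤ 0ℓ} (sto : IsStrictTotalOrder _≡_ _≺_) where
    open Until _≺_
    open IsStrictTotalOrder sto using (compare) renaming (trans to ≺-trans; irrefl to ≺-irrefl)

    -- Phrased with a negated `≺`, so that for the reversed order `After` is definitionally `Before`
    -- for the original one. The lemmas on both orders then apply to the same hypotheses.
    Before After : ℤ → Pred ℤ 0ℓ → Pred ℤ 0ℓ → Set
    Before x P P′ = ∀ k → ¬ (x ≺ k) → P k ⇔ P′ k
    After  x P P′ = ∀ k → ¬ (k ≺ x) → P k ⇔ P′ k

    until-after : ∀ {x P P′ Q Q′} → After x P P′ → After x Q Q′ →
                  After x (Until P Q) (Until P′ Q′)
    until-after p q k k⊀x = until-cong (λ m k≺m → p m (after k≺m)) (λ m k≺m → q m (after k≺m))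
      where
      after : ∀ {m} → k ≺ m → ¬ (m ≺ _)
      after k≺m m≺x = k⊀x (≺-trans k≺m m≺x)

    private
      -- A witness beyond `x` makes the Until formula true at `x` itself, where `u` carries it over.
      -- The new witness may be a different point, but it again lies beyond `x`.
      transfer : ∀ {x P P′ Q Q′} → (∀ k → ¬ (x ≺ k) → P k → P′ k) →
                 (∀ k → ¬ (x ≺ k) → Q k → Q′ k) →
                 (Until P Q x → Until P′ Q′ x) →
                 ∀ k → ¬ (x ≺ k) → Until P Q k → Until P′ Q′ k
      transfer {x} {P} {P′} p q u k x⊀k (j , k≺j , Qj , h) with compare k x
      ... | tri≈ _ refl _ = u (j , k≺j , Qj , h)
      ... | tri> _ _ x≺k = ⊥-elim (x⊀k x≺k)
      ... | tri< k≺x _ _ with compare j x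
      ...   | tri< j≺x _ x⊀j = j , k≺j , q j x⊀j Qj ,
                λ m l r → p m (λ x≺m → x⊀j (≺-trans x≺m r)) (h m l r)
      ...   | tri≈ _ refl x⊀j = j , k≺j , q j x⊀j Qj ,
                λ m l r → p m (λ x≺m → x⊀j (≺-trans x≺m r)) (h m l r)
      ...   | tri> _ _ x≺j with u (j , x≺j , Qj , λ m l r → h m (≺-trans k≺x l) r)
      ...     | j′ , x≺j′ , Qj′ , h′ = j′ , ≺-trans k≺x x≺j′ , Qj′ , inner
        where
        inner : ∀ m → k ≺ m → m ≺ j′ → _
        inner m l r with compare m x
        ... | tri< m≺x _ x⊀m = p m x⊀m (h m l (≺-trans m≺x x≺j))
        ... | tri≈ _ refl x⊀m = p m x⊀m (h m l x≺j)
        ... | tri> _ _ x≺m = h′ m x≺m r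

    until-before : ∀ {x P P′ Q Q′} → Before x P P′ → Before x Q Q′ →
                   Until P Q x ⇔ Until P′ Q′ x →
                   Before x (Until P Q) (Until P′ Q′)
    until-before p q u k x⊀k = mk⇔
      (transfer (λ k l → to (p k l)) (λ k l → to (q k l)) (to u) k x⊀k)
      (transfer (λ k l → from (p k l)) (λ k l → from (q k l)) (from u) k x⊀k)

  -- Since is Until for the reversed order, so only one of the two is treated.
  <-sto : IsStrictTotalOrder _≡_ ℤ._<_
  <-sto = ℤ.<-isStrictTotalOrder

  >-sto : IsStrictTotalOrder _≡_ (flip ℤ._<_)
  >-sto = Flip.isStrictTotalOrder <-sto

  open Until using (Until; until-cong)
  module Future = GlueUntil <-sto
  module Past = GlueUntil >-sto

  -- Strict Until and Since express all other modalities, so gluing has just two temporal cases.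
  data Core : Set where
    top   : Core
    atom  : ℕ → Core
    neg   : Core → Core
    and until since : Core → Core → Core

  infix 4 _,_⊨_

  _,_⊨_ : Interpretation → ℤ → Core → Set
  M , n ⊨ top       = ⊤
  M , n ⊨ atom i    = M i n
  M , n ⊨ neg φ     = ¬ (M , n ⊨ φ)
  M , n ⊨ and φ ψ   = (M , n ⊨ φ) × (M , n ⊨ ψ)
  M , n ⊨ until φ ψ = Until ℤ._<_ (λ m → M , m ⊨ φ) (λ m → M , m ⊨ ψ) n
  M , n ⊨ since φ ψ = Until (flip ℤ._<_) (λ m → M , m ⊨ φ) (λ m → M , m ⊨ ψ) n

  -- Split off from `children` so that a formula is found in its own list by `here`, without a case
  -- distinction on the formula.
  subs : Core → List Core
  children : Core → List Core
  subs φ = φ ∷ children φ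
  children top         = []
  children (atom _)    = []
  children (neg φ)     = subs φ
  children (and φ ψ)   = subs φ ++ subs ψ
  children (until φ ψ) = subs φ ++ subs ψ
  children (since φ ψ) = subs φ ++ subs ψ

  subs-trans : ∀ {ψ χ} φ → ψ ∈ˡ subs φ → χ ∈ˡ subs ψ → χ ∈ˡ subs φ
  subs-trans φ (here refl) χ∈ = χ∈
  subs-trans (neg φ) (there ψ∈) χ∈ = there (subs-trans φ ψ∈ χ∈)
  subs-trans (and φ φ′) (there ψ∈) χ∈ with ∈-++⁻ (subs φ) ψ∈
  ... | inj₁ ψ∈ = there (∈-++⁺ˡ (subs-trans φ ψ∈ χ∈))
  ... | inj₂ ψ∈ = there (∈-++⁺ʳ (subs φ) (subs-trans φ′ ψ∈ χ∈))
  subs-trans (until φ φ′) (there ψ∈) χ∈ with ∈-++⁻ (subs φ) ψ∈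
  ... | inj₁ ψ∈ = there (∈-++⁺ˡ (subs-trans φ ψ∈ χ∈))
  ... | inj₂ ψ∈ = there (∈-++⁺ʳ (subs φ) (subs-trans φ′ ψ∈ χ∈))
  subs-trans (since φ φ′) (there ψ∈) χ∈ with ∈-++⁻ (subs φ) ψ∈
  ... | inj₁ ψ∈ = there (∈-++⁺ˡ (subs-trans φ ψ∈ χ∈))
  ... | inj₂ ψ∈ = there (∈-++⁺ʳ (subs φ) (subs-trans φ′ ψ∈ χ∈))

  Agree : List Core → Interpretation → ℤ → Interpretation → ℤ → Set
  Agree Γ M m N n = ∀ {φ} → φ ∈ˡ Γ → M , m ⊨ φ ⇔ N , n ⊨ φ

  module Glue {M M′ N : Interpretation} (x : ℤ) where
    open Future using (Before; After)

    Glued : Core → Set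
    Glued φ = Before x (N ,_⊨ φ) (M ,_⊨ φ) × After x (N ,_⊨ φ) (M′ ,_⊨ φ)

    private
      refl-⊀ : ¬ (x ℤ.< x)
      refl-⊀ = ℤ.<-irrefl refl

      at : ∀ {φ} → M , x ⊨ φ ⇔ M′ , x ⊨ φ → After x (N ,_⊨ φ) (M′ ,_⊨ φ) →
           N , x ⊨ φ ⇔ M , x ⊨ φ
      at e a = ⇔-sym e ⇔-∘ a x refl-⊀

      at′ : ∀ {φ} → M , x ⊨ φ ⇔ M′ , x ⊨ φ → Before x (N ,_⊨ φ) (M ,_⊨ φ) →
            N , x ⊨ φ ⇔ M′ , x ⊨ φ
      at′ e b = e ⇔-∘ b x refl-⊀

    -- Induction on `φ`. For `until`, the points from `x` on see only `M′`, so `N` agrees with `M′`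
    -- at `x`; the agreement of `M` and `M′` there turns this into agreement with `M`, from which
    -- the points before `x` follow. `since` is the mirror image.
    glue : ∀ φ → Agree (subs φ) M x M′ x → (∀ {i} → atom i ∈ˡ subs φ → Glued (atom i)) → Glued φ
    glue top _ _ = (λ _ _ → ⇔-id _) , (λ _ _ → ⇔-id _)
    glue (atom i) _ a = a (here refl)
    glue (neg φ) e a =
      let b , c = glue φ (e ∘ there) (a ∘ there)
      in (λ k l → ¬-cong (b k l)) , (λ k l → ¬-cong (c k l))
    glue (and φ ψ) e a =
      let b , c = glue φ (e ∘ there ∘ ∈-++⁺ˡ) (a ∘ there ∘ ∈-++⁺ˡ)
          b′ , c′ = glue ψ (e ∘ there ∘ ∈-++⁺ʳ (subs φ)) (a ∘ there ∘ ∈-++⁺ʳ (subs φ))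
      in (λ k l → ×-cong (b k l) (b′ k l)) , (λ k l → ×-cong (c k l) (c′ k l))
    glue (until φ ψ) e a =
      let b , c = glue φ (e ∘ there ∘ ∈-++⁺ˡ) (a ∘ there ∘ ∈-++⁺ˡ)
          b′ , c′ = glue ψ (e ∘ there ∘ ∈-++⁺ʳ (subs φ)) (a ∘ there ∘ ∈-++⁺ʳ (subs φ))
          after = Future.until-after c c′
      in Future.until-before b b′ (at {until φ ψ} (e (here refl)) after) , after
    glue (since φ ψ) e a =
      let b , c = glue φ (e ∘ there ∘ ∈-++⁺ˡ) (a ∘ there ∘ ∈-++⁺ˡ)
          b′ , c′ = glue ψ (e ∘ there ∘ ∈-++⁺ʳ (subs φ)) (a ∘ there ∘ ∈-++⁺ʳ (subs φ))
          before = Past.until-after b b′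
      in before , Past.until-before c c′ (at′ {since φ ψ} (e (here refl)) before)

  -- Translation in time.

  shift : ℤ → Interpretation → Interpretation
  shift c M i n = M i (n ℤ.+ c)

  module _ (c : ℤ) where
    private
      back : ∀ n → (n ℤ.- c) ℤ.+ c ≡ n
      back n = trans (ℤ.+-assoc n (ℤ.- c) c)
                 (trans (cong (λ m → n ℤ.+ m) (ℤ.+-inverseˡ c)) (ℤ.+-identityʳ n))

      mono : ∀ {m n} → m ℤ.< n → m ℤ.+ c ℤ.< n ℤ.+ c
      mono = ℤ.+-monoˡ-< c

      anti : ∀ {m n} → m ℤ.+ c ℤ.< n ℤ.+ c → m ℤ.< n
      anti {m} {n} l with ℤ.<-cmp m n
      ... | tri< m<n _ _ = m<n
      ... | tri≈ _ refl _ = ⊥-elim (ℤ.<-irrefl refl l)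
      ... | tri> _ _ n<m = ⊥-elim (ℤ.<-asym l (mono n<m))

      until-shift : (_≺_ : Rel ℤ 0ℓ) → (∀ {m n} → m ≺ n → (m ℤ.+ c) ≺ (n ℤ.+ c)) →
                    (∀ {m n} → (m ℤ.+ c) ≺ (n ℤ.+ c) → m ≺ n) →
                    ∀ {P P′ Q Q′ : Pred ℤ 0ℓ} → (∀ n → P n ⇔ P′ (n ℤ.+ c)) →
                    (∀ n → Q n ⇔ Q′ (n ℤ.+ c)) →
                    ∀ n → Until _≺_ P Q n ⇔ Until _≺_ P′ Q′ (n ℤ.+ c)
      until-shift _≺_ mono anti {P} {P′} {Q} {Q′} p q n = mk⇔
        (λ (k , n≺k , Qk , h) → k ℤ.+ c , mono n≺k , to (q k) Qk , λ m l r →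
          let m≡ = back m
          in subst P′ m≡ (to (p (m ℤ.- c))
               (h _ (anti (subst (_ ≺_) (sym m≡) l)) (anti (subst (_≺ _) (sym m≡) r)))))
        (λ (k , n≺k , Qk , h) →
          let k≡ = sym (back k)
          in k ℤ.- c , anti (subst (_ ≺_) k≡ n≺k) , from (q _) (subst Q′ k≡ Qk) ,
             λ m l r → from (p m) (h _ (mono l) (subst (_ ≺_) (sym k≡) (mono r))))

    shift-⊨ : ∀ {M} φ n → shift c M , n ⊨ φ ⇔ M , n ℤ.+ c ⊨ φ
    shift-⊨ top n = ⇔-id _
    shift-⊨ (atom i) n = ⇔-id _
    shift-⊨ (neg φ) n = ¬-cong (shift-⊨ φ n)
    shift-⊨ (and φ ψ) n = ×-cong (shift-⊨ φ n) (shift-⊨ ψ n)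
    shift-⊨ (until φ ψ) = until-shift ℤ._<_ mono anti (shift-⊨ φ) (shift-⊨ ψ)
    shift-⊨ (since φ ψ) = until-shift (flip ℤ._<_) mono anti (shift-⊨ φ) (shift-⊨ ψ)

  -- Next becomes Until with an unsatisfiable left argument: no point may lie strictly in between,
  -- so the witness is the immediate neighbour.
  core : Concept → Core
  core ⊤′       = top
  core (atom i) = atom i
  core (¬′ κ)   = neg (core κ)
  core (κ ∧′ ϰ) = and (core κ) (core ϰ)
  core (κ ∨′ ϰ) = neg (and (neg (core κ)) (neg (core ϰ)))
  core (○F κ)   = until (neg top) (core κ)
  core (◇F κ)   = until top (core κ)
  core (□F κ)   = neg (until top (neg (core κ)))
  core (κ 𝒰 ϰ)  = until (core κ) (core ϰ)
  core (○P κ)   = since (neg top) (core κ)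
  core (◇P κ)   = since top (core κ)
  core (□P κ)   = neg (since top (neg (core κ)))
  core (κ 𝒮 ϰ)  = since (core κ) (core ϰ)

  bigAnd : {A : Set} → (A → Core) → List A → Core
  bigAnd f []       = top
  bigAnd f (x ∷ xs) = and (f x) (bigAnd f xs)

  bigAnd-⊨ : ∀ {A : Set} {M n} (f : A → Core) xs → M , n ⊨ bigAnd f xs ⇔ All (λ x → M , n ⊨ f x) xs
  bigAnd-⊨ f []       = mk⇔ (λ _ → []) (λ _ → tt)
  bigAnd-⊨ f (x ∷ xs) = mk⇔
    (λ (p , ps) → p ∷ to (bigAnd-⊨ f xs) ps)
    (λ { (p ∷ ps) → p , from (bigAnd-⊨ f xs) ps })

  basic : Basic → Core
  basic C = core ⌜ C ⌝

  clauseCore : Clause → Core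
  clauseCore (Cs ⇒ Ds) = neg (and (bigAnd basic Cs) (bigAnd (neg ∘ basic) Ds))

  next-until : ∀ (_≺_ : Rel ℤ 0ℓ) {P P′ : Pred ℤ 0ℓ} {n s} → n ≺ s →
               (∀ {k} → n ≺ k → k ≡ s ⊎ s ≺ k) → (∀ {k} → n ≺ k → ¬ (k ≺ s)) →
               P s ⇔ P′ s → P s ⇔ Until _≺_ (λ _ → ¬ ⊤) P′ n
  next-until _≺_ {P} {P′} {n} {s} n≺s least gap e = mk⇔
    (λ Ps → s , n≺s , to e Ps , λ m l r → ⊥-elim (gap l r)) back
    where
    back : Until _≺_ (λ _ → ¬ ⊤) P′ n → P s
    back (k , n≺k , Pk , h) with least n≺k
    ... | inj₁ refl = from e Pk
    ... | inj₂ s≺k  = ⊥-elim (h s n≺s s≺k tt)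

  n<suc[n] : ∀ n → n ℤ.< ℤ.suc n
  n<suc[n] n = ℤ.suc[i]≤j⇒i<j ℤ.≤-refl

  pred[n]<n : ∀ n → ℤ.pred n ℤ.< n
  pred[n]<n n = ℤ.i≤pred[j]⇒i<j ℤ.≤-refl

  ≤-split : ∀ {m n} → m ℤ.≤ n → n ≡ m ⊎ m ℤ.< n
  ≤-split {m} {n} m≤n with ℤ.<-cmp m n
  ... | tri< m<n _ _ = inj₂ m<n
  ... | tri≈ _ m≡n _ = inj₁ (sym m≡n)
  ... | tri> _ _ n<m = ⊥-elim (ℤ.<⇒≱ n<m m≤n)

  ≤-split′ : ∀ {m n} → m ℤ.≤ n → m ≡ n ⊎ m ℤ.< n
  ≤-split′ m≤n with ≤-split m≤n
  ... | inj₁ refl = inj₁ refl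
  ... | inj₂ m<n  = inj₂ m<n

  module _ (em : ExcludedMiddle 0ℓ) where
    open Classical em

    private
      until-⊤ : ∀ (_≺_ : Rel ℤ 0ℓ) {P P′ : Pred ℤ 0ℓ} → (∀ n → P n ⇔ P′ n) → ∀ n →
                (∃[ k ] n ≺ k × P k) ⇔ Until _≺_ (λ _ → ⊤) P′ n
      until-⊤ _≺_ p n = mk⇔
        (λ (k , l , Pk) → k , l , to (p k) Pk , λ _ _ _ → tt)
        (λ (k , l , Pk , _) → k , l , from (p k) Pk)

      always : ∀ (_≺_ : Rel ℤ 0ℓ) {P P′ : Pred ℤ 0ℓ} → (∀ n → P n ⇔ P′ n) → ∀ n →
               (∀ k → n ≺ k → P k) ⇔ (¬ Until _≺_ (λ _ → ⊤) (λ k → ¬ P′ k) n)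
      always _≺_ p n = mk⇔
        (λ h (k , l , ¬Pk , _) → ¬Pk (to (p k) (h k l)))
        (λ h k l → stable (λ ¬Pk → h (k , l , ¬Pk ∘ from (p k) , λ _ _ _ → tt)))

    core-⊨ : ∀ {M} κ n → n ∈ ⟦ κ ⟧ M ⇔ M , n ⊨ core κ
    core-⊨ ⊤′ n = ⇔-id _
    core-⊨ (atom i) n = ⇔-id _
    core-⊨ (¬′ κ) n = ¬-cong (core-⊨ κ n)
    core-⊨ (κ ∧′ ϰ) n = ×-cong (core-⊨ κ n) (core-⊨ ϰ n)
    core-⊨ {M} (κ ∨′ ϰ) n = mk⇔
      (λ { (inj₁ a) (¬a , _) → ¬a (to (core-⊨ κ n) a) ; (inj₂ b) (_ , ¬b) → ¬b (to (core-⊨ ϰ n) b) })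
      (λ h → stable (λ g → h (g ∘ inj₁ ∘ from (core-⊨ κ n) , g ∘ inj₂ ∘ from (core-⊨ ϰ n))))
    core-⊨ {M} (○F κ) n = next-until ℤ._<_ {⟦ κ ⟧ M} (n<suc[n] n)
      (≤-split ∘ ℤ.i<j⇒suc[i]≤j) (λ n<k k<s → ℤ.<⇒≱ k<s (ℤ.i<j⇒suc[i]≤j n<k))
      (core-⊨ κ (ℤ.suc n))
    core-⊨ (◇F κ) = until-⊤ ℤ._<_ (core-⊨ κ)
    core-⊨ (□F κ) = always ℤ._<_ (core-⊨ κ)
    core-⊨ (κ 𝒰 ϰ) n = until-cong ℤ._<_ (λ m _ → core-⊨ κ m) (λ m _ → core-⊨ ϰ m)
    core-⊨ {M} (○P κ) n = next-until (flip ℤ._<_) {⟦ κ ⟧ M} (pred[n]<n n)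
      (≤-split′ ∘ ℤ.i<j⇒i≤pred[j]) (λ k<n p<k → ℤ.<⇒≱ p<k (ℤ.i<j⇒i≤pred[j] k<n))
      (core-⊨ κ (ℤ.pred n))
    core-⊨ (◇P κ) = until-⊤ (flip ℤ._<_) (core-⊨ κ)
    core-⊨ (□P κ) = always (flip ℤ._<_) (core-⊨ κ)
    -- Over the reversed order, `Until` receives the two bounds on `m` in the opposite order to `𝒮`.
    core-⊨ {M} (κ 𝒮 ϰ) n = until-cong (flip ℤ._<_) (λ m _ → core-⊨ κ m) (λ m _ → core-⊨ ϰ m) ⇔-∘
      mk⇔ (λ (k , l , Q , h) → k , l , Q , λ m r s → h m s r)
          (λ (k , l , Q , h) → k , l , Q , λ m r s → h m s r)

    clause-⊨ : ∀ {M} c → TrueIn M c ⇔ (∀ n → M , n ⊨ clauseCore c)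
    clause-⊨ {M} (Cs ⇒ Ds) = mk⇔
      (λ h n (ps , ¬qs) → All¬⇒¬Any
        (All.map (λ {D} ¬q → ¬q ∘ to (core-⊨ ⌜ D ⌝ n)) (to (bigAnd-⊨ (neg ∘ basic) Ds) ¬qs))
        (h n (All.map (λ {C} → from (core-⊨ ⌜ C ⌝ n)) (to (bigAnd-⊨ basic Cs) ps))))
      (λ h n ps → stable (λ ¬any → h n
        ( from (bigAnd-⊨ basic Cs) (All.map (λ {C} → to (core-⊨ ⌜ C ⌝ n)) ps)
        , from (bigAnd-⊨ (neg ∘ basic) Ds)
            (All.map (λ {D} ¬q → ¬q ∘ from (core-⊨ ⌜ D ⌝ n)) (¬Any⇒All¬ Ds ¬any)))))

    ontology-⊨ : ∀ {M} 𝒪 → All (TrueIn M) 𝒪 ⇔ (∀ n → M , n ⊨ bigAnd clauseCore 𝒪)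
    ontology-⊨ 𝒪 = mk⇔
      (λ h n → from (bigAnd-⊨ clauseCore 𝒪) (All.map (λ {c} t → to (clause-⊨ c) t n) h))
      (λ h → All.tabulate λ {c} c∈ →
        from (clause-⊨ c) (λ n → All.lookup (to (bigAnd-⊨ clauseCore 𝒪) (h n)) c∈))

    -- Interpretations form a type in `Set₁`, so a statement that some model exists is beyond
    -- excluded middle at level 0. Ranging over Boolean interpretations keeps such statements in
    -- `Set`, where `decide` applies.
    BoolInterpretation : Set
    BoolInterpretation = ℕ → ℤ → Bool

    lift : BoolInterpretation → Interpretation
    lift M i n = M i n ≡ true

    module _ (Γ : List Core) where

      private
        finite : Finite (Vec Bool (List.length Γ))
        finite = finite-Vec finite-Bool _

        open Injection (↔⇒↣ (proj₂ finite)) using (injective) renaming (to to encodeVec)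

      types : ℕ
      types = proj₁ finite

      type : Interpretation → ℤ → Fin types
      type M n = encodeVec (Vec.tabulate λ j → decide (M , n ⊨ List.lookup Γ j))

      type-cong : ∀ {M m N n} → Agree Γ M m N n → type M m ≡ type N n
      type-cong a = cong encodeVec (tabulate-cong λ j → decide-cong (a (∈-lookup j)))

      type-injective : ∀ {M m N n} → type M m ≡ type N n → Agree Γ M m N n
      type-injective {M} {m} {N} {n} e φ∈ =
        subst (λ φ → M , m ⊨ φ ⇔ N , n ⊨ φ) (sym (lookup-index φ∈)) (decide-injective
          (trans (sym (lookup∘tabulate _ j))
            (trans (cong (λ v → Vec.lookup v j) (injective e)) (lookup∘tabulate _ j))))
        where j = Any.index φ∈

    -- The states are the types realised in models of the ontology, so gluing
    -- makes every run the sequence of types of a single model.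
    module TypeAutomaton (𝒪 : Ontology) (κ : Concept) where

      Ω K Φ : Core
      Ω = bigAnd clauseCore 𝒪
      K = core κ
      Φ = and Ω K

      Γ : List Core
      Γ = subs Φ

      Ω∈ : Ω ∈ˡ Γ
      Ω∈ = there (here refl)

      K∈ : K ∈ˡ Γ
      K∈ = there (∈-++⁺ʳ (subs Ω) (here refl))

      Good : Interpretation → Set
      Good M = ∀ n → M , n ⊨ Ω

      -- `zero` stands for the moment before time 0 and is never entered again. It leads to every
      -- type realised anywhere in a model, since whatever precedes that point serves as the past.
      step : Fin (suc (types Γ)) → Fin (suc (types Γ)) → Set
      step _       zero    = ⊥
      step zero    (suc q) = ∃[ M ] Good (lift M) × ∃[ n ] type Γ (lift M) n ≡ q
      step (suc p) (suc q) = ∃[ M ] Good (lift M) × ∃[ n ]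
        type Γ (lift M) n ≡ p × type Γ (lift M) (ℤ.suc n) ≡ q

      -- A type fixes the truth values of the atoms of `Γ`, so one witnessing point speaks for all
      -- points of type `q`; the same holds for `refute`. Atoms outside `Γ` are never forbidden.
      forbid : Fin (suc (types Γ)) → ℕ → Set
      forbid zero    i = ⊥
      forbid (suc q) i = atom i ∈ˡ Γ × ∃[ M ] ∃[ n ] type Γ (lift M) n ≡ q × M i n ≡ false

      refute : Fin (suc (types Γ)) → Set
      refute zero    = ⊥
      refute (suc q) = ∃[ M ] ∃[ n ] type Γ (lift M) n ≡ q × ¬ (lift M , n ⊨ K)

      index : Core → ℕ
      index (atom i) = i
      index _        = 0

      -- The sum stands in for the maximum, as any upper bound on the atom indices will do for
      -- `bound`.
      ∈⇒≤sum : ∀ {φ Δ} → φ ∈ˡ Δ → index φ ℕ.≤ sum (List.map index Δ)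
      ∈⇒≤sum (here refl) = ℕ.m≤m+n _ _
      ∈⇒≤sum {Δ = ψ ∷ _} (there φ∈) = ℕ.m≤n⇒m≤o+n (index ψ) (∈⇒≤sum φ∈)

      automaton : Automaton
      automaton = record
        { states  = suc (types Γ)
        ; start   = zero
        ; δ       = λ p q → decide (step p q)
        ; forbids = λ q i → decide (forbid q i)
        ; refutes = λ q → decide (refute q)
        ; bound   = suc (sum (List.map index Γ))
        ; bounded = λ { zero e → ⊥-elim (to decide⇔ e)
                      ; (suc q) e → ℕ.s≤s (∈⇒≤sum (proj₁ (to decide⇔ e))) }
        }

      open Automaton automaton

      -- Truth depends only on the atoms of `Γ`: gluing `M` to itself at `n` yields this without a
      -- separate induction.
      agree-everywhere : ∀ {M N : Interpretation} →
        (∀ {i} → atom i ∈ˡ Γ → ∀ n → N i n ⇔ M i n) → ∀ n → Agree Γ N n M n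
      agree-everywhere {M} {N} e n {φ} φ∈ =
        proj₁ (Glue.glue {M} {M} {N} n φ (λ _ → ⇔-id _)
          (λ i∈ → let e′ = e (subs-trans Φ φ∈ i∈) in (λ k _ → e′ k) , (λ k _ → e′ k)))
          n (ℤ.<-irrefl refl)

      splice : ℤ → BoolInterpretation → BoolInterpretation → BoolInterpretation
      splice x M M′ i n = if does (x ℤ.<? n) then M′ i n else M i n

      module _ {M M′ : BoolInterpretation} (x : ℤ) (e : type Γ (lift M) x ≡ type Γ (lift M′) x) where

        private
          N = splice x M M′

          agrees : Agree Γ (lift M) x (lift M′) x
          agrees = type-injective Γ {lift M} {x} {lift M′} {x} e

          left-of : ∀ {i k} → ¬ (x ℤ.< k) → N i k ≡ M i k
          left-of {k = k} x≮k with x ℤ.<? k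
          ... | yes x<k = ⊥-elim (x≮k x<k)
          ... | no _    = refl

          right-of : ∀ {i k} → atom i ∈ˡ Γ → ¬ (k ℤ.< x) → lift N i k ⇔ lift M′ i k
          right-of {i} {k} i∈ k≮x with ≤-split (ℤ.≮⇒≥ k≮x)
          -- At `x` itself the splice takes its value from `M`; equality of types makes it the value
          -- of `M′` too.
          ... | inj₁ refl = subst (λ b → b ≡ true ⇔ M′ i x ≡ true) (sym (left-of {i} (ℤ.<-irrefl refl))) (agrees i∈)
          ... | inj₂ x<k with x ℤ.<? k
          ...   | yes _   = ⇔-id _
          ...   | no x≮k = ⊥-elim (x≮k x<k)

          glued : ∀ {φ} → φ ∈ˡ Γ → Glue.Glued {lift M} {lift M′} {lift N} x φ
          glued {φ} φ∈ = Glue.glue x φ (agrees ∘ subs-trans Φ φ∈) λ {i} i∈ →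
            (λ k l → subst (λ b → lift N i k ⇔ b ≡ true) (left-of {i} l) (⇔-id _)) ,
            (λ k l → right-of (subs-trans Φ φ∈ i∈) l)

        splice-before : ∀ {k} → ¬ (x ℤ.< k) → Agree Γ (lift N) k (lift M) k
        splice-before l φ∈ = proj₁ (glued φ∈) _ l

        splice-after : ∀ {k} → ¬ (k ℤ.< x) → Agree Γ (lift N) k (lift M′) k
        splice-after l φ∈ = proj₂ (glued φ∈) _ l

        -- `Ω` is a member of `Γ`, so each point inherits it from the model on its side of `x`.
        splice-good : Good (lift M) → Good (lift M′) → Good (lift N)
        splice-good g g′ n with x ℤ.<? n
        ... | yes x<n = from (splice-after (ℤ.<-asym x<n) Ω∈) (g′ n)
        ... | no x≮n  = from (splice-before x≮n Ω∈) (g n)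

      Realised : (ℕ → Fin states → Set) → ℕ → BoolInterpretation → Set
      Realised C t M = Good (lift M) × (∀ s → s ℕ.≤ t → C s (suc (type Γ (lift M) (+ s))))

      -- The model grows by one transition at a time: the model behind the next transition is
      -- shifted until its first point lies at `t`, and spliced in there together with its whole
      -- future.
      realise : ∀ {C} t {q} → Reach C (suc t) (suc q) →
                ∃[ M ] Realised C t M × type Γ (lift M) (+ t) ≡ q
      realise {C} zero {q} ((.zero , refl , d) , c) =
        let M , g , n , e = to decide⇔ d
            M′ = λ i m → M i (m ℤ.+ n)
            agree : ∀ m → Agree Γ (lift M′) m (lift M) (m ℤ.+ n)
            agree = λ m {φ} _ → shift-⊨ n φ m
            e′ : type Γ (lift M′) (+ 0) ≡ q
            e′ = trans (type-cong Γ (agree (+ 0))) (trans (cong (type Γ (lift M)) (ℤ.+-identityˡ n)) e)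
        in M′ , ((λ m → from (agree m Ω∈) (g _)) ,
                 λ { .zero ℕ.z≤n → subst (λ p → C 0 (suc p)) (sym e′) c }) , e′
      realise {C} (suc t) {q} ((zero , ((_ , _ , d) , _) , _) , _) = ⊥-elim (to (decide⇔ {⊥}) d)
      realise {C} (suc t) {q} ((suc p , r , d) , c) =
        let M , (g , h) , e = realise t r
            M′ , g′ , n , e₁ , e₂ = to decide⇔ d
            c′ = n ℤ.- + t
            M″ = λ i m → M′ i (m ℤ.+ c′)
            agree : ∀ m → Agree Γ (lift M″) m (lift M′) (m ℤ.+ c′)
            agree = λ m {φ} _ → shift-⊨ c′ φ m
            x = + t
            here-t : x ℤ.+ c′ ≡ n
            here-t = trans (ℤ.+-comm x c′) (trans (ℤ.+-assoc n (ℤ.- x) x)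
                       (trans (cong (λ m → n ℤ.+ m) (ℤ.+-inverseˡ x)) (ℤ.+-identityʳ n)))
            next-t : + suc t ℤ.+ c′ ≡ ℤ.suc n
            next-t = trans (ℤ.+-assoc 1ℤ x c′) (cong ℤ.suc here-t)
            eq : type Γ (lift M) x ≡ type Γ (lift M″) x
            eq = trans e (sym (trans (type-cong Γ (agree x)) (trans (cong (type Γ (lift M′)) here-t) e₁)))
            N = splice x M M″
            e′ : type Γ (lift N) (+ suc t) ≡ q
            e′ = trans (type-cong Γ (splice-after {M} {M″} x eq (ℤ.≤⇒≯ (ℤ.+≤+ (ℕ.n≤1+n t)))))
                   (trans (type-cong Γ (agree _)) (trans (cong (type Γ (lift M′)) next-t) e₂))
            facts : ∀ s → s ℕ.≤ suc t → C s (suc (type Γ (lift N) (+ s)))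
            facts = λ s s≤ → case ℕ.m≤n⇒m<n∨m≡n s≤ of λ
              { (inj₁ (ℕ.s≤s s≤t)) → subst (λ p → C s (suc p))
                  (sym (type-cong Γ (splice-before {M} {M″} x eq (ℤ.≤⇒≯ (ℤ.+≤+ s≤t))))) (h s s≤t)
              ; (inj₂ refl) → subst (λ p → C (suc t) (suc p)) (sym e′) c }
        in N , (splice-good {M} {M″} x eq g (λ m → from (agree m Ω∈) (g′ _)) , facts) , e′

      module _ (𝒜 : Data) (ℓ : Tem 𝒜) where
        open Data 𝒜 using (atoms; max)

        letter : ℕ → Fin states → Set
        letter t = Reads (λ i → (i , + t) ∈ˡ atoms) (t ≡ toℕ ℓ)

        private
          ℓ≤max : toℕ ℓ ℕ.≤ max
          ℓ≤max = ℕ.s≤s⁻¹ (toℕ<n ℓ)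

          timestamp : ∀ {i n} → (i , n) ∈ˡ atoms → ∃[ s ] s ℕ.≤ max × n ≡ + s
          timestamp {i} {n} i∈ with n | All.lookup (Data.min≤ 𝒜) (∈-map⁺ proj₂ i∈) | All.lookup (Data.≤max 𝒜) (∈-map⁺ proj₂ i∈)
          ... | + s | _ | ℤ.+≤+ s≤ = s , s≤ , refl

        -- A run controls only the atoms of `Γ`, so the realised model may miss facts about other
        -- atoms, and all facts are added to it. For the atoms of `Γ` this changes nothing, and only
        -- these matter to `Ω` and `K`.
        countermodel : ∀ {M} → Realised letter max M → ¬ (ℓ ∈ ans ⟨ 𝒪 , κ ⟩ 𝒜)
        countermodel {M} (g , c) certain = contra (certain N model)
          where
          N : Interpretation
          N i n = M i n ≡ true ⊎ (i , n) ∈ˡ atoms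
          collapse : ∀ {i} → atom i ∈ˡ Γ → ∀ n → N i n → M i n ≡ true
          collapse i∈ n (inj₁ e) = e
          collapse {i} i∈ n (inj₂ a) with timestamp a
          ... | s , s≤ , refl with M i (+ s) in eq
          ...   | true  = refl
          ...   | false = case trans (sym (proj₁ (c s s≤) i a)) (from decide⇔ (i∈ , M , + s , refl , eq)) of λ ()
          agree : ∀ n → Agree Γ N n (lift M) n
          agree = agree-everywhere λ i∈ n → mk⇔ (collapse i∈ n) inj₁
          model : Model 𝒪 𝒜 N
          model = record { ontology = from (ontology-⊨ 𝒪) (λ n → from (agree n Ω∈) (g n)) ; facts = inj₂ }
          contra : ¬ (time 𝒜 ℓ ∈ ⟦ κ ⟧ N)
          contra l∈ =
            let M′ , n , e , ¬k = to decide⇔ (proj₂ (c (toℕ ℓ) ℓ≤max) refl)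
            in ¬k (from (type-injective Γ e K∈) (to (agree _ K∈) (to (core-⊨ κ _) l∈)))

        -- `decide` makes the given model Boolean without altering any truth value of `Γ`; its types
        -- at successive points form the run.
        run : ∀ {M} → Model 𝒪 𝒜 M → ¬ (time 𝒜 ℓ ∈ ⟦ κ ⟧ M) → ∃[ q ] Reach letter (suc max) q
        run {M} model ¬l = _ , reached max
          where
          N : BoolInterpretation
          N i n = decide (M i n)
          agree : ∀ n → Agree Γ (lift N) n M n
          agree = agree-everywhere (λ _ _ → decide⇔)
          g : Good (lift N)
          g n = from (agree n Ω∈) (to (ontology-⊨ 𝒪) (Model.ontology model) n)
          reads : ∀ t → letter t (suc (type Γ (lift N) (+ t)))
          reads t =
            (λ i a → decide-false λ (i∈ , M′ , n , e , f) →
              case trans (sym f) (from (type-injective Γ {lift M′} {n} {lift N} {+ t} e i∈) (from decide⇔ (Model.facts model a))) of λ ()) ,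
            (λ { refl → from decide⇔ (N , + toℕ ℓ , refl , λ k → ¬l (from (core-⊨ κ _) (to (agree _ K∈) k))) })
          reached : ∀ t → Reach letter (suc t) (suc (type Γ (lift N) (+ t)))
          reached zero    = (zero , refl , from decide⇔ (N , g , + 0 , refl)) , reads zero
          reached (suc t) = (_ , reached t , from decide⇔ (N , g , + t , refl , refl)) , reads (suc t)

        ans⇔ : ℓ ∈ ans ⟨ 𝒪 , κ ⟩ 𝒜 ⇔ (¬ (∃[ q ] Reach letter (suc max) q))
        ans⇔ = mk⇔
          (λ { certain (zero , ((_ , _ , d) , _)) → to (decide⇔ {⊥}) d
             ; certain (suc q , r) → let M , realised , _ = realise max r in countermodel realised certain })
          (λ h M model → stable (λ ¬l → h (run model ¬l)))

-- Formulas of both logics expressing that there is no run.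

module Rewriting where

  open Automata

  open import Data.Bool.Base using (Bool; true; false; not; if_then_else_)
  open import Data.Empty using (⊥; ⊥-elim)
  open import Data.Fin.Base as Fin using (Fin; zero; suc; toℕ; fromℕ<; fromℕ; _↑ˡ_)
  open import Data.Fin.Properties using (toℕ<n; toℕ-fromℕ<; toℕ-fromℕ; splitAt-↑ˡ; toℕ-injective; toℕ≤pred[n]; toℕ-inject₁)
  import Data.Fin.Subset as Subset
  open import Data.Fin.Subset.Properties using (_∈?_)
  open import Data.Integer.Base using (+_)
  open import Data.List.Membership.Propositional using () renaming (_∈_ to _∈ˡ_)
  open import Data.Nat.Base as ℕ using (ℕ; zero; suc; _≤_; _<_; s≤s; s≤s⁻¹)
  open import Data.Nat.Properties using (<⇒≤; ≤-antisym; ≮⇒≥; <-irrefl; n<1+n; m<n⇒n≢0; <⇒≱; <-cmp; <-trans)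
  open import Data.Product.Base using (∃-syntax; _×_; _,_; proj₁; proj₂)
  open import Data.Sum.Base using (_⊎_; inj₁; inj₂; [_,_])
  open import Data.Vec.Base as Vec using (Vec; []; _∷_; lookup)
  open import Data.Vec.Properties using (lookup∘tabulate; lookup⇒[]=; []=⇒lookup)
  import Data.Vec.Functional as Fun
  open import Function.Base using (_∘_; case_of_)
  open import Function.Bundles using (_⇔_; mk⇔; Equivalence)
  open import Function.Construct.Composition using (_⇔-∘_)
  open import Function.Construct.Identity using (⇔-id)
  open import Relation.Binary.Definitions using (tri<; tri≈; tri>)
  open import Relation.Binary.PropositionalEquality using (_≡_; _≢_; refl; sym; trans; cong; subst)
  open import Relation.Nullary using (¬_)
  open import Relation.Nullary.Decidable using (decidable-stable)
  open import Relation.Unary using (Pred)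

  open Equivalence using (to; from)

  module Connectives {F : Set} (ff : F) (_or_ : F → F → F) where

    ⋁ : ∀ {k} → (Fin k → F) → F
    ⋁ {zero}  f = ff
    ⋁ {suc k} f = f zero or ⋁ (f ∘ suc)

    guard : Bool → F → F
    guard b φ = if b then φ else ff

    -- In both logics the clauses for the connectives hold definitionally, so they are passed as
    -- equations between types and supplied by `refl`.
    module Semantics (sat : F → Set) (sat-ff : ¬ sat ff)
                     (sat-or : ∀ φ ψ → sat (φ or ψ) ≡ (sat φ ⊎ sat ψ)) where

      ⋁-sat : ∀ {k} (f : Fin k → F) → sat (⋁ f) ⇔ (∃[ i ] sat (f i))
      ⋁-sat {zero}  f = mk⇔ (λ s → ⊥-elim (sat-ff s)) (λ ())
      ⋁-sat {suc k} f rewrite sat-or (f zero) (⋁ (f ∘ suc)) = mk⇔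
        [ (λ s → zero , s) , (λ s → let i , s′ = to (⋁-sat (f ∘ suc)) s in suc i , s′) ]
        (λ { (zero , s) → inj₁ s ; (suc i , s) → inj₂ (from (⋁-sat (f ∘ suc)) (i , s)) })

      guard-sat : ∀ b φ → sat (guard b φ) ⇔ (b ≡ true × sat φ)
      guard-sat true  φ = mk⇔ (λ s → refl , s) proj₂
      guard-sat false φ = mk⇔ (λ s → ⊥-elim (sat-ff s)) (λ ())

  module StepFormula (A : Automaton) {F : Set} (ff : F) (_or_ _and_ : F → F → F) (neg : F → F) where
    open Automaton A
    open Connectives ff _or_ using (⋁; guard)

    -- Reading a letter is tested through its negation, a finite disjunction, because only atoms
    -- below `bound` can be forbidden.
    blocked : (ℕ → F) → F → Fin states → F
    blocked holds mark q =
      ⋁ (λ (i : Fin bound) → guard (forbids q (toℕ i)) (holds (toℕ i))) or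
      guard (not (refutes q)) mark

    -- No point of the structure precedes 0, so the transitions out of `start` are guarded by
    -- `first` instead of `prev`.
    step : F → (Fin states → F) → (ℕ → F) → F → Fin states → F
    step first prev holds mark q =
      (guard (δ start q) first or ⋁ (λ p → guard (δ p q) (prev p))) and neg (blocked holds mark q)

    module Semantics (sat : F → Set) (sat-ff : ¬ sat ff)
                     (sat-or : ∀ φ ψ → sat (φ or ψ) ≡ (sat φ ⊎ sat ψ))
                     (sat-and : ∀ φ ψ → sat (φ and ψ) ≡ (sat φ × sat ψ))
                     (sat-neg : ∀ φ → sat (neg φ) ≡ (¬ sat φ)) where
      open Connectives.Semantics ff _or_ sat sat-ff sat-or

      module _ {first : F} {prev : Fin states → F} {holds : ℕ → F} {mark : F}
               {P : ℕ → Set} {marked : Set}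
               (holds⇔ : ∀ i → sat (holds i) ⇔ P i) (mark⇔ : sat mark ⇔ marked) where

        reads⇔ : ∀ q → (¬ sat (blocked holds mark q)) ⇔ Reads P marked q
        reads⇔ q rewrite sat-or (⋁ (λ (i : Fin bound) → guard (forbids q (toℕ i)) (holds (toℕ i))))
                                (guard (not (refutes q)) mark) = mk⇔
          (λ h → (λ i p → allowed h i p (forbids q i) refl) , (λ m → refuted h m (refutes q) refl))
          (λ { (f , r) → [ (λ s →
                   let i , s′ = to (⋁-sat (λ (i : Fin bound) → guard (forbids q (toℕ i)) (holds (toℕ i)))) s
                       e , p = to (guard-sat _ _) s′
                   in case trans (sym e) (f (toℕ i) (to (holds⇔ _) p)) of λ ())
               , (λ s → let e , m = to (guard-sat _ _) s
                        in clash (r (to mark⇔ m)) e) ] })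
          where
          Blocked : Set
          Blocked = sat (⋁ (λ (i : Fin bound) → guard (forbids q (toℕ i)) (holds (toℕ i)))) ⊎
                    sat (guard (not (refutes q)) mark)
          clash : ∀ {b} → b ≡ true → not b ≡ true → ⊥
          clash refl ()
          allowed : ¬ Blocked → ∀ i → P i → ∀ b → forbids q i ≡ b → forbids q i ≡ false
          allowed h i p false e = e
          allowed h i p true  e = ⊥-elim (h (inj₁ (from (⋁-sat _)
            (fromℕ< i<bound , from (guard-sat _ _)
              ( trans (cong (forbids q) (toℕ-fromℕ< i<bound)) e
              , from (holds⇔ _) (subst P (sym (toℕ-fromℕ< i<bound)) p))))))
            where i<bound = bounded q e
          refuted : ¬ Blocked → marked → ∀ b → refutes q ≡ b → refutes q ≡ true
          refuted h m true  e = e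
          refuted h m false e = ⊥-elim (h (inj₂ (from (guard-sat _ _) (cong not e , from mark⇔ m))))

        module _ (t : ℕ) (first⇔ : sat first ⇔ (t ≡ 0))
                 {C : ℕ → Fin states → Set} (letter : ∀ q → Reads P marked q ⇔ C t q) where

          private
            Enabled : Fin states → Set
            Enabled q = sat (guard (δ start q) first or ⋁ (λ p → guard (δ p q) (prev p)))

          -- Kept apart from `step-sound`: for an arbitrary closed family of sets, `prev` is only
          -- known to include the reachable states.
          step-complete : (∀ p → t ≢ 0 → Reach C t p → sat (prev p)) →
                          ∀ q → Reach C (suc t) q → sat (step first prev holds mark q)
          step-complete h q ((p , r , d) , c)
            rewrite sat-and (guard (δ start q) first or ⋁ (λ p → guard (δ p q) (prev p)))
                            (neg (blocked holds mark q))
                  | sat-neg (blocked holds mark q)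
            = enabled t refl r , from (reads⇔ q) (from (letter q) c)
            where
            enabled : ∀ s → s ≡ t → Reach C s p → Enabled q
            enabled zero e refl = subst (λ X → X) (sym (sat-or _ _))
              (inj₁ (from (guard-sat _ _) (d , from first⇔ (sym e))))
            enabled (suc s) refl r = subst (λ X → X) (sym (sat-or _ _))
              (inj₂ (from (⋁-sat _) (p , from (guard-sat _ _) (d , h p (λ ()) r))))

          step-sound : (∀ p → sat (prev p) → Reach C t p) →
                       ∀ q → sat (step first prev holds mark q) → Reach C (suc t) q
          step-sound h q s with subst (λ X → X) (sat-and _ _) s
          ... | s , n with subst (λ X → X) (sat-or _ _) s
          ...   | inj₁ s₁ = (start , start-reached (to first⇔ (proj₂ g)) , proj₁ g) , c
            where
            g = to (guard-sat _ _) s₁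
            c = to (letter q) (to (reads⇔ q) (subst (λ X → X) (sat-neg _) n))
            start-reached : ∀ {t} → t ≡ 0 → Reach C t start
            start-reached refl = refl
          ...   | inj₂ s₂ = (proj₁ g , h _ (proj₂ g′) , proj₁ g′) , c
            where
            g = to (⋁-sat _) s₂
            g′ = to (guard-sat _ _) (proj₂ g)
            c = to (letter q) (to (reads⇔ q) (subst (λ X → X) (sat-neg _) n))

  last⇔ : ∀ {n} (t : Fin (suc n)) → (¬ (∃[ d ] toℕ {suc n} d ≡ suc (toℕ t))) ⇔ (toℕ t ≡ n)
  last⇔ {n} t = mk⇔
    (λ h → ≤-antisym (toℕ≤pred[n] t) (≮⇒≥ λ l → h (fromℕ< (s≤s l) , toℕ-fromℕ< (s≤s l))))
    (λ e (d , e′) → <-irrefl e (s≤s⁻¹ (subst (_< suc n) e′ (toℕ<n d))))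

  first⇔ : ∀ {n} (t : Fin n) → (¬ (∃[ d ] toℕ t ≡ suc (toℕ {n} d))) ⇔ (toℕ t ≡ 0)
  first⇔ t = mk⇔ (λ h → first t h)
    (λ e (d , e′) → case trans (sym e) e′ of λ ())
    where
    first : ∀ {n} (t : Fin n) → (¬ (∃[ d ] toℕ t ≡ suc (toℕ {n} d))) → toℕ t ≡ 0
    first zero    h = refl
    first (suc t) h = ⊥-elim (h (Fin.inject₁ t , cong suc (sym (toℕ-inject₁ t))))

  module _ (A : Automaton) (𝒜 : Data) (ℓ : Tem 𝒜) where
    open Automaton A
    open Data 𝒜

    Letter : ℕ → Fin states → Set
    Letter t = Reads (λ i → (i , + t) ∈ˡ atoms) (t ≡ toℕ ℓ)

    NoRun : Set
    NoRun = ¬ (∃[ q ] Reach Letter (suc max) q)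

    final⇔ : {S : Tem 𝒜 → Fin states → Set} → (∀ t q → S t q ⇔ Reach Letter (suc (toℕ t)) q) →
             {last : Tem 𝒜 → Set} → (∀ t → last t ⇔ (toℕ t ≡ max)) →
             (¬ (∃[ t ] last t × ∃[ q ] S t q)) ⇔ NoRun
    final⇔ {S} s l = mk⇔
      (λ h (q , r) → h (fromℕ max , from (l _) (toℕ-fromℕ max) , q ,
         from (s _ q) (subst (λ m → Reach Letter (suc m) q) (sym (toℕ-fromℕ max)) r)))
      (λ h (t , e , q , r) → h (q , subst (λ m → Reach Letter (suc m) q) (to (l t) e) (to (s t q) r)))

  module RPR (A : Automaton) where
    open Automaton A

    -- One relation per state. Its argument besides time carries the queried point, since the
    -- variables of a recursive definition are its time and its own arguments only.
    arity : Fun.Vector ℕ states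
    arity _ = 1

    arity⁺ : Fun.Vector ℕ states
    arity⁺ q = suc (arity q)

    module _ {r} {Δ : Fun.Vector ℕ r} where

      ff : ∀ {n} → FORPR Δ (suc n)
      ff = ¬′ (zero ≈′ zero)

      module _ {m} (a : Fun.Vector ℕ m) where

        arity≡ : ∀ q → a q ≡ (a Fun.++ Δ) (q ↑ˡ r)
        arity≡ q = sym (cong [ a , Δ ] (splitAt-↑ˡ m q r))

        relˡ : ∀ {n} (q : Fin m) → Vec (Fin n) (a q) → FORPR (a Fun.++ Δ) n
        relˡ q xs = rel (q ↑ˡ r) (subst (Vec _) (arity≡ q) xs)

        -- `splitAt` does not reduce on `q ↑ˡ r` for a variable `q`, so its result is generalised
        -- before it is matched.
        relˡ-sat : ∀ {𝔄 n} {P : Relations (Structure.size 𝔄) a} {R : Relations (Structure.size 𝔄) Δ} q xs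
                   (v : Vec _ n) → satFORPR 𝔄 (relˡ q xs) (P ⊕ R) v ≡ P q (Vec.map (lookup v) xs)
        relˡ-sat {𝔄} {P = P} {R} q xs v = go _ (splitAt-↑ˡ m q r)
          where
          N = Structure.size 𝔄
          go : ∀ s (e : s ≡ inj₁ q) →
               [_,_] {C = λ s → Pred (Vec (Fin N) ([ a , Δ ] s)) 0ℓ} P R s
                 (Vec.map (lookup v) (subst (Vec _) (sym (cong [ a , Δ ] e)) xs)) ≡
               P q (Vec.map (lookup v) xs)
          go _ refl = refl

    Context : Fun.Vector ℕ (states ℕ.+ 0)
    Context = arity Fun.++ Fun.[]

    open StepFormula A {FORPR Context 2} ff _∨′_ _∧′_ ¬′_

    first : FORPR Context 2
    first = ¬′ ∃₁ (succ zero (suc zero))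

    Θ : Fin states → FORPR Context 2
    Θ = step first (λ p → relˡ arity p (suc zero ∷ [])) (λ i → pred i zero) (zero ≈′ suc zero)

    formula : FORPR Fun.[] 1
    formula = rec arity Θ (¬′ ∃₁ (¬′ ∃₁ (succ (suc zero) zero) ∧′
      Connectives.⋁ ff _∨′_ (λ q → relˡ arity⁺ q (zero ∷ suc zero ∷ []))))

    -- The empty environment is a variable because absurd lambdas written in different places need
    -- not be definitionally equal.
    module _ (𝒜 : Data) (ℓ : Tem 𝒜) (R₀ : Relations (suc (Data.max 𝒜)) Fun.[]) where
      open Data 𝒜 using (atoms; max)

      private
        C = Letter A 𝒜 ℓ

        Step : Tem 𝒜 → Relations (suc max) arity → Relations (suc max) arity
        Step t P q z = satFORPR (𝔖 𝒜) (Θ q) (P ⊕ R₀) (t ∷ z)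

        step⇔ : ∀ t {P} → (∀ p → P p (ℓ ∷ []) ⇔ (toℕ t ≢ 0 × Reach C (toℕ t) p)) →
                ∀ q → Step t P q (ℓ ∷ []) ⇔ Reach C (suc (toℕ t)) q
        step⇔ t {P} h q = mk⇔
          (step-sound {holds = λ i → pred i zero} holds⇔ mark⇔ (toℕ t) (first⇔ t) {C} (λ _ → ⇔-id _)
            (λ p s → proj₂ (to (h p) (subst (λ X → X) (prev p) s))) q)
          (step-complete {holds = λ i → pred i zero} holds⇔ mark⇔ (toℕ t) (first⇔ t) {C} (λ _ → ⇔-id _)
            (λ p t≢0 r → subst (λ X → X) (sym (prev p)) (from (h p) (t≢0 , r))) q)
          where
          open Semantics (λ φ → satFORPR (𝔖 𝒜) φ (P ⊕ R₀) (t ∷ ℓ ∷ []))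
                         (λ s → s refl) (λ _ _ → refl) (λ _ _ → refl) (λ _ → refl)
          holds⇔ : ∀ i → _ ⇔ _
          holds⇔ i = ⇔-id ((i , + toℕ t) ∈ˡ atoms)
          mark⇔ : (t ≡ ℓ) ⇔ (toℕ t ≡ toℕ ℓ)
          mark⇔ = mk⇔ (cong toℕ) toℕ-injective
          prev : ∀ p → satFORPR (𝔖 𝒜) (relˡ arity p (suc zero ∷ [])) (P ⊕ R₀) (t ∷ ℓ ∷ []) ≡ P p (ℓ ∷ [])
          prev p = relˡ-sat arity {𝔖 𝒜} p (suc zero ∷ []) (t ∷ ℓ ∷ [])

        -- All relations are false at time -1, whereas `Reach C 0` contains `start`; hence the
        -- condition `k ≢ 0`.
        before⇔ : ∀ k .(k≤ : k ≤ suc max) p →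
                  before {a = arity} Step k k≤ p (ℓ ∷ []) ⇔ (k ≢ 0 × Reach C k p)
        before⇔ zero    _  p = mk⇔ (λ ()) (λ (k≢0 , _) → ⊥-elim (k≢0 refl))
        before⇔ (suc k) k< p = mk⇔ (λ s → (λ ()) , to e s) (λ (_ , r) → from e r)
          where
          k≡ = toℕ-fromℕ< k<
          e : Step (fromℕ< k<) (before {a = arity} Step k (<⇒≤ k<)) p (ℓ ∷ []) ⇔ Reach C (suc k) p
          e = subst (λ j → Step (fromℕ< k<) (before {a = arity} Step k (<⇒≤ k<)) p (ℓ ∷ []) ⇔ Reach C (suc j) p) k≡
                (step⇔ (fromℕ< k<) (subst (λ j → ∀ p → before {a = arity} Step k (<⇒≤ k<) p (ℓ ∷ []) ⇔ (j ≢ 0 × Reach C j p)) (sym k≡) (before⇔ k (<⇒≤ k<))) p)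

      formula⇔ : satFORPR (𝔖 𝒜) formula R₀ (ℓ ∷ []) ⇔ NoRun A 𝒜 ℓ
      formula⇔ = final⇔ A 𝒜 ℓ {S} s {λ t → ¬ (∃[ d ] toℕ {suc max} d ≡ suc (toℕ t))} last⇔ ⇔-∘ e
        where
        S : Tem 𝒜 → Fin states → Set
        S t q = recursive {a = arity} Step q (t ∷ ℓ ∷ [])
        s : ∀ t q → S t q ⇔ Reach C (suc (toℕ t)) q
        s t q = mk⇔ (λ x → proj₂ (to (before⇔ (suc (toℕ t)) (toℕ<n t) q) x))
                    (λ r → from (before⇔ (suc (toℕ t)) (toℕ<n t) q) ((λ ()) , r))
        module D t = Connectives.Semantics {FORPR (arity⁺ Fun.++ Fun.[]) 2} ff _∨′_
          (λ φ → satFORPR (𝔖 𝒜) φ (recursive {a = arity} Step ⊕ R₀) (t ∷ ℓ ∷ []))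
          (λ s → s refl) (λ _ _ → refl)
        r≡ : ∀ t q → _ ≡ S t q
        r≡ t q = relˡ-sat arity⁺ {𝔖 𝒜} {P = recursive {a = arity} Step} q (zero ∷ suc zero ∷ []) (t ∷ ℓ ∷ [])
        e = mk⇔
          (λ h (t , l , q , x) → h (t , l , from (D.⋁-sat t _) (q , subst (λ X → X) (sym (r≡ t q)) x)))
          (λ h (t , l , x) → let q , y = to (D.⋁-sat t _) x in h (t , l , q , subst (λ X → X) (r≡ t q) y))

  module SecondOrder (A : Automaton) where
    open Automaton A

    ff : ∀ {s n} → MSO s (suc n)
    ff = zero <′ zero

    precedes : ∀ {s n} → Fin n → Fin n → MSO s n
    precedes x y = (x <′ y) ∧′ ¬′ ∃₁ ((suc x <′ zero) ∧′ (zero <′ suc y))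

    open StepFormula A {MSO states 2} ff _∨′_ _∧′_ ¬′_

    first : MSO states 2
    first = ¬′ ∃₁ (zero <′ suc zero)

    prev : Fin states → MSO states 2
    prev p = ∃₁ (precedes zero (suc zero) ∧′ var p zero)

    same : MSO states 2
    same = ¬′ (zero <′ suc zero) ∧′ ¬′ (suc zero <′ zero)

    successors : Fin states → MSO states 2
    successors = step first prev (λ i → pred i zero) same

    closed : MSO states 1
    closed = ¬′ ∃₁ (Connectives.⋁ ff _∨′_ (λ q → successors q ∧′ ¬′ var q zero))

    final : MSO states 1
    final = ∃₁ (¬′ ∃₁ (suc zero <′ zero) ∧′ Connectives.⋁ ff _∨′_ (λ q → var q zero))

    ∃₂* : ∀ {s n} → MSO s n → MSO 0 n
    ∃₂* {zero}  φ = φ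
    ∃₂* {suc s} φ = ∃₂* (∃₂ φ)

    ∃₂*-sat : ∀ {𝔄 s n v} (φ : MSO s n) → satMSO 𝔄 (∃₂* φ) [] v ⇔ (∃[ V ] satMSO 𝔄 φ V v)
    ∃₂*-sat {s = zero}  φ = mk⇔ (λ x → [] , x) (λ { ([] , x) → x })
    ∃₂*-sat {s = suc s} φ = mk⇔
      (λ x → let V , S , y = to (∃₂*-sat (∃₂ φ)) x in S ∷ V , y)
      (λ { (S ∷ V , y) → from (∃₂*-sat (∃₂ φ)) (V , S , y) })

    -- A closed family without a state at the last point is an invariant that certifies the absence
    -- of a run, so existential set quantifiers suffice.
    formula : MSO 0 1
    formula = ∃₂* (closed ∧′ ¬′ final)

    -- Any family of sets closed under the transitions contains the reachable
    -- states, and the reachable states form the least such family.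
    module _ (em : ExcludedMiddle 0ℓ) (𝒜 : Data) (ℓ : Tem 𝒜) where
      open Data 𝒜 using (atoms; max)
      open Classical em using (decide; decide⇔)

      private
        C = Letter A 𝒜 ℓ

        N : ℕ
        N = suc max

        module At (V : Vec (Subset.Subset N) states) (t : Fin N) where
          sat : MSO states 2 → Set
          sat φ = satMSO (𝔖 𝒜) φ V (t ∷ ℓ ∷ [])
          open Semantics sat (<-irrefl refl) (λ _ _ → refl) (λ _ _ → refl) (λ _ → refl) public
          open Connectives.Semantics {MSO states 2} ff _∨′_ sat (<-irrefl refl) (λ _ _ → refl) public using (⋁-sat)

          holds⇔ : ∀ i → sat (pred i zero) ⇔ ((i , + toℕ t) ∈ˡ atoms)
          holds⇔ i = ⇔-id _

          same⇔ : sat same ⇔ (toℕ t ≡ toℕ ℓ)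
          same⇔ = mk⇔ (λ (a , b) → ≤-antisym (≮⇒≥ b) (≮⇒≥ a))
            (λ e → (λ l → <-irrefl e l) , (λ l → <-irrefl (sym e) l))

          none-before⇔ : sat first ⇔ (toℕ t ≡ 0)
          none-before⇔ = mk⇔
            (λ h → to (first⇔ t) λ (d , e) → h (d , subst (toℕ d <_) (sym e) (n<1+n _)))
            (λ e (d , l) → m<n⇒n≢0 l e)

          prev⇔ : ∀ p → sat (prev p) ⇔ (∃[ d ] toℕ t ≡ suc (toℕ {N} d) × d Subset.∈ lookup V p)
          prev⇔ p = mk⇔
            (λ { (d , (l , g) , x) → d , adjacent d l g , x })
            (λ { (d , e , x) → d , (subst (toℕ d <_) (sym e) (n<1+n _) ,
                 λ (w , l , r) → <⇒≱ l (s≤s⁻¹ (subst (toℕ w <_) e r))) , x })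
            where
            adjacent : ∀ d → toℕ d < toℕ t → ¬ (∃[ w ] (toℕ d < toℕ {N} w × toℕ w < toℕ t)) →
                       toℕ t ≡ suc (toℕ d)
            adjacent d l g with <-cmp (toℕ t) (suc (toℕ d))
            ... | tri≈ _ e _ = e
            ... | tri< l′ _ _ = ⊥-elim (<⇒≱ l (s≤s⁻¹ l′))
            ... | tri> _ _ l′ = ⊥-elim (g (w , subst (toℕ d <_) (sym w≡) (n<1+n _) , subst (_< toℕ t) (sym w≡) l′))
              where
              w<N = <-trans l′ (toℕ<n t)
              w = fromℕ< w<N
              w≡ = toℕ-fromℕ< w<N

        absorb : ∀ {V} → satMSO (𝔖 𝒜) closed V (ℓ ∷ []) → ∀ t →
                 (∀ p → toℕ t ≢ 0 → Reach C (toℕ t) p → At.sat V t (prev p)) →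
                 ∀ q → Reach C (suc (toℕ t)) q → t Subset.∈ lookup V q
        absorb {V} h t earlier q r = decidable-stable (t ∈? lookup V q) λ t∉ →
          h (t , from (⋁-sat (λ q → successors q ∧′ ¬′ var q zero)) (q ,
            step-complete {holds = λ i → pred i zero} holds⇔ same⇔ (toℕ t) none-before⇔ {C} (λ _ → ⇔-id _)
              earlier q r , t∉))
          where open At V t

        contained : ∀ {V} → satMSO (𝔖 𝒜) closed V (ℓ ∷ []) →
                    ∀ k (t : Fin N) → toℕ t ≡ k → ∀ q → Reach C (suc (toℕ t)) q → t Subset.∈ lookup V q
        contained h zero t e = absorb h t λ _ t≢0 _ → ⊥-elim (t≢0 e)
        contained {V} h (suc k) t e = absorb h t λ p _ r → from (At.prev⇔ V t p)
          (fromℕ< k<N , trans e (cong suc (sym k≡)) ,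
           contained {V} h k (fromℕ< k<N) k≡ p
             (subst (λ j → Reach C j p) (trans e (cong suc (sym k≡))) r))
          where
          k<N : k < N
          k<N = <⇒≤ (subst (_< N) e (toℕ<n t))
          k≡ = toℕ-fromℕ< k<N

        -- Sets of time points are Boolean vectors, so the least family has to be built with
        -- `decide`.
        reached : Vec (Subset.Subset N) states
        reached = Vec.tabulate λ q → Vec.tabulate λ t → decide (Reach C (suc (toℕ t)) q)

        reached⇔ : ∀ t q → t Subset.∈ lookup reached q ⇔ Reach C (suc (toℕ t)) q
        reached⇔ t q = mk⇔
          (λ x → to decide⇔ (trans (sym e) ([]=⇒lookup x)))
          (λ r → lookup⇒[]= t _ (trans e (from decide⇔ r)))
          where
          e : lookup (lookup reached q) t ≡ decide (Reach C (suc (toℕ t)) q)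
          e = trans (cong (λ S → lookup S t) (lookup∘tabulate (λ q → Vec.tabulate λ t → decide (Reach C (suc (toℕ t)) q)) q))
                (lookup∘tabulate (λ t → decide (Reach C (suc (toℕ t)) q)) t)

        reached-closed : satMSO (𝔖 𝒜) closed reached (ℓ ∷ [])
        reached-closed (t , x) =
          let q , s , t∉ = to (⋁-sat (λ q → successors q ∧′ ¬′ var q zero)) x
          in t∉ (from (reached⇔ t q) (step-sound {holds = λ i → pred i zero} holds⇔ same⇔ (toℕ t) none-before⇔ {C} (λ _ → ⇔-id _)
               (λ p y → earlier p (to (prev⇔ p) y)) q s))
          where
          open At reached t
          earlier : ∀ p → (∃[ d ] toℕ t ≡ suc (toℕ {N} d) × d Subset.∈ lookup reached p) → Reach C (toℕ t) p
          earlier p (d , e , x) = subst (λ k → Reach C k p) (sym e) (to (reached⇔ d p) x)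

        final-sat : ∀ V → satMSO (𝔖 𝒜) final V (ℓ ∷ []) ⇔
                    (∃[ t ] (¬ (∃[ d ] toℕ t < toℕ {N} d)) × ∃[ q ] t Subset.∈ lookup V q)
        final-sat V = mk⇔ (λ (t , l , x) → t , l , to (At.⋁-sat V t _) x)
                          (λ (t , l , x) → t , l , from (At.⋁-sat V t _) x)

        none-after⇔ : ∀ (t : Fin N) → (¬ (∃[ d ] toℕ t < toℕ {N} d)) ⇔ (toℕ t ≡ max)
        none-after⇔ t = mk⇔
          (λ h → to (last⇔ t) λ (d , e) → h (d , subst (toℕ t <_) (sym e) (n<1+n _)))
          (λ e (d , l) → <⇒≱ l (subst (toℕ d ≤_) (sym e) (toℕ≤pred[n] d)))

      formula⇔ : satMSO (𝔖 𝒜) formula [] (ℓ ∷ []) ⇔ NoRun A 𝒜 ℓ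
      formula⇔ = mk⇔
        (λ x (q , r) →
          let V , c , f = to (∃₂*-sat (closed ∧′ ¬′ final)) x
          in f (from (final-sat V) (fromℕ max , from (none-after⇔ (fromℕ max)) (toℕ-fromℕ max) , q ,
               contained {V} c max (fromℕ max) (toℕ-fromℕ max) q (subst (λ j → Reach C (suc j) q) (sym (toℕ-fromℕ max)) r))))
        (λ h → from (∃₂*-sat (closed ∧′ ¬′ final)) (reached , reached-closed ,
          from (final⇔ A 𝒜 ℓ {λ t q → t Subset.∈ lookup reached q} reached⇔ none-after⇔) h ∘ to (final-sat reached)))

-- The encodings of positive instances form a regular language.

module Rows where

  open FiniteSets
  open Automata
  open Temporal using (¬-cong; module TypeAutomaton)
  open Rewriting

  open import Data.Bool.Base using (Bool; true; false; _∧_; _∨_)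
  open import Data.Bool.ListAction using (or)
  open import Data.Bool.Properties using (∨-assoc; ∨-identityʳ)
  open import Data.Empty using (⊥-elim)
  open import Data.Fin.Base as Fin using (Fin; zero; suc; toℕ; fromℕ<; fromℕ)
  open import Data.Fin.Properties using (toℕ-injective; toℕ<n; toℕ-fromℕ; toℕ-fromℕ<) renaming (_≟_ to _≟ᶠ_)
  open import Data.Integer.Base as ℤ using (ℤ; +_; 0ℤ)
  import Data.Integer.Properties as ℤ
  open import Data.List.Base as List
    using (List; []; _∷_; _++_; length; foldl; concatMap; concat; tabulate; drop; head; map)
  open import Data.List.Membership.Propositional using () renaming (_∈_ to _∈ˡ_)
  open import Data.List.Membership.Propositional.Properties
    using (∈-map⁺; ∈-map⁻; ∈-concat⁺′; ∈-concat⁻′; ∈-tabulate⁺; ∈-tabulate⁻)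
  open import Data.List.Properties using (tabulate-cong; map-tabulate; length-tabulate)
  open import Data.List.Relation.Unary.All as All using (All)
  open import Data.List.Relation.Unary.Any using (here; there)
  open import Data.Maybe.Base using (Maybe; just; nothing)
  open import Data.Nat.Base as ℕ using (ℕ; zero; suc; _+_; _≤_; _<_; s≤s; s≤s⁻¹; z≤n)
  import Data.Nat.Properties as ℕ
  open import Data.Product.Base using (∃-syntax; _×_; _,_; proj₁; proj₂)
  open import Data.Product.Properties using (,-injective)
  open import Data.Sum.Base using (_⊎_; inj₁; inj₂)
  open import Data.Vec.Base as Vec using (Vec; lookup)
  open import Data.Vec.Properties using (lookup∘tabulate)
  open import Function.Base using (_∘_; case_of_)
  open import Function.Bundles using (_⇔_; mk⇔; Equivalence)
  open import Function.Construct.Composition using (_⇔-∘_)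
  open import Function.Construct.Identity using (⇔-id)
  open import Relation.Binary.PropositionalEquality using (_≡_; refl; sym; trans; cong; cong₂; subst)
  open import Relation.Nullary using (¬_; Dec; yes; no; does)
  open import Relation.Nullary.Decidable using (⌊_⌋)
  open import Relation.Unary using (_∈_)

  open Equivalence using (to; from)

  record DFA : Set₁ where
    field
      State  : Set
      finite : Finite State
      init   : State
      next   : State → Bool → State
      final  : State → Bool

    Accepts : List Bool → Set
    Accepts w = final (foldl next init w) ≡ true

  Row : Set
  Row = Bool × List Bool

  -- The default row is unmarked and empty, so conditions on rows can quantify over all of ℕ.
  rowAt : List Row → ℕ → Row
  rowAt []       _       = false , []
  rowAt (r ∷ _)  zero    = r
  rowAt (_ ∷ rs) (suc t) = rowAt rs t

  entryBits : List Bool → List Bool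
  entryBits = concatMap (λ b → false ∷ b ∷ [])

  rowBits : Row → List Bool
  rowBits (m , bs) = true ∷ m ∷ entryBits bs

  bits : List Row → List Bool
  bits = concatMap rowBits

  -- Conditions on the data are stated for this automaton, which sees whole tokens; `Bitwise` then
  -- deals with malformed words once and for all.
  record RowAutomaton : Set₁ where
    field
      State  : Set
      finite : Finite State
      init   : State
      open′  : State → Bool → State
      entry  : State → Bool → State
      final  : State → Bool

    row : State → Row → State
    row s (m , bs) = foldl entry (open′ s m) bs

    run : State → List Row → State
    run = foldl row

    Accepts : List Row → Set
    Accepts rs = final (run init rs) ≡ true

  module Bitwise (A : RowAutomaton) where
    open RowAutomaton A

    -- inj₂ false is the state before the first row, inj₂ true a dead state; the
    -- second component is the pending first bit of a token.
    Half : Set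
    Half = (State ⊎ Bool) × Maybe Bool

    token : State ⊎ Bool → Bool → Bool → State ⊎ Bool
    token (inj₁ s)     true  m = inj₁ (open′ s m)
    token (inj₁ s)     false b = inj₁ (entry s b)
    token (inj₂ false) true  m = inj₁ (open′ init m)
    token (inj₂ false) false _ = inj₂ true
    token (inj₂ true)  _     _ = inj₂ true

    nextHalf : Half → Bool → Half
    nextHalf (s , nothing) a = s , just a
    nextHalf (s , just a)  b = token s a b , nothing

    finalHalf : Half → Bool
    finalHalf (inj₁ s , nothing) = final s
    finalHalf _                  = false

    dfa : DFA
    dfa = record
      { State = Half ; finite = (finite ⊎ᶠ finite-Bool) ×ᶠ finite-Maybe finite-Bool
      ; init = inj₂ false , nothing ; next = nextHalf ; final = finalHalf }

    runs : ∀ s bs rs → foldl nextHalf (inj₁ s , nothing) (entryBits bs ++ bits rs) ≡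
                       (inj₁ (run (foldl entry s bs) rs) , nothing)
    runs s (b ∷ bs) rs              = runs (entry s b) bs rs
    runs s []       []              = refl
    runs s []       ((m , bs) ∷ rs) = runs (open′ s m) bs rs

    -- A live state without a pending bit means that whole tokens were read, so the word splits back
    -- into entries and rows.
    parse : ∀ s w {s′} → foldl nextHalf (inj₁ s , nothing) w ≡ (inj₁ s′ , nothing) →
            ∃[ bs ] ∃[ rs ] w ≡ entryBits bs ++ bits rs × s′ ≡ run (foldl entry s bs) rs
    parse s []              refl = [] , [] , refl , refl
    parse s (a ∷ [])        ()
    parse s (true ∷ m ∷ w)  e with parse (open′ s m) w e
    ... | bs , rs , refl , e′ = [] , (m , bs) ∷ rs , refl , e′
    parse s (false ∷ b ∷ w) e with parse (entry s b) w e
    ... | bs , rs , refl , e′ = b ∷ bs , rs , refl , e′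

    dead : ∀ w → finalHalf (foldl nextHalf (inj₂ true , nothing) w) ≡ false
    dead []          = refl
    dead (_ ∷ [])    = refl
    dead (_ ∷ _ ∷ w) = dead w

    dfa-accepts : ∀ w → DFA.Accepts dfa w ⇔ (∃[ r ] ∃[ rs ] w ≡ bits (r ∷ rs) × Accepts (r ∷ rs))
    dfa-accepts w = mk⇔ (there′ w)
      (λ { ((m , bs) , rs , refl , a) → trans (cong finalHalf (runs (open′ init m) bs rs)) a })
      where
      accepted : ∀ h → finalHalf h ≡ true → ∃[ s ] h ≡ (inj₁ s , nothing) × final s ≡ true
      accepted (inj₁ s , nothing) e = s , refl , e
      there′ : ∀ w → finalHalf (foldl nextHalf (inj₂ false , nothing) w) ≡ true →
               ∃[ r ] ∃[ rs ] w ≡ bits (r ∷ rs) × Accepts (r ∷ rs)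
      there′ (true ∷ m ∷ w) e with accepted _ e
      ... | s , h , f with parse (open′ init m) w h
      ...   | bs , rs , refl , refl = (m , bs) , rs , refl , f
      there′ (false ∷ b ∷ w) e = case trans (sym (dead w)) e of λ ()

  Recognises : RowAutomaton → (List Row → Set) → Set
  Recognises A P = ∀ rs → RowAutomaton.Accepts A rs ⇔ P rs

  infixr 5 _⊗_

  _⊗_ : RowAutomaton → RowAutomaton → RowAutomaton
  A ⊗ B = record
    { State  = A.State × B.State
    ; finite = A.finite ×ᶠ B.finite
    ; init   = A.init , B.init
    ; open′  = λ (s , t) m → A.open′ s m , B.open′ t m
    ; entry  = λ (s , t) b → A.entry s b , B.entry t b
    ; final  = λ (s , t) → A.final s ∧ B.final t
    }
    where
    module A = RowAutomaton A
    module B = RowAutomaton B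

  foldl-× : ∀ {S T X : Set} (f : S → X → S) (g : T → X → T) s t xs →
            foldl (λ (s , t) x → f s x , g t x) (s , t) xs ≡ (foldl f s xs , foldl g t xs)
  foldl-× f g s t []       = refl
  foldl-× f g s t (x ∷ xs) = foldl-× f g (f s x) (g t x) xs

  ⊗-run : ∀ A B s t rs → RowAutomaton.run (A ⊗ B) (s , t) rs ≡
          (RowAutomaton.run A s rs , RowAutomaton.run B t rs)
  ⊗-run A B s t []              = refl
  ⊗-run A B s t ((m , bs) ∷ rs)
    rewrite foldl-× (RowAutomaton.entry A) (RowAutomaton.entry B)
                    (RowAutomaton.open′ A s m) (RowAutomaton.open′ B t m) bs = ⊗-run A B _ _ rs

  ⊗-recognises : ∀ A B {P Q} → Recognises A P → Recognises B Q →
                 Recognises (A ⊗ B) (λ rs → P rs × Q rs)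
  ⊗-recognises A B p q rs
    rewrite ⊗-run A B (RowAutomaton.init A) (RowAutomaton.init B) rs = mk⇔
    (λ e → let a , b = ∧-true _ e in to (p rs) a , to (q rs) b)
    (λ (x , y) → cong₂ _∧_ (from (p rs) x) (from (q rs) y))
    where
    ∧-true : ∀ a {b} → a ∧ b ≡ true → a ≡ true × b ≡ true
    ∧-true true e = refl , e

  foldl-const : ∀ {S X : Set} (s : S) (xs : List X) → foldl (λ s _ → s) s xs ≡ s
  foldl-const s []       = refl
  foldl-const s (_ ∷ xs) = foldl-const s xs

  foldl-∨ : ∀ s bs → foldl _∨_ s bs ≡ s ∨ or bs
  foldl-∨ s []       = sym (∨-identityʳ s)
  foldl-∨ s (b ∷ bs) = trans (foldl-∨ (s ∨ b) bs) (∨-assoc s b (or bs))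

  -- 0, 1, and 2 for anything more.
  Few : Set
  Few = Fin 3

  more : Few → Few
  more zero    = suc zero
  more (suc _) = suc (suc zero)

  -- Which rows come from a data instance: length, nonempty first and last row, single mark.

  module _ where
    open RowAutomaton

    long : RowAutomaton
    long .State     = Few
    long .finite    = finite-Fin 3
    long .init      = zero
    long .open′ s _ = more s
    long .entry s _ = s
    long .final s   = does (s ≟ᶠ suc (suc zero))

    long-recognises : Recognises long (λ rs → 2 ≤ length rs)
    long-recognises []       = mk⇔ (λ ()) (λ ())
    long-recognises ((_ , bs) ∷ []) rewrite foldl-const {Few} (suc zero) bs =
      mk⇔ (λ ()) (λ { (s≤s ()) })
    long-recognises ((_ , bs) ∷ (_ , bs′) ∷ rs)
      rewrite foldl-const {Few} (suc zero) bs | foldl-const {Few} (suc (suc zero)) bs′ =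
      mk⇔ (λ _ → s≤s (s≤s z≤n)) (λ _ → cong (long .final) (stays rs))
      where
      stays : ∀ rs → run long (suc (suc zero)) rs ≡ suc (suc zero)
      stays []              = refl
      stays ((_ , bs) ∷ rs) rewrite foldl-const {Few} (suc (suc zero)) bs = stays rs

    firstFull : RowAutomaton
    firstFull .State                    = Maybe (Bool × Bool)
    firstFull .finite                   = finite-Maybe (finite-Bool ×ᶠ finite-Bool)
    firstFull .init                     = nothing
    firstFull .open′ nothing        _   = just (true , false)
    firstFull .open′ (just (_ , s)) _   = just (false , s)
    firstFull .entry nothing            _ = nothing
    firstFull .entry (just (true , s))  b = just (true , s ∨ b)
    firstFull .entry (just (false , s)) b = just (false , s)
    firstFull .final nothing            = false
    firstFull .final (just (_ , s))     = s

    firstFull-recognises : Recognises firstFull (λ rs → or (proj₂ (rowAt rs 0)) ≡ true)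
    firstFull-recognises []              = mk⇔ (λ ()) (λ ())
    firstFull-recognises ((_ , bs) ∷ rs) = mk⇔ (trans (sym e)) (trans e)
      where
      in-first : ∀ s bs → foldl (firstFull .entry) (just (true , s)) bs ≡ just (true , s ∨ or bs)
      in-first s []       = cong (λ s → just (true , s)) (sym (∨-identityʳ s))
      in-first s (b ∷ bs) = trans (in-first (s ∨ b) bs) (cong (λ s → just (true , s)) (∨-assoc s b (or bs)))
      later : ∀ s bs → foldl (firstFull .entry) (just (false , s)) bs ≡ just (false , s)
      later s []       = refl
      later s (_ ∷ bs) = later s bs
      stays : ∀ i s rs → firstFull .final (run firstFull (just (i , s)) rs) ≡ s
      stays i s []              = refl
      stays i s ((_ , bs) ∷ rs) rewrite later s bs = stays false s rs
      e = trans (cong (λ s → firstFull .final (run firstFull s rs)) (in-first false bs)) (stays true (or bs) rs)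

    lastFull : RowAutomaton
    lastFull .State     = Bool
    lastFull .finite    = finite-Bool
    lastFull .init      = false
    lastFull .open′ _ _ = false
    lastFull .entry     = _∨_
    lastFull .final s   = s

    lastFull-recognises : Recognises lastFull (λ rs → or (proj₂ (rowAt rs (ℕ.pred (length rs)))) ≡ true)
    lastFull-recognises []       = mk⇔ (λ ()) (λ ())
    lastFull-recognises (r ∷ rs) = mk⇔ (trans (sym (last false r rs))) (trans (last false r rs))
      where
      last : ∀ s r rs → run lastFull s (r ∷ rs) ≡ or (proj₂ (rowAt (r ∷ rs) (length rs)))
      last s (_ , bs) []        = foldl-∨ false bs
      last s (_ , bs) (r′ ∷ rs) = last (foldl _∨_ false bs) r′ rs

    oneMark : RowAutomaton
    oneMark .State         = Few
    oneMark .finite        = finite-Fin 3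
    oneMark .init          = zero
    oneMark .open′ s false = s
    oneMark .open′ s true  = more s
    oneMark .entry s _     = s
    oneMark .final s       = does (s ≟ᶠ suc zero)

    MarkedAt : List Row → ℕ → Set
    MarkedAt rs ℓ = ∀ t → proj₁ (rowAt rs t) ≡ true ⇔ t ≡ ℓ

    oneMark-recognises : Recognises oneMark (λ rs → ∃[ ℓ ] ℓ < length rs × MarkedAt rs ℓ)
    oneMark-recognises [] = mk⇔ (λ ()) (λ ())
    oneMark-recognises ((true , bs) ∷ rs) rewrite foldl-const {Few} (suc zero) bs = mk⇔
      (λ a → 0 , s≤s z≤n , λ { zero → mk⇔ (λ _ → refl) (λ _ → refl)
                             ; (suc t) → mk⇔ (λ m → case trans (sym m) (to (none rs) a t) of λ ()) (λ ()) })
      (λ { (ℓ , _ , h) → from (none rs) λ t → unmarked (λ m → ℕ.1+n≢0 (trans (to (h (suc t)) m) (sym (to (h 0) refl)))) })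
      where
      unmarked : ∀ {b} → ¬ (b ≡ true) → b ≡ false
      unmarked {true}  h = ⊥-elim (h refl)
      unmarked {false} h = refl
      many : ∀ rs → oneMark .final (run oneMark (suc (suc zero)) rs) ≡ false
      many []                  = refl
      many ((false , bs) ∷ rs) rewrite foldl-const {Few} (suc (suc zero)) bs = many rs
      many ((true , bs) ∷ rs)  rewrite foldl-const {Few} (suc (suc zero)) bs = many rs
      none : ∀ rs → oneMark .final (run oneMark (suc zero) rs) ≡ true ⇔ (∀ t → proj₁ (rowAt rs t) ≡ false)
      none [] = mk⇔ (λ _ _ → refl) (λ _ → refl)
      none ((true , bs) ∷ rs) rewrite foldl-const {Few} (suc (suc zero)) bs =
        mk⇔ (λ a → case trans (sym (many rs)) a of λ ()) (λ h → case h 0 of λ ())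
      none ((false , bs) ∷ rs) rewrite foldl-const {Few} (suc zero) bs = mk⇔
        (λ { a zero → refl ; a (suc t) → to (none rs) a t })
        (λ h → from (none rs) (h ∘ suc))
    oneMark-recognises ((false , bs) ∷ rs) rewrite foldl-const {Few} zero bs = mk⇔
      (λ a → let ℓ , l , h = to (oneMark-recognises rs) a in
         suc ℓ , s≤s l , λ { zero → mk⇔ (λ ()) (λ ())
                           ; (suc t) → mk⇔ (cong suc ∘ to (h t)) (from (h t) ∘ ℕ.suc-injective) })
      (λ { (zero , _ , h) → case from (h 0) refl of λ ()
         ; (suc ℓ , l , h) → from (oneMark-recognises rs)
             (ℓ , s≤s⁻¹ l , λ t → mk⇔ (ℕ.suc-injective ∘ to (h (suc t))) (from (h (suc t)) ∘ cong suc)) })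

  clamp : ∀ {B} → ℕ → Fin (suc B)
  clamp {zero}  _       = zero
  clamp {suc B} zero    = zero
  clamp {suc B} (suc n) = suc (clamp n)

  bump : ∀ {B} → Fin (suc B) → Fin (suc B)
  bump {zero}  zero    = zero
  bump {suc B} zero    = suc zero
  bump {suc B} (suc i) = suc (bump i)

  bump-clamp : ∀ B n → bump {B} (clamp n) ≡ clamp (suc n)
  bump-clamp zero          _       = refl
  bump-clamp (suc zero)    zero    = refl
  bump-clamp (suc (suc B)) zero    = refl
  bump-clamp (suc B)       (suc n) = cong suc (bump-clamp B n)

  clamp-zero : ∀ B → clamp {B} 0 ≡ zero
  clamp-zero zero    = refl
  clamp-zero (suc B) = refl

  toℕ-clamp : ∀ {B n} → n ≤ B → toℕ (clamp {B} n) ≡ n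
  toℕ-clamp {zero}  z≤n     = refl
  toℕ-clamp {suc B} z≤n     = refl
  toℕ-clamp {suc B} (s≤s l) = cong suc (toℕ-clamp l)

  toℕ-clamp-> : ∀ {B n} → B ≤ n → toℕ (clamp {B} n) ≡ B
  toℕ-clamp-> {zero}  _       = refl
  toℕ-clamp-> {suc B} (s≤s l) = cong suc (toℕ-clamp-> l)

  module _ (em : ExcludedMiddle 0ℓ) (A : Automaton) where
    open Automaton A

    open Classical em using (decide; decide⇔)

    has : List Bool → ℕ → Set
    has bs i = head (drop i bs) ≡ just true

    rowLetter : List Row → ℕ → Fin states → Set
    rowLetter rs t = Reads (has (proj₂ (rowAt rs t))) (proj₁ (rowAt rs t) ≡ true)

    tracked : Vec Bool states → Fin states → Set
    tracked V q = lookup V q ≡ true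

    filtered : (Fin states → Set) → Vec Bool states
    filtered P = Vec.tabulate (decide ∘ P)

    filtered⇔ : ∀ P q → tracked (filtered P) q ⇔ P q
    filtered⇔ P q = mk⇔ (λ e → to decide⇔ (trans (sym (lookup∘tabulate (decide ∘ P) q)) e))
                        (λ p → trans (lookup∘tabulate (decide ∘ P) q) (from decide⇔ p))

    open RowAutomaton

    -- The state is the column, saturated at the bound, with the set of automaton
    -- states that can read the rows so far.
    noRun : RowAutomaton
    noRun .State           = Fin (suc bound) × Vec Bool states
    noRun .finite          = finite-Fin _ ×ᶠ finite-Vec finite-Bool _
    noRun .init            = zero , filtered (_≡ start)
    noRun .open′ (_ , V) m = zero , filtered (post (tracked V) (λ q → m ≡ true → refutes q ≡ true))
    noRun .entry (c , V) b =
      bump c , filtered (λ q → tracked V q × (b ≡ true → forbids q (toℕ c) ≡ false))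
    noRun .final (_ , V)   = decide (¬ (∃[ q ] tracked V q))

    -- By `bounded` no state forbids a column from `bound` on, so the saturated counter loses
    -- nothing.
    forbids-clamp : ∀ q i → forbids q (toℕ (clamp {bound} i)) ≡ forbids q i
    forbids-clamp q i with ℕ.≤-total i bound
    ... | inj₁ i≤B = cong (forbids q) (toℕ-clamp i≤B)
    ... | inj₂ B≤i = trans (cong (forbids q) (toℕ-clamp-> B≤i)) (trans (never ℕ.≤-refl) (sym (never B≤i)))
      where
      never : ∀ {i} → bound ≤ i → forbids q i ≡ false
      never {i} B≤i with forbids q i in e
      ... | true  = ⊥-elim (ℕ.<⇒≱ (bounded q e) B≤i)
      ... | false = refl

    entries⇔ : ∀ i V bs q → tracked (proj₂ (foldl (noRun .entry) (clamp i , V) bs)) q ⇔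
               (tracked V q × (∀ j → has bs j → forbids q (i + j) ≡ false))
    entries⇔ i V [] q = mk⇔ (λ v → v , λ { zero () ; (suc _) () }) proj₁
    entries⇔ i V (b ∷ bs) q rewrite bump-clamp bound i = mk⇔
      (λ x → let y , h = to IH x ; v , g = to (filtered⇔ _ q) y in v , later g h)
      (λ (v , h) → from IH
        ( from (filtered⇔ _ q) (v , λ e → trans (forbids-clamp q i)
            (subst (λ k → forbids q k ≡ false) (ℕ.+-identityʳ i) (h 0 (cong just e))))
        , λ j x → subst (λ k → forbids q k ≡ false) (ℕ.+-suc i j) (h (suc j) x)))
      where
      IH = entries⇔ (suc i)
             (filtered (λ q → tracked V q × (b ≡ true → forbids q (toℕ (clamp {bound} i)) ≡ false))) bs q
      later : (b ≡ true → forbids q (toℕ (clamp {bound} i)) ≡ false) →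
              (∀ j → has bs j → forbids q (suc i + j) ≡ false) →
              ∀ j → has (b ∷ bs) j → forbids q (i + j) ≡ false
      later g h zero    refl = subst (λ k → forbids q k ≡ false) (sym (ℕ.+-identityʳ i))
                                 (trans (sym (forbids-clamp q i)) (g refl))
      later g h (suc j) x    = subst (λ k → forbids q k ≡ false) (sym (ℕ.+-suc i j)) (h j x)

    -- One step of the subset construction is spread over the tokens of a row: opening takes the
    -- successors that tolerate the mark, then each entry removes the states that forbid it.
    row⇔ : ∀ c V m bs q → tracked (proj₂ (row noRun (c , V) (m , bs))) q ⇔
           post (tracked V) (Reads (has bs) (m ≡ true)) q
    row⇔ c V m bs q = mk⇔
      (λ x → let y , h = to e x ; p , r = to (filtered⇔ S q) y in p , h , r)
      (λ (p , h , r) → from e (from (filtered⇔ S q) (p , r) , h))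
      where
      S : Fin states → Set
      S = post (tracked V) (λ q → m ≡ true → refutes q ≡ true)
      W = filtered S
      e : tracked (proj₂ (foldl (noRun .entry) (zero , W) bs)) q ⇔ (tracked W q × (∀ i → has bs i → forbids q i ≡ false))
      e = subst (λ c → tracked (proj₂ (foldl (noRun .entry) (c , W) bs)) q ⇔
                       (tracked W q × (∀ i → has bs i → forbids q i ≡ false))) (clamp-zero bound)
            (entries⇔ 0 W bs q)

    reach-cong : ∀ {S T C} n → (∀ q → S q ⇔ T q) → ∀ q → reach S C n q ⇔ reach T C n q
    reach-cong zero    e q = e q
    reach-cong (suc n) e q = mk⇔
      (λ ((p , r , d) , c) → (p , to (reach-cong n e p) r , d) , c)
      (λ ((p , r , d) , c) → (p , from (reach-cong n e p) r , d) , c)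

    run⇔ : ∀ c V rs q → tracked (proj₂ (run noRun (c , V) rs)) q ⇔
           reach (tracked V) (rowLetter rs) (length rs) q
    run⇔ c V []              q = ⇔-id _
    run⇔ c V ((m , bs) ∷ rs) q =
      subst (λ S → tracked (proj₂ (run noRun (c , V) ((m , bs) ∷ rs))) q ⇔ S q)
        (sym (reach-shift {tracked V} {rowLetter ((m , bs) ∷ rs)} (length rs)))
        (reach-cong (length rs) (row⇔ c V m bs) q ⇔-∘ run⇔ _ _ rs q)

    noRun-recognises : Recognises noRun (λ rs → ¬ (∃[ q ] Reach (rowLetter rs) (length rs) q))
    noRun-recognises rs = mk⇔
      (λ a (q , r) → to decide⇔ a (q , from (e q) r))
      (λ h → from decide⇔ λ (q , v) → h (q , to (e q) v))
      where
      e : ∀ q → tracked (proj₂ (run noRun (noRun .init) rs)) q ⇔ Reach (rowLetter rs) (length rs) q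
      e q = reach-cong (length rs) (filtered⇔ (_≡ start)) q ⇔-∘ run⇔ _ _ rs q

  trues : List Bool → List ℕ
  trues []           = []
  trues (true ∷ bs)  = 0 ∷ map suc (trues bs)
  trues (false ∷ bs) = map suc (trues bs)

  trues⇔ : ∀ bs i → i ∈ˡ trues bs ⇔ head (drop i bs) ≡ just true
  trues⇔ []           zero    = mk⇔ (λ ()) (λ ())
  trues⇔ []           (suc _) = mk⇔ (λ ()) (λ ())
  trues⇔ (true ∷ bs)  zero    = mk⇔ (λ _ → refl) (λ _ → here refl)
  trues⇔ (true ∷ bs)  (suc i) = mk⇔
    (λ { (here ()) ; (there i∈) → let j , j∈ , e = ∈-map⁻ suc i∈ in
         to (trues⇔ bs i) (subst (_∈ˡ trues bs) (sym (ℕ.suc-injective e)) j∈) })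
    (λ e → there (∈-map⁺ suc (from (trues⇔ bs i) e)))
  trues⇔ (false ∷ bs) zero    = mk⇔ (λ i∈ → case proj₂ (proj₂ (∈-map⁻ suc i∈)) of λ ()) (λ ())
  trues⇔ (false ∷ bs) (suc i) = mk⇔
    (λ i∈ → let j , j∈ , e = ∈-map⁻ suc i∈ in
       to (trues⇔ bs i) (subst (_∈ˡ trues bs) (sym (ℕ.suc-injective e)) j∈))
    (λ e → ∈-map⁺ suc (from (trues⇔ bs i) e))

  or⇔ : ∀ bs → or bs ≡ true ⇔ (∃[ i ] head (drop i bs) ≡ just true)
  or⇔ []           = mk⇔ (λ ()) (λ { (zero , ()) ; (suc _ , ()) })
  or⇔ (true ∷ bs)  = mk⇔ (λ _ → 0 , refl) (λ _ → refl)
  or⇔ (false ∷ bs) = mk⇔ (λ e → let i , h = to (or⇔ bs) e in suc i , h)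
                         (λ { (zero , ()) ; (suc i , h) → from (or⇔ bs) (i , h) })

  tabulate-rowAt : ∀ rs → tabulate {n = length rs} (rowAt rs ∘ toℕ) ≡ rs
  tabulate-rowAt []       = refl
  tabulate-rowAt (r ∷ rs) = cong (r ∷_) (tabulate-rowAt rs)

  rowAt-tabulate : ∀ {n} (f : Fin n → Row) t → rowAt (tabulate f) (toℕ t) ≡ f t
  rowAt-tabulate f zero    = refl
  rowAt-tabulate f (suc t) = rowAt-tabulate (f ∘ suc) t

  rowAt-beyond : ∀ rs t → length rs ≤ t → rowAt rs t ≡ (false , [])
  rowAt-beyond []       t       _       = refl
  rowAt-beyond (_ ∷ rs) (suc t) (s≤s l) = rowAt-beyond rs t l

  ⌊⌋≡ : ∀ {P : Set} {b} (d : Dec P) → b ≡ true ⇔ P → ⌊ d ⌋ ≡ b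
  ⌊⌋≡ (yes p) e = sym (from e p)
  ⌊⌋≡ {b = true}  (no ¬p) e = ⊥-elim (¬p (to e refl))
  ⌊⌋≡ {b = false} (no ¬p) e = refl

  -- The data instance read off from rows.

  module RowData (r : Row) (rs : List Row) (long : 2 ≤ length (r ∷ rs))
                 (first : or (proj₂ (rowAt (r ∷ rs) 0)) ≡ true)
                 (last : or (proj₂ (rowAt (r ∷ rs) (length rs))) ≡ true) where

    top : ℕ
    top = length rs

    contents : Fin (suc top) → List Bool
    contents t = proj₂ (rowAt (r ∷ rs) (toℕ t))

    block : Fin (suc top) → List (ℕ × ℤ)
    block t = map (λ i → i , + toℕ t) (trues (contents t))

    facts : List (ℕ × ℤ)
    facts = concat (tabulate block)

    facts⁺ : ∀ t i → head (drop i (contents t)) ≡ just true → (i , + toℕ t) ∈ˡ facts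
    facts⁺ t i h = ∈-concat⁺′ (∈-map⁺ (λ i → i , + toℕ t) (from (trues⇔ (contents t) i) h)) (∈-tabulate⁺ {f = block} t)

    facts⁻ : ∀ {a} → a ∈ˡ facts → ∃[ t ] ∃[ i ] a ≡ (i , + toℕ t) × head (drop i (contents t)) ≡ just true
    facts⁻ a∈ with ∈-concat⁻′ (tabulate block) a∈
    ... | _ , a∈b , b∈ with ∈-tabulate⁻ {f = block} b∈
    ...   | t , refl with ∈-map⁻ (λ i → i , + toℕ t) a∈b
    ...     | i , i∈ , refl = t , i , refl , to (trues⇔ (contents t) i) i∈

    stamps : ∀ {n} → n ∈ˡ map proj₂ facts → ∃[ t ] n ≡ + toℕ {suc top} t
    stamps n∈ with ∈-map⁻ proj₂ n∈
    ... | _ , a∈ , refl with facts⁻ a∈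
    ...   | t , _ , refl , _ = t , refl

    dataOf : Data
    dataOf = record
      { atoms  = facts
      ; min∈   = let i , h = to (or⇔ (contents zero)) first in ∈-map⁺ proj₂ (facts⁺ zero i h)
      ; min≤   = All.tabulate λ n∈ → let t , e = stamps n∈ in subst (0ℤ ℤ.≤_) (sym e) (ℤ.+≤+ z≤n)
      ; max    = top
      ; max∈   = let i , h = to (or⇔ (contents (fromℕ top)))
                               (subst (λ t → or (proj₂ (rowAt (r ∷ rs) t)) ≡ true) (sym (toℕ-fromℕ top)) last)
                 in subst (λ t → + t ∈ˡ map proj₂ facts) (toℕ-fromℕ top) (∈-map⁺ proj₂ (facts⁺ (fromℕ top) i h))
      ; ≤max   = All.tabulate λ n∈ → let t , e = stamps n∈ in
                   subst (ℤ._≤ + top) (sym e) (ℤ.+≤+ (s≤s⁻¹ (toℕ<n t)))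
      ; 1≤max  = s≤s⁻¹ long
      }

    represents : Represents dataOf contents
    represents t i = mk⇔
      (λ a∈ → let t′ , i′ , e , h = facts⁻ a∈ in same t′ i′ e h)
      (facts⁺ t i)
      where
      same : ∀ t′ i′ → (i , + toℕ t) ≡ (i′ , + toℕ t′) → head (drop i′ (contents t′)) ≡ just true →
             head (drop i (contents t)) ≡ just true
      same t′ i′ e h with ,-injective e
      ... | refl , e′ = subst (λ t → head (drop i (contents t)) ≡ just true)
                          (toℕ-injective (sym (ℤ.+-injective e′))) h

  module Answers (em : ExcludedMiddle 0ℓ) (𝒪 : Ontology) (κ : Concept) where

    open TypeAutomaton em 𝒪 κ using (automaton; ans⇔)
    open Automaton automaton

    Valid : List Row → Set
    Valid rs = 2 ≤ length rs ×
               or (proj₂ (rowAt rs 0)) ≡ true ×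
               or (proj₂ (rowAt rs (ℕ.pred (length rs)))) ≡ true ×
               (∃[ ℓ ] ℓ < length rs × MarkedAt rs ℓ) ×
               (¬ (∃[ q ] Reach (rowLetter em automaton rs) (length rs) q))

    rowAutomaton : RowAutomaton
    rowAutomaton = long ⊗ firstFull ⊗ lastFull ⊗ oneMark ⊗ noRun em automaton

    rowAutomaton-recognises : Recognises rowAutomaton Valid
    rowAutomaton-recognises =
      ⊗-recognises long (firstFull ⊗ lastFull ⊗ oneMark ⊗ noRun em automaton) long-recognises
      (⊗-recognises firstFull (lastFull ⊗ oneMark ⊗ noRun em automaton) firstFull-recognises
      (⊗-recognises lastFull (oneMark ⊗ noRun em automaton) lastFull-recognises
      (⊗-recognises oneMark (noRun em automaton) oneMark-recognises (noRun-recognises em automaton))))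

    module _ (𝒜 : Data) (ρ : Rows 𝒜) (ℓ : Tem 𝒜) (rep : Represents 𝒜 ρ) (rs : List Row)
             (len : length rs ≡ suc (Data.max 𝒜))
             (rows : ∀ t → rowAt rs (toℕ t) ≡ (⌊ t ≟ᶠ ℓ ⌋ , ρ t)) where

      marked⇔ : ∀ t → proj₁ (rowAt rs (toℕ t)) ≡ true ⇔ toℕ t ≡ toℕ ℓ
      marked⇔ t rewrite rows t with t ≟ᶠ ℓ
      ... | yes refl = mk⇔ (λ _ → refl) (λ _ → refl)
      ... | no t≢ℓ   = mk⇔ (λ ()) (λ e → ⊥-elim (t≢ℓ (toℕ-injective e)))

      letter⇔ : ∀ t q → Letter automaton 𝒜 ℓ (toℕ t) q ⇔ rowLetter em automaton rs (toℕ t) q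
      letter⇔ t q = mk⇔
        (λ (f , m) → (λ i h → f i (from (rep t i) (subst (λ r → head (drop i (proj₂ r)) ≡ just true) (rows t) h))) ,
                     m ∘ to (marked⇔ t))
        (λ (f , m) → (λ i a → f i (subst (λ r → head (drop i (proj₂ r)) ≡ just true) (sym (rows t)) (to (rep t i) a))) ,
                     m ∘ from (marked⇔ t))

      noRun⇔ : NoRun automaton 𝒜 ℓ ⇔ (¬ (∃[ q ] Reach (rowLetter em automaton rs) (length rs) q))
      noRun⇔ rewrite len = ¬-cong (mk⇔
        (λ (q , r) → q , reach-mono (suc (Data.max 𝒜)) (λ t q l → to (at t l q)) q r)
        (λ (q , r) → q , reach-mono (suc (Data.max 𝒜)) (λ t q l → from (at t l q)) q r))
        where
        at : ∀ t → t < suc (Data.max 𝒜) → ∀ q → Letter automaton 𝒜 ℓ t q ⇔ rowLetter em automaton rs t q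
        at t l q = subst (λ t → Letter automaton 𝒜 ℓ t q ⇔ rowLetter em automaton rs t q)
                     (toℕ-fromℕ< l) (letter⇔ (fromℕ< l) q)

      answer⇔ : ℓ ∈ ans ⟨ 𝒪 , κ ⟩ 𝒜 ⇔ (¬ (∃[ q ] Reach (rowLetter em automaton rs) (length rs) q))
      answer⇔ = mk⇔ (to noRun⇔ ∘ to (ans⇔ 𝒜 ℓ)) (from (ans⇔ 𝒜 ℓ) ∘ from noRun⇔)

    encode≡ : ∀ 𝒜 (ρ : Rows 𝒜) ℓ → encode 𝒜 ρ ℓ ≡ bits (tabulate λ t → ⌊ t ≟ᶠ ℓ ⌋ , ρ t)
    encode≡ 𝒜 ρ ℓ = cong concat (sym (map-tabulate (λ t → ⌊ t ≟ᶠ ℓ ⌋ , ρ t) rowBits))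

    -- By `answer⇔` the answer depends on the rows alone, so the instance rebuilt from them is as
    -- good as any other that they represent.
    answering⇔ : ∀ w → w ∈ Answering ⟨ 𝒪 , κ ⟩ ⇔ (∃[ r ] ∃[ rs ] w ≡ bits (r ∷ rs) × Valid (r ∷ rs))
    answering⇔ w = mk⇔ forth back
      where
      forth : w ∈ Answering ⟨ 𝒪 , κ ⟩ → ∃[ r ] ∃[ rs ] w ≡ bits (r ∷ rs) × Valid (r ∷ rs)
      forth (𝒜 , ρ , ℓ , rep , e , certain) =
        _ , _ , trans e (encode≡ 𝒜 ρ ℓ) ,
        ( subst (2 ≤_) (sym len) (s≤s (Data.1≤max 𝒜))
        , full zero (Data.min∈ 𝒜)
        , subst (λ t → or (proj₂ (rowAt rows t)) ≡ true) (trans (toℕ-fromℕ _) (sym (cong ℕ.pred len)))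
            (full (fromℕ max) (subst (λ t → + t ∈ˡ Data.timestamps 𝒜) (sym (toℕ-fromℕ _)) (Data.max∈ 𝒜)))
        , (toℕ ℓ , subst (toℕ ℓ <_) (sym len) (toℕ<n ℓ) , marked)
        , to (answer⇔ 𝒜 ρ ℓ rep rows len at) certain )
        where
        max = Data.max 𝒜
        rows : List Row
        rows = tabulate {n = suc max} λ t → ⌊ t ≟ᶠ ℓ ⌋ , ρ t
        len : length rows ≡ suc max
        len = length-tabulate {n = suc max} λ t → ⌊ t ≟ᶠ ℓ ⌋ , ρ t
        at : ∀ t → rowAt rows (toℕ t) ≡ (⌊ t ≟ᶠ ℓ ⌋ , ρ t)
        at = rowAt-tabulate λ t → ⌊ t ≟ᶠ ℓ ⌋ , ρ t
        full : ∀ t → + toℕ t ∈ˡ Data.timestamps 𝒜 → or (proj₂ (rowAt rows (toℕ t))) ≡ true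
        full t n∈ with ∈-map⁻ proj₂ n∈
        ... | (i , _) , a∈ , refl = trans (cong (or ∘ proj₂) (at t)) (from (or⇔ (ρ t)) (i , to (rep t i) a∈))
        marked : MarkedAt rows (toℕ ℓ)
        marked t with t ℕ.<? suc max
        ... | yes l = subst (λ t → proj₁ (rowAt rows t) ≡ true ⇔ t ≡ toℕ ℓ) (toℕ-fromℕ< l)
                        (marked⇔ 𝒜 ρ ℓ rep rows len at (fromℕ< l))
        ... | no l≰ rewrite rowAt-beyond rows t (subst (_≤ t) (sym len) (ℕ.≮⇒≥ l≰)) =
          mk⇔ (λ ()) (λ { refl → ⊥-elim (l≰ (toℕ<n ℓ)) })
      back : (∃[ r ] ∃[ rs ] w ≡ bits (r ∷ rs) × Valid (r ∷ rs)) → w ∈ Answering ⟨ 𝒪 , κ ⟩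
      back (r , rs , e , two , first , last , (ℓ , l , marked) , none) =
        dataOf , contents , ℓ′ , represents ,
        trans e (trans (cong bits (trans (sym (tabulate-rowAt (r ∷ rs))) (tabulate-cong at))) (sym (encode≡ dataOf contents ℓ′))) ,
        from (answer⇔ dataOf contents ℓ′ represents (r ∷ rs) refl at) none
        where
        open RowData r rs two first last
        ℓ′ : Fin (suc top)
        ℓ′ = fromℕ< l
        at : ∀ t → rowAt (r ∷ rs) (toℕ t) ≡ (⌊ t ≟ᶠ ℓ′ ⌋ , contents t)
        at t = cong (_, contents t) (sym (⌊⌋≡ (t ≟ᶠ ℓ′) (mk⇔
          (λ m → toℕ-injective (trans (to (marked (toℕ t)) m) (sym (toℕ-fromℕ< l))))
          (λ { refl → from (marked (toℕ t)) (toℕ-fromℕ< l) }))))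

    dfa : DFA
    dfa = Bitwise.dfa rowAutomaton

    dfa-answers : ∀ w → w ∈ Answering ⟨ 𝒪 , κ ⟩ ⇔ DFA.Accepts dfa w
    dfa-answers w = mk⇔
      (λ a → let r , rs , e , v = to (answering⇔ w) a in
         from (Bitwise.dfa-accepts rowAutomaton w) (r , rs , e , from (rowAutomaton-recognises (r ∷ rs)) v))
      (λ a → let r , rs , e , v = to (Bitwise.dfa-accepts rowAutomaton w) a in
         from (answering⇔ w) (r , rs , e , to (rowAutomaton-recognises (r ∷ rs)) v))

-- Formulas as trees, and their compilation to circuits.

module Circuits where

  open import Data.Bool.Base using (Bool; true; false; not; _∧_; _∨_)
  open import Data.Fin.Base using (Fin; zero; suc; toℕ)
  open import Data.List.Base using (List; []; _∷_)
  open import Data.Maybe.Base using (Maybe; just; nothing)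
  open import Data.Nat.Base using (ℕ; zero; suc; _+_; _⊔_)
  open import Data.Nat.Properties using (+-assoc; +-comm)
  open import Data.Vec.Base as Vec using (Vec; []; _∷_; lookup)
  open import Function.Base using (_∘_)
  open import Relation.Binary.PropositionalEquality using (_≡_; refl; sym; trans; cong; cong₂)

  -- In a tree a path leads to a subformula, so labels along paths can be computed by induction,
  -- which the gate indices of a circuit would obscure.
  data Form (n : ℕ) : Set where
    const      : Bool → Form n
    input      : Fin n → Form n
    neg        : Form n → Form n
    conj disj  : Form n → Form n → Form n

  module _ {n : ℕ} where

    eval : Vec Bool n → Form n → Bool
    eval x (const b)  = b
    eval x (input i)  = lookup x i
    eval x (neg F)    = not (eval x F)
    eval x (conj F G) = eval x F ∧ eval x G
    eval x (disj F G) = eval x F ∨ eval x G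

    height : Form n → ℕ
    height (const b)  = 0
    height (input i)  = 0
    height (neg F)    = suc (height F)
    height (conj F G) = suc (height F ⊔ height G)
    height (disj F G) = suc (height F ⊔ height G)

    nodes : Form n → ℕ
    nodes (const b)  = 1
    nodes (input i)  = 1
    nodes (neg F)    = suc (nodes F)
    nodes (conj F G) = suc (nodes F + nodes G)
    nodes (disj F G) = suc (nodes F + nodes G)

    rootLabel : Form n → List Bool
    rootLabel (const b)  = false ∷ true ∷ true ∷ b ∷ []
    rootLabel (input i)  = true ∷ binary (toℕ i)
    rootLabel (neg _)    = false ∷ true ∷ false ∷ []
    rootLabel (conj _ _) = false ∷ false ∷ false ∷ []
    rootLabel (disj _ _) = false ∷ false ∷ true ∷ []

    labelAt : Form n → List Bool → Maybe (List Bool)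
    labelAt F          []          = just (rootLabel F)
    labelAt (neg F)    (false ∷ p) = labelAt F p
    labelAt (conj F G) (false ∷ p) = labelAt F p
    labelAt (conj F G) (true  ∷ p) = labelAt G p
    labelAt (disj F G) (false ∷ p) = labelAt F p
    labelAt (disj F G) (true  ∷ p) = labelAt G p
    labelAt _          _           = nothing

    -- One less than the number of gates after compilation, so that the type of `compile` shows that
    -- there is an output gate.
    top : Form n → ℕ → ℕ
    top (const b)  s = s
    top (input i)  s = s
    top (neg F)    s = suc (top F s)
    top (conj F G) s = suc (top G (suc (top F s)))
    top (disj F G) s = suc (top G (suc (top F s)))

    keep : ∀ F {s} → Fin s → Fin (suc (top F s))
    keep (const b)  = suc
    keep (input i)  = suc
    keep (neg F)    = suc ∘ keep F
    keep (conj F G) = suc ∘ keep G ∘ keep F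
    keep (disj F G) = suc ∘ keep G ∘ keep F

    compile : ∀ {s} → Circuit n s → (F : Form n) → Circuit n (suc (top F s))
    compile C (const b)  = C ▷ const b
    compile C (input i)  = C ▷ input i
    compile C (neg F)    = compile C F ▷ neg zero
    compile C (conj F G) = compile (compile C F) G ▷ conj (keep G zero) zero
    compile C (disj F G) = compile (compile C F) G ▷ disj (keep G zero) zero

    top-nodes : ∀ F s → suc (top F s) ≡ nodes F + s
    top-nodes (const b)  s = refl
    top-nodes (input i)  s = refl
    top-nodes (neg F)    s = cong suc (top-nodes F s)
    top-nodes (conj F G) s = cong suc (trans (top-nodes G _)
      (trans (cong (nodes G +_) (top-nodes F s))
        (trans (sym (+-assoc (nodes G) (nodes F) s)) (cong (_+ s) (+-comm (nodes G) (nodes F))))))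
    top-nodes (disj F G) s = cong suc (trans (top-nodes G _)
      (trans (cong (nodes G +_) (top-nodes F s))
        (trans (sym (+-assoc (nodes G) (nodes F) s)) (cong (_+ s) (+-comm (nodes G) (nodes F))))))

    module _ (x : Vec Bool n) where

      values-keep : ∀ {s} (C : Circuit n s) F i →
                    lookup (values (compile C F) x) (keep F i) ≡ lookup (values C x) i
      values-keep C (const b)  i = refl
      values-keep C (input j)  i = refl
      values-keep C (neg F)    i = values-keep C F i
      values-keep C (conj F G) i = trans (values-keep (compile C F) G (keep F i)) (values-keep C F i)
      values-keep C (disj F G) i = trans (values-keep (compile C F) G (keep F i)) (values-keep C F i)

      values-compile : ∀ {s} (C : Circuit n s) F → lookup (values (compile C F) x) zero ≡ eval x F
      values-compile C (const b)  = refl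
      values-compile C (input j)  = refl
      values-compile C (neg F)    = cong not (values-compile C F)
      values-compile C (conj F G) = cong₂ _∧_
        (trans (values-keep (compile C F) G zero) (values-compile C F)) (values-compile (compile C F) G)
      values-compile C (disj F G) = cong₂ _∨_
        (trans (values-keep (compile C F) G zero) (values-compile C F)) (values-compile (compile C F) G)

    depths-keep : ∀ {s} (C : Circuit n s) F i → lookup (depths (compile C F)) (keep F i) ≡ lookup (depths C) i
    depths-keep C (const b)  i = refl
    depths-keep C (input j)  i = refl
    depths-keep C (neg F)    i = depths-keep C F i
    depths-keep C (conj F G) i = trans (depths-keep (compile C F) G (keep F i)) (depths-keep C F i)
    depths-keep C (disj F G) i = trans (depths-keep (compile C F) G (keep F i)) (depths-keep C F i)

    depths-compile : ∀ {s} (C : Circuit n s) F → lookup (depths (compile C F)) zero ≡ height F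
    depths-compile C (const b)  = refl
    depths-compile C (input j)  = refl
    depths-compile C (neg F)    = cong suc (depths-compile C F)
    depths-compile C (conj F G) = cong suc (cong₂ _⊔_
      (trans (depths-keep (compile C F) G zero) (depths-compile C F)) (depths-compile (compile C F) G))
    depths-compile C (disj F G) = cong suc (cong₂ _⊔_
      (trans (depths-keep (compile C F) G zero) (depths-compile C F)) (depths-compile (compile C F) G))

    labelFrom-keep : ∀ {s} (C : Circuit n s) F i p → labelFrom (compile C F) (keep F i) p ≡ labelFrom C i p
    labelFrom-keep C (const b)  i p = refl
    labelFrom-keep C (input j)  i p = refl
    labelFrom-keep C (neg F)    i p = labelFrom-keep C F i p
    labelFrom-keep C (conj F G) i p = trans (labelFrom-keep (compile C F) G (keep F i) p) (labelFrom-keep C F i p)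
    labelFrom-keep C (disj F G) i p = trans (labelFrom-keep (compile C F) G (keep F i) p) (labelFrom-keep C F i p)

    labelFrom-compile : ∀ {s} (C : Circuit n s) F p → labelFrom (compile C F) zero p ≡ labelAt F p
    labelFrom-compile C (const b)  []          = refl
    labelFrom-compile C (const b)  (false ∷ p) = refl
    labelFrom-compile C (const b)  (true ∷ p)  = refl
    labelFrom-compile C (input j)  []          = refl
    labelFrom-compile C (input j)  (false ∷ p) = refl
    labelFrom-compile C (input j)  (true ∷ p)  = refl
    labelFrom-compile C (neg F)    []          = refl
    labelFrom-compile C (neg F)    (false ∷ p) = labelFrom-compile C F p
    labelFrom-compile C (neg F)    (true ∷ p)  = refl
    labelFrom-compile C (conj F G) []          = refl
    labelFrom-compile C (conj F G) (false ∷ p) =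
      trans (labelFrom-keep (compile C F) G zero p) (labelFrom-compile C F p)
    labelFrom-compile C (conj F G) (true ∷ p)  = labelFrom-compile (compile C F) G p
    labelFrom-compile C (disj F G) []          = refl
    labelFrom-compile C (disj F G) (false ∷ p) =
      trans (labelFrom-keep (compile C F) G zero p) (labelFrom-compile C F p)
    labelFrom-compile C (disj F G) (true ∷ p)  = labelFrom-compile (compile C F) G p

-- Binary notation.

module Binary where

  open import Data.Bool.Base using (Bool; true; false)
  open import Data.List.Base using (List; []; _∷_; _++_; [_]; length; foldl; foldr; reverse)
  open import Data.List.Properties using (unfold-reverse; reverse-foldl; length-++)
  open import Data.Nat.Base
  open import Data.Nat.Induction using (<-rec)
  open import Data.Nat.Logarithm using (⌈log₂_⌉; ⌈log₂⌉-mono-≤; ⌈log₂2^n⌉≡n; ⌈log₂2*n⌉≡1+⌈log₂n⌉)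
  open import Data.Nat.Properties
  open import Data.Nat.Solver using (module +-*-Solver)
  open import Data.Product.Base using (∃-syntax; _,_)
  open import Relation.Binary.PropositionalEquality using (_≡_; refl; sym; trans; cong; subst)
  open +-*-Solver using (solve; _:=_; _:+_; _:*_; con)

  infixl 6 _⊳_

  -- Appends a lowest binary digit. For the interval with number `o`, the results are the numbers of
  -- its two halves.
  _⊳_ : ℕ → Bool → ℕ
  o ⊳ false = o + o
  o ⊳ true  = suc (o + o)

  value : ℕ → List Bool → ℕ
  value = foldl _⊳_

  value-binary : ∀ n → value 0 (binary n) ≡ n
  value-binary n = trans (reverse-foldl _⊳_ 0 (binaryLSB n)) (go n)
    where
    val : List Bool → ℕ
    val = foldr (λ b v → v ⊳ b) 0
    inc : ∀ bs → val (increment bs) ≡ suc (val bs)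
    inc []           = refl
    inc (false ∷ bs) = refl
    inc (true ∷ bs)  rewrite inc bs = cong suc (+-suc (val bs) (val bs))
    go : ∀ n → val (binaryLSB n) ≡ n
    go zero    = refl
    go (suc n) = trans (inc (binaryLSB n)) (cong suc (go n))

  binaryLSB-odd : ∀ o → binaryLSB (suc (o + o)) ≡ true ∷ binaryLSB o
  binaryLSB-even : ∀ o → binaryLSB (suc o + suc o) ≡ false ∷ binaryLSB (suc o)
  binaryLSB-odd zero    = refl
  binaryLSB-odd (suc o) = cong increment (binaryLSB-even o)
  binaryLSB-even o rewrite +-suc o o = cong increment (binaryLSB-odd o)

  -- Zero is excluded because `binary 0` is empty rather than a single digit.
  binary-⊳ : ∀ o b → 0 < o ⊳ b → binary (o ⊳ b) ≡ binary o ++ [ b ]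
  binary-⊳ (suc o) false _ = trans (cong reverse (binaryLSB-even o)) (unfold-reverse false (binaryLSB (suc o)))
  binary-⊳ o       true  _ = trans (cong reverse (binaryLSB-odd o)) (unfold-reverse true (binaryLSB o))

  ⊳-mono-< : ∀ {o u} b a → o < u → o ⊳ b < u ⊳ a
  ⊳-mono-< {o} {u} b a o<u = ≤-trans (upper b) (lower a)
    where
    upper : ∀ b → suc (o ⊳ b) ≤ suc o + suc o
    upper false = s≤s (+-monoʳ-≤ o (n≤1+n o))
    upper true  = ≤-reflexive (cong suc (sym (+-suc o o)))
    lower : ∀ a → suc o + suc o ≤ u ⊳ a
    lower false = +-mono-≤ o<u o<u
    lower true  = m≤n⇒m≤1+n (+-mono-≤ o<u o<u)

  value-< : ∀ u bs → value u bs < suc u * 2 ^ length bs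
  value-< u []       = ≤-reflexive (sym (*-identityʳ (suc u)))
  value-< u (b ∷ bs) = ≤-trans (value-< (u ⊳ b) bs)
    (≤-trans (*-monoˡ-≤ (2 ^ length bs) (le b))
      (≤-reflexive (solve 2 (λ u p → (con 2 :* (con 1 :+ u)) :* p := (con 1 :+ u) :* (con 2 :* p)) refl u (2 ^ length bs))))
    where
    le : ∀ b → suc (u ⊳ b) ≤ 2 * suc u
    le false = ≤-trans (n≤1+n _) (≤-reflexive (solve 1 (λ u → con 2 :+ (u :+ u) := con 2 :* (con 1 :+ u)) refl u))
    le true  = ≤-reflexive (solve 1 (λ u → con 2 :+ (u :+ u) := con 2 :* (con 1 :+ u)) refl u)

  -- Strict, so that the topmost interval has room for a blank after the input, where the verdict is
  -- taken.
  n<2^|binary| : ∀ n → n < 2 ^ length (binary n)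
  n<2^|binary| n = subst (λ m → suc m ≤ 2 ^ length (binary n)) (value-binary n)
    (≤-trans (value-< 0 (binary n)) (≤-reflexive (*-identityˡ _)))

  halve : ∀ n → ∃[ o ] ∃[ b ] n ≡ o ⊳ b
  halve zero = 0 , false , refl
  halve (suc n) with halve n
  ... | o , false , e = o , true , cong suc e
  ... | o , true , e  = suc o , false , trans (cong suc e) (cong suc (sym (+-suc o o)))

  2^|binary|≤2n : ∀ n → 0 < n → 2 ^ length (binary n) ≤ 2 * n
  2^|binary|≤2n = <-rec _ go
    where
    go : ∀ n → (∀ {m} → m < n → 0 < m → 2 ^ length (binary m) ≤ 2 * m) →
         0 < n → 2 ^ length (binary n) ≤ 2 * n
    go n ih 0<n with halve n
    ... | zero , true , refl = ≤-refl
    ... | suc o , b , refl rewrite binary-⊳ (suc o) b 0<n | length-++ (binary (suc o)) {[ b ]}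
                                 | +-comm (length (binary (suc o))) 1 =
      *-monoʳ-≤ 2 (≤-trans (ih (smaller b) z<s) (double b))
      where
      smaller : ∀ b → suc o < suc o ⊳ b
      smaller false = s≤s (m≤n+m (suc o) o)
      smaller true  = s≤s (s≤s (≤-trans (n≤1+n o) (m≤n+m (suc o) o)))
      double : ∀ b → 2 * suc o ≤ suc o ⊳ b
      double false = ≤-reflexive (cong (suc o +_) (+-identityʳ (suc o)))
      double true  = m≤n⇒m≤1+n (double false)

  |binary|≤log : ∀ n → length (binary n) ≤ suc ⌈log₂ n ⌉
  |binary|≤log zero    = z≤n
  |binary|≤log (suc n) = begin
    length (binary (suc n))               ≡⟨ ⌈log₂2^n⌉≡n _ ⟨
    ⌈log₂ 2 ^ length (binary (suc n)) ⌉   ≤⟨ ⌈log₂⌉-mono-≤ (2^|binary|≤2n (suc n) z<s) ⟩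
    ⌈log₂ 2 * suc n ⌉                     ≡⟨ ⌈log₂2*n⌉≡1+⌈log₂n⌉ (suc n) ⟩
    suc ⌈log₂ suc n ⌉                     ∎
    where open ≤-Reasoning

-- Powers of the transition matrix as formulas of logarithmic depth.

module Matrix where

  open FiniteSets
  open Circuits hiding (top)
  open Binary
  open Rows using (DFA)

  open import Data.Bool.Base using (Bool; true; false; not; _∧_; _∨_; if_then_else_)
  open import Data.Empty using (⊥-elim)
  open import Data.Fin.Base as Fin using (Fin; zero; suc; toℕ; fromℕ; fromℕ<; inject₁)
  open import Data.Fin.Properties using (toℕ-fromℕ) renaming (_≟_ to _≟ᶠ_)
  open import Data.Fin.Relation.Unary.Top using (view; ‵fromℕ; ‵inject₁)
  open import Data.List.Base as List using ([]; _∷_; length; foldl)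
  open import Data.Maybe.Base using (just; nothing)
  open import Data.Nat.Base
  open import Data.Nat.Logarithm using (⌈log₂_⌉)
  open import Data.Nat.Properties
  open import Data.Nat.Solver using (module +-*-Solver)
  open import Data.Product.Base using (∃-syntax; _×_; _,_; proj₁; proj₂)
  open import Data.Sum.Base using (_⊎_; inj₁; inj₂)
  open import Data.Vec.Base as Vec using (Vec; []; _∷_; lookup)
  open import Function.Base using (_∘_)
  open import Function.Bundles using (_⇔_; mk⇔; Equivalence; module Inverse)
  open import Function.Construct.Composition using (_⇔-∘_)
  open import Relation.Binary.PropositionalEquality using (_≡_; refl; sym; trans; cong; subst)
  open import Relation.Nullary using (Dec; yes; no; does)

  open Equivalence using (to; from)
  open +-*-Solver using (solve; _:=_; _:+_; _:*_; con)

  symbolAt : ∀ {n} → Vec Bool n → ℕ → Symbol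
  symbolAt []      _       = nothing
  symbolAt (b ∷ x) zero    = just b
  symbolAt (b ∷ x) (suc p) = symbolAt x p

  symbolAt-< : ∀ {n} (x : Vec Bool n) {p} (l : p < n) → symbolAt x p ≡ just (lookup x (fromℕ< l))
  symbolAt-< (b ∷ x) {zero}  l = refl
  symbolAt-< (b ∷ x) {suc p} l = symbolAt-< x (s<s⁻¹ l)

  symbolAt-≥ : ∀ {n} (x : Vec Bool n) {p} → n ≤ p → symbolAt x p ≡ nothing
  symbolAt-≥ []      _       = refl
  symbolAt-≥ (b ∷ x) (s≤s l) = symbolAt-≥ x l

  -- The index counts the disjuncts still to come. A place within the chain is thus an element of a
  -- fixed finite set, which a machine can remember.
  chain : ∀ {n k} → (Fin k → Form n) → Fin (suc k) → Form n
  chain f zero            = const false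
  chain {k = suc k} f (suc c) = disj (f c) (chain (f ∘ inject₁) c)

  -- Hence the tail of a chain is a shorter chain for the same `f`, and descending changes the index
  -- alone.
  chain-inject₁ : ∀ {n k} (f : Fin (suc k) → Form n) c → chain f (inject₁ c) ≡ chain (f ∘ inject₁) c
  chain-inject₁ f zero                = refl
  chain-inject₁ {k = suc k} f (suc c) = cong (disj (f (inject₁ c))) (chain-inject₁ (f ∘ inject₁) c)

  chain-eval : ∀ {n k} x (f : Fin k → Form n) →
               eval x (chain f (fromℕ k)) ≡ true ⇔ (∃[ m ] eval x (f m) ≡ true)
  chain-eval {k = zero}  x f = mk⇔ (λ ()) (λ ())
  chain-eval {k = suc k} x f = mk⇔ forth back
    where
    forth : eval x (f (fromℕ k)) ∨ eval x (chain (f ∘ inject₁) (fromℕ k)) ≡ true → ∃[ m ] eval x (f m) ≡ true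
    forth e with eval x (f (fromℕ k)) in e′
    ... | true  = fromℕ k , e′
    ... | false = let m , e″ = to (chain-eval x (f ∘ inject₁)) e in inject₁ m , e″
    ∨-true : ∀ a {b} → b ≡ true → a ∨ b ≡ true
    ∨-true true  e = refl
    ∨-true false e = e
    back : (∃[ m ] eval x (f m) ≡ true) → eval x (f (fromℕ k)) ∨ eval x (chain (f ∘ inject₁) (fromℕ k)) ≡ true
    back (m , e) with view m
    ... | ‵fromℕ rewrite e = refl
    ... | ‵inject₁ j = ∨-true _ (from (chain-eval x (f ∘ inject₁)) (j , e))

  chain-height : ∀ {n k h} (f : Fin k → Form n) c → (∀ m → height (f m) ≤ h) → height (chain f c) ≤ toℕ c + h
  chain-height f zero p = z≤n
  chain-height {k = suc k} {h} f (suc c) p =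
    s≤s (⊔-lub (≤-trans (p c) (m≤n+m h (toℕ c))) (chain-height (f ∘ inject₁) c (p ∘ inject₁)))

  chain-nodes : ∀ {n k h} (f : Fin k → Form n) c → (∀ m → nodes (f m) ≤ h) → nodes (chain f c) ≤ suc (toℕ c * suc h)
  chain-nodes f zero p = ≤-refl
  chain-nodes {k = suc k} {h} f (suc c) p = s≤s (≤-trans
    (+-mono-≤ (p c) (chain-nodes (f ∘ inject₁) c (p ∘ inject₁)))
    (≤-reflexive (+-suc h (toℕ c * suc h))))

  module Powers (N : ℕ) (δ : Fin N → Symbol → Fin N) where

    can : Fin N → Symbol → Fin N → Bool
    can i s j = does (δ i s ≟ᶠ j)

    -- Of the input bit, the function taking true to a and false to b.
    unary : ∀ {n} → Bool → Bool → Fin n → Form n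
    unary true  true  p = const true
    unary true  false p = input p
    unary false true  p = neg (input p)
    unary false false p = const false

    leaf : ∀ n o → Dec (o < n) → Fin N → Fin N → Form n
    leaf n o (yes o<n) i j = unary (can i (just true) j) (can i (just false) j) (fromℕ< o<n)
    leaf n o (no _)    i j = const (can i nothing j)

    -- mat n d o i j says that the automaton gets from i to j on the positions
    -- from o * 2 ^ d up to (suc o) * 2 ^ d, those from n on being blank.
    mat : ∀ n → ℕ → ℕ → Fin N → Fin N → Form n
    via : ∀ n → ℕ → ℕ → Fin N → Fin N → Fin N → Form n
    mat n zero    o i j = leaf n o (o <? n) i j
    mat n (suc d) o i j = chain (via n d o i j) (fromℕ N)
    via n d o i j m = conj (mat n d (o ⊳ false) i m) (mat n d (o ⊳ true) m j)

    walk : (ℕ → Symbol) → Fin N → ℕ → ℕ → Fin N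
    walk s i a zero    = i
    walk s i a (suc l) = walk s (δ i (s a)) (suc a) l

    walk-+ : ∀ s i a k l → walk s i a (k + l) ≡ walk s (walk s i a k) (a + k) l
    walk-+ s i a zero    l rewrite +-identityʳ a = refl
    walk-+ s i a (suc k) l rewrite +-suc a k = walk-+ s (δ i (s a)) (suc a) k l

    can⇔ : ∀ i s j → can i s j ≡ true ⇔ δ i s ≡ j
    can⇔ i s j with δ i s ≟ᶠ j
    ... | yes e = mk⇔ (λ _ → e) (λ _ → refl)
    ... | no ¬e = mk⇔ (λ ()) (λ e → ⊥-elim (¬e e))

    unary-eval : ∀ {n} a b (x : Vec Bool n) p {c} → lookup x p ≡ c →
                 eval x (unary a b p) ≡ (if c then a else b)
    unary-eval true  true  x p {true}  e = refl
    unary-eval true  true  x p {false} e = refl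
    unary-eval true  false x p {true}  e = e
    unary-eval true  false x p {false} e = e
    unary-eval false true  x p {true}  e = cong not e
    unary-eval false true  x p {false} e = cong not e
    unary-eval false false x p {true}  e = refl
    unary-eval false false x p {false} e = refl

    leaf-eval : ∀ {n} (x : Vec Bool n) o d i j → eval x (leaf n o d i j) ≡ can i (symbolAt x o) j
    leaf-eval x o (yes l) i j rewrite symbolAt-< x l with lookup x (fromℕ< l) in e
    ... | true  = unary-eval (can i (just true) j) (can i (just false) j) x (fromℕ< l) e
    ... | false = unary-eval (can i (just true) j) (can i (just false) j) x (fromℕ< l) e
    leaf-eval x o (no l)  i j rewrite symbolAt-≥ x (≮⇒≥ l) = refl

    ∧-true⇔ : ∀ a b → a ∧ b ≡ true ⇔ (a ≡ true × b ≡ true)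
    ∧-true⇔ true  b = mk⇔ (λ e → refl , e) proj₂
    ∧-true⇔ false b = mk⇔ (λ ()) (λ ())

    -- The walk splits at the middle of the interval. It is deterministic, so the disjunct that
    -- holds is the one for the state actually reached there.
    mat-eval : ∀ {n} (x : Vec Bool n) d o i j →
               eval x (mat n d o i j) ≡ true ⇔ walk (symbolAt x) i (o * 2 ^ d) (2 ^ d) ≡ j
    mat-eval {n} x zero o i j rewrite *-identityʳ o | leaf-eval x o (o <? n) i j = can⇔ i (symbolAt x o) j
    mat-eval {n} x (suc d) o i j = mk⇔
      (λ e → let m , e′ = to (chain-eval x (via n d o i j)) e
                 l , r = to (∧-true⇔ _ _) e′
             in trans split (trans (cong (λ m → walk s m _ (2 ^ d)) (to (mat-eval x d (o ⊳ false) i m) l))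
                                   (to (mat-eval x d (o ⊳ true) m j) r)))
      (λ e → from (chain-eval x (via n d o i j))
        (mid , from (∧-true⇔ _ _) (from (mat-eval x d (o ⊳ false) i mid) refl ,
                                  from (mat-eval x d (o ⊳ true) mid j) (trans (sym split) e))))
      where
      s = symbolAt x
      q = 2 ^ d
      mid = walk s i ((o ⊳ false) * q) q
      split : walk s i (o * 2 ^ suc d) (2 ^ suc d) ≡ walk s mid ((o ⊳ true) * q) q
      split rewrite +-identityʳ q = trans
        (cong (λ a → walk s i a (q + q)) (solve 2 (λ o q → o :* (q :+ q) := (o :+ o) :* q) refl o q))
        (trans (walk-+ s i ((o + o) * q) q q) (cong (λ a → walk s mid a q) (+-comm ((o + o) * q) q)))

    mat-height : ∀ n d o i j → height (mat n d o i j) ≤ d * suc N + 1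
    mat-height n zero o i j = leaf-height (o <? n)
      where
      unary-height : ∀ a b (p : Fin n) → height (unary a b p) ≤ 1
      unary-height true  true  p = z≤n
      unary-height true  false p = z≤n
      unary-height false true  p = ≤-refl
      unary-height false false p = z≤n
      leaf-height : ∀ d → height (leaf n o d i j) ≤ 1
      leaf-height (yes l) = unary-height (can i (just true) j) (can i (just false) j) (fromℕ< l)
      leaf-height (no _)  = z≤n
    mat-height n (suc d) o i j = ≤-trans
      (chain-height (via n d o i j) (fromℕ N) λ m → s≤s (⊔-lub (mat-height n d _ i m) (mat-height n d _ m j)))
      (≤-reflexive (trans (cong (_+ suc (d * suc N + 1)) (toℕ-fromℕ N))
        (trans (+-suc N _) (sym (+-assoc (suc N) (d * suc N) 1)))))

    -- If `X` bounds the level below, a chain of `N` products has at most 1 + N(2 + 2X) nodes, which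
    -- is at most X + 3NX as 2 ≤ X. The summand 2 also covers a leaf, which has up to two nodes.
    base : ℕ
    base = 2 + 3 * N

    mat-nodes : ∀ n d o i j → nodes (mat n d o i j) ≤ base ^ suc d
    mat-nodes n zero o i j = ≤-trans (leaf-nodes (o <? n)) (≤-trans (m≤m+n 2 (3 * N)) (≤-reflexive (sym (*-identityʳ base))))
      where
      unary-nodes : ∀ a b (p : Fin n) → nodes (unary a b p) ≤ 2
      unary-nodes true  true  p = s≤s z≤n
      unary-nodes true  false p = s≤s z≤n
      unary-nodes false true  p = ≤-refl
      unary-nodes false false p = s≤s z≤n
      leaf-nodes : ∀ d → nodes (leaf n o d i j) ≤ 2
      leaf-nodes (yes l) = unary-nodes (can i (just true) j) (can i (just false) j) (fromℕ< l)
      leaf-nodes (no _)  = s≤s z≤n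
    mat-nodes n (suc d) o i j = begin
      nodes (chain (via n d o i j) (fromℕ N))
        ≤⟨ chain-nodes (via n d o i j) (fromℕ N) (λ m → s≤s (+-mono-≤ (mat-nodes n d _ i m) (mat-nodes n d _ m j))) ⟩
      suc (toℕ (fromℕ N) * (2 + (X + X)))  ≡⟨ cong (λ k → suc (k * (2 + (X + X)))) (toℕ-fromℕ N) ⟩
      1 + N * (2 + (X + X))                ≤⟨ +-mono-≤ 1≤X (*-monoʳ-≤ N (+-monoˡ-≤ (X + X) 2≤X)) ⟩
      X + N * (X + (X + X))                ≤⟨ m≤m+n _ X ⟩
      X + N * (X + (X + X)) + X            ≡⟨ solve 2 (λ X N → X :+ N :* (X :+ (X :+ X)) :+ X := (con 2 :+ con 3 :* N) :* X) refl X N ⟩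
      base * X                             ∎
      where
      open ≤-Reasoning
      X = base ^ suc d
      2≤X : 2 ≤ X
      2≤X = ≤-trans (m≤m+n 2 (3 * N)) (m≤m*n base (base ^ d) ⦃ m^n≢0 base d ⦄)
      1≤X : 1 ≤ X
      1≤X = ≤-trans (n≤1+n 1) 2≤X

  m<2^m : ∀ m → m < 2 ^ m
  m<2^m zero    = z<s
  m<2^m (suc m) = ≤-trans (+-mono-≤ (>-nonZero⁻¹ (2 ^ m) ⦃ m^n≢0 2 m ⦄) (m<2^m m)) (≤-reflexive (cong (2 ^ m +_) (sym (+-identityʳ (2 ^ m)))))

  poly : ∀ B → NonZero B → ∃[ c ] ∀ n → B ^ suc (length (binary n)) ≤ n ^ c + c
  poly B B≢0 = c , bound
    where
    -- For n ≥ 2, B < 2^B and 2^(D+1) ≤ 4n ≤ n³ give the exponent 3B. The summand B² serves as the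
    -- additive constant for n = 0 and n = 1.
    c = 3 * B + B * B
    instance _ = B≢0
    open ≤-Reasoning
    bound : ∀ n → B ^ suc (length (binary n)) ≤ n ^ c + c
    bound 0 = begin
      B * 1       ≤⟨ *-monoʳ-≤ B (>-nonZero⁻¹ B) ⟩
      B * B       ≤⟨ m≤n+m (B * B) (3 * B) ⟩
      c           ≤⟨ m≤n+m c (0 ^ c) ⟩
      0 ^ c + c   ∎
    bound 1 = begin
      B * (B * 1) ≡⟨ cong (B *_) (*-identityʳ B) ⟩
      B * B       ≤⟨ m≤n+m (B * B) (3 * B) ⟩
      c           ≤⟨ m≤n+m c (1 ^ c) ⟩
      1 ^ c + c   ∎
    bound n@(suc (suc _)) = begin
      B ^ suc D             ≤⟨ ^-monoˡ-≤ (suc D) (<⇒≤ (m<2^m B)) ⟩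
      (2 ^ B) ^ suc D       ≡⟨ ^-*-assoc 2 B (suc D) ⟩
      2 ^ (B * suc D)       ≡⟨ cong (2 ^_) (*-comm B (suc D)) ⟩
      2 ^ (suc D * B)       ≡⟨ ^-*-assoc 2 (suc D) B ⟨
      (2 ^ suc D) ^ B       ≤⟨ ^-monoˡ-≤ B (*-monoʳ-≤ 2 (2^|binary|≤2n n z<s)) ⟩
      (2 * (2 * n)) ^ B     ≤⟨ ^-monoˡ-≤ B (*-mono-≤ 2≤n (*-monoˡ-≤ n 2≤n)) ⟩
      (n * (n * n)) ^ B     ≡⟨ cong (λ m → (n * (n * m)) ^ B) (*-identityʳ n) ⟨
      (n ^ 3) ^ B           ≡⟨ ^-*-assoc n 3 B ⟩
      n ^ (3 * B)           ≤⟨ ^-monoʳ-≤ n (m≤m+n (3 * B) (B * B)) ⟩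
      n ^ c                 ≤⟨ m≤m+n (n ^ c) c ⟩
      n ^ c + c             ∎
      where
      D = length (binary n)
      2≤n : 2 ≤ n
      2≤n = s≤s (s≤s z≤n)

  module FromDFA (A : DFA) where
    open DFA A

    extended : Finite (State ⊎ Bool)
    extended = finite ⊎ᶠ finite-Bool

    N : ℕ
    N = proj₁ extended

    open Inverse (proj₂ extended) using (strictlyInverseʳ) renaming (to to code; from to decode)

    -- The first blank turns the final state into the verdict, so that acceptance
    -- is reachability of a single state.
    onSymbol : State ⊎ Bool → Symbol → State ⊎ Bool
    onSymbol (inj₁ s) (just b) = inj₁ (next s b)
    onSymbol (inj₁ s) nothing  = inj₂ (final s)
    onSymbol (inj₂ v) _        = inj₂ v

    δ : Fin N → Symbol → Fin N
    δ i s = code (onSymbol (decode i) s)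

    source target : Fin N
    source = code (inj₁ init)
    target = code (inj₂ true)

    open Powers N δ public

    -- One level per binary digit of `n`: the interval covers the whole input, and the path advances
    -- in step with the digits.
    form : ∀ n → Form n
    form n = mat n (length (binary n)) 0 source target

    δ-code : ∀ q s → δ (code q) s ≡ code (onSymbol q s)
    δ-code q s = cong (λ q → code (onSymbol q s)) (strictlyInverseʳ q)

    walk-verdict : ∀ s v a l → walk s (code (inj₂ v)) a l ≡ code (inj₂ v)
    walk-verdict s v a zero = refl
    walk-verdict s v a (suc l) rewrite δ-code (inj₂ v) (s a) = walk-verdict s v (suc a) l

    walk-word : ∀ s w a q l → (∀ p → s (a + p) ≡ symbolAt (Vec.fromList w) p) → length w < l →
                walk s (code (inj₁ q)) a l ≡ code (inj₂ (final (foldl next q w)))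
    walk-word s [] a q (suc l) e _
      rewrite trans (cong s (sym (+-identityʳ a))) (e 0) | δ-code (inj₁ q) nothing = walk-verdict s _ (suc a) l
    walk-word s (b ∷ w) a q (suc l) e (s<s l<)
      rewrite trans (cong s (sym (+-identityʳ a))) (e 0) | δ-code (inj₁ q) (just b) =
      walk-word s w (suc a) (next q b) l (λ p → trans (cong s (sym (+-suc a p))) (e (suc p))) l<

    form-accepts : ∀ w → eval (Vec.fromList w) (form (length w)) ≡ true ⇔ Accepts w
    form-accepts w = mk⇔ verdict (λ e → cong (λ v → code (inj₂ v)) e) ⇔-∘
      subst (λ i → eval x (form (length w)) ≡ true ⇔ i ≡ target)
        (walk-word (symbolAt x) w 0 init _ (λ _ → refl) (n<2^|binary| (length w)))
        (mat-eval x (length (binary (length w))) 0 source target)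
      where
      x = Vec.fromList w
      verdict : ∀ {v} → code (inj₂ v) ≡ code (inj₂ true) → v ≡ true
      verdict {v} e with trans (sym (strictlyInverseʳ (inj₂ v))) (trans (cong decode e) (strictlyInverseʳ (inj₂ true)))
      ... | refl = refl

    family : Family
    family = record { size = λ n → Circuits.top (form n) 0 ; circuit = λ n → compile [] (form n) }

    open Family family

    polySize : ∃[ c ] ∀ n → size n ≤ n ^ c + c
    polySize =
      let c , h = poly base _
      in c , λ n → ≤-trans (n≤1+n _) (≤-trans
           (≤-reflexive (trans (top-nodes (form n) 0) (+-identityʳ _)))
           (≤-trans (mat-nodes n (length (binary n)) 0 source target) (h n)))

    head≡lookup : ∀ {X : Set} {k} (xs : Vec X (suc k)) → Vec.head xs ≡ lookup xs zero
    head≡lookup (_ ∷ _) = refl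

    logDepth : ∃[ c ] ∀ n → depth (circuit n) ≤ c * ⌈log₂ n ⌉ + c
    logDepth = suc (suc N) , λ n → begin
      depth (circuit n)                   ≡⟨ trans (head≡lookup (depths (circuit n))) (depths-compile [] (form n)) ⟩
      height (form n)                     ≤⟨ mat-height n (length (binary n)) 0 source target ⟩
      length (binary n) * suc N + 1       ≤⟨ +-monoˡ-≤ 1 (*-monoˡ-≤ (suc N) (|binary|≤log n)) ⟩
      suc ⌈log₂ n ⌉ * suc N + 1           ≡⟨ solve 2 (λ L K → (con 1 :+ L) :* K :+ con 1 := K :* L :+ (con 1 :+ K)) refl ⌈log₂ n ⌉ (suc N) ⟩
      suc N * ⌈log₂ n ⌉ + suc (suc N)     ≤⟨ +-monoˡ-≤ (suc (suc N)) (*-monoˡ-≤ ⌈log₂ n ⌉ (n≤1+n (suc N))) ⟩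
      suc (suc N) * ⌈log₂ n ⌉ + suc (suc N) ∎
      where open ≤-Reasoning

    recognises : ∀ w → Accepts w ⇔ output (circuit (length w)) (Vec.fromList w) ≡ true
    recognises w = subst (λ b → Accepts w ⇔ b ≡ true)
      (sym (trans (head≡lookup (values (circuit (length w)) (Vec.fromList w)))
                  (values-compile (Vec.fromList w) [] (form (length w)))))
      (mk⇔ (from (form-accepts w)) (to (form-accepts w)))

-- Read-only machines with one-way heads.

module OneWay where

  open FiniteSets

  open import Data.Bool.Base using (Bool; true; false)
  open import Data.List.Base as List using (List; []; _∷_; head; drop)
  open import Data.Maybe.Base using (Maybe; just; nothing)
  open import Data.Nat.Base using (ℕ; zero; suc)
  open import Data.Product.Base using (_×_; _,_)
  open import Data.Sum.Base as Sum using (_⊎_; inj₁; inj₂)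
  open import Data.Vec.Base as Vec using (Vec; []; _∷_)
  open import Relation.Binary.PropositionalEquality using (_≡_; refl)

  -- A machine that only reads, with three heads moving to the right; the flags
  -- say which of the heads move.
  record OneWay : Set₁ where
    field
      State  : Set
      finite : Finite State
      start  : State
      δ      : State → Symbol → Symbol → Symbol → Bool ⊎ (State × Bool × Bool × Bool)

    advance : Bool → List Bool → List Bool
    advance true  = drop 1
    advance false xs = xs

    go    : ℕ → State → List Bool → List Bool → List Bool → Maybe Bool
    after : ℕ → Bool ⊎ (State × Bool × Bool × Bool) → List Bool → List Bool → List Bool → Maybe Bool
    go zero    s x y z = nothing
    go (suc k) s x y z = after k (δ s (head x) (head y) (head z)) x y z
    after k (inj₁ b)                 x y z = just b
    after k (inj₂ (s , a , b , c)) x y z = go k s (advance a x) (advance b y) (advance c z)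

    move : Symbol → Bool → Symbol × Move
    move s true  = s , right
    move s false = s , stay

    moves : Symbol → Symbol → Symbol → Bool ⊎ (State × Bool × Bool × Bool) →
            Bool ⊎ (State × Vec (Symbol × Move) 3)
    moves x y z (inj₁ b)                = inj₁ b
    moves x y z (inj₂ (s , a , b , c)) = inj₂ (s , move x a ∷ move y b ∷ move z c ∷ [])

    machine : Machine
    machine = record
      { State = State ; finite = finite ; start = start ; work = 0
      ; δ = λ { s (x ∷ y ∷ z ∷ []) → moves x y z (δ s x y z) } }

    -- `ls` collects the cells left behind, to which no head returns.
    on : List Symbol → List Bool → Tape
    on ls []       = tape ls nothing []
    on ls (b ∷ bs) = tape ls (just b) (List.map just bs)

    load≡on : ∀ xs → load xs ≡ on [] xs
    load≡on []      = refl
    load≡on (_ ∷ _) = refl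

    current-on : ∀ ls xs → Tape.current (on ls xs) ≡ head xs
    current-on ls []      = refl
    current-on ls (_ ∷ _) = refl

    passed : Bool → List Bool → List Symbol → List Symbol
    passed true  xs ls = head xs ∷ ls
    passed false xs ls = ls

    act-on : ∀ b ls xs → act (move (head xs) b) (on ls xs) ≡ on (passed b xs ls) (advance b xs)
    act-on true  ls []           = refl
    act-on true  ls (_ ∷ [])     = refl
    act-on true  ls (_ ∷ _ ∷ _)  = refl
    act-on false ls []           = refl
    act-on false ls (_ ∷ _)      = refl

    run≡go : ∀ k s l₁ l₂ l₃ x y z →
             Machine.run machine k s (on l₁ x ∷ on l₂ y ∷ on l₃ z ∷ []) ≡ go k s x y z
    run≡go zero    s l₁ l₂ l₃ x y z = refl
    run≡go (suc k) s l₁ l₂ l₃ x y z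
      rewrite current-on l₁ x | current-on l₂ y | current-on l₃ z
      with δ s (head x) (head y) (head z)
    ... | inj₁ b = refl
    ... | inj₂ (s′ , a , b , c)
      rewrite act-on a l₁ x | act-on b l₂ y | act-on c l₃ z =
      run≡go k s′ (passed a x l₁) (passed b y l₂) (passed c z l₃) (advance a x) (advance b y) (advance c z)

    runOn≡go : ∀ k x y z → Machine.runOn machine k x y z ≡ go k start x y z
    runOn≡go k x y z rewrite load≡on x | load≡on y | load≡on z = run≡go k start [] [] [] x y z

-- A machine for the extended connection language.

module Uniformity where

  open FiniteSets
  open Circuits hiding (top)
  open Binary
  open OneWay
  open Matrix

  open import Data.Bool.Base using (Bool; true; false; not; _∨_; if_then_else_)
  open import Data.Empty using (⊥-elim)
  open import Data.Fin.Base as Fin using (Fin; zero; suc; toℕ; fromℕ; fromℕ<; inject₁)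
  open import Data.Fin.Properties using (toℕ-fromℕ<)
  open import Data.List.Base as List using (List; []; _∷_; _++_; [_]; length; head)
  open import Data.List.Properties using (++-assoc; ++-identityʳ; ++-cancelˡ; ∷-injectiveʳ)
  open import Data.Maybe.Base using (Maybe; just; nothing)
  open import Data.Maybe.Properties using (just-injective)
  open import Data.Nat.Base hiding (compare)
  open import Data.Nat.Properties
  open import Data.Product.Base using (∃-syntax; _×_; _,_; proj₁; proj₂)
  open import Data.Sum.Base using (_⊎_; inj₁; inj₂)
  open import Data.Unit.Base using (⊤; tt)
  open import Data.Vec.Base as Vec using (Vec; []; _∷_; _∷ʳ_)
  open import Function.Base using (_∘_; case_of_)
  open import Function.Bundles using (_⇔_; mk⇔; Equivalence)
  open import Relation.Binary.PropositionalEquality using (_≡_; _≢_; refl; sym; trans; cong; subst)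
  open import Relation.Nullary using (¬_; yes; no)

  open Equivalence using (to; from)

  -- The machine follows the path through the levels of mat, moving its head on n
  -- once per level.  It remembers how the position chosen so far compares with
  -- the prefix of n read (cmp), whether that position is nonzero (nz), and the
  -- status of y: a fixed label to be read at the end, the label of an input gate
  -- matched so far, or the label of an input gate that does not match.
  module Checker (N : ℕ) (δ : Fin N → Symbol → Fin N) (source target : Fin N) where
    open Powers N δ

    -- Where the path stands: at a matrix entry, within its chain of disjunctions, at a product of
    -- two entries, or at the input below a negation.
    Control : Set
    Control = (Fin N × Fin N) ⊎ (Fin N × Fin N × Fin (suc N)) ⊎ (Fin N × Fin N × Fin N) ⊎ ⊤

    pattern node i j    = inj₁ (i , j)
    pattern link i j c  = inj₂ (inj₁ (i , j , c))
    pattern both i j m  = inj₂ (inj₂ (inj₁ (i , j , m)))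
    pattern wire        = inj₂ (inj₂ (inj₂ tt))

    Flags : Set
    Flags = Maybe Bool × Bool × Maybe Bool

    pattern same    = nothing
    pattern below   = just true
    pattern above   = just false

    pattern fixed    = nothing
    pattern matching = just true
    pattern failed   = just false

    -- Four cells suffice for `expect`, since the longest fixed label, that of a constant, has four
    -- bits.
    State : Set
    State = ⊤ ⊎ (Control × Flags) ⊎ Vec Symbol 4

    pattern begin     = inj₁ tt
    pattern at c fl   = inj₂ (inj₁ (c , fl))
    pattern expect v  = inj₂ (inj₂ v)

    finite-State : Finite State
    finite-State = finite-⊤ ⊎ᶠ
      ((N² ⊎ᶠ (finite-Fin N ×ᶠ finite-Fin N ×ᶠ finite-Fin (suc N)) ⊎ᶠ
        (finite-Fin N ×ᶠ finite-Fin N ×ᶠ finite-Fin N) ⊎ᶠ finite-⊤) ×ᶠ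
       (finite-Maybe finite-Bool ×ᶠ finite-Bool ×ᶠ finite-Maybe finite-Bool)) ⊎ᶠ
      finite-Vec (finite-Maybe finite-Bool) 4
      where N² = finite-Fin N ×ᶠ finite-Fin N

    Result : Set
    Result = Bool ⊎ (State × Bool × Bool × Bool)

    -- Exactly the labels of input gates begin with `true`, so a `y` that does is rejected at every
    -- other gate.
    finish : Vec Symbol 4 → Maybe Bool → Result
    finish v fixed    = inj₂ (expect v , false , false , false)
    finish v (just _) = inj₁ false

    onConst : Bool → Maybe Bool → Symbol → Result
    onConst b md nothing  = finish (just false ∷ just true ∷ just true ∷ just b ∷ []) md
    onConst b md (just _) = inj₁ false

    onInput : Maybe Bool → Symbol → Symbol → Result
    onInput matching nothing nothing = inj₁ true
    onInput _        _       _       = inj₁ false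

    onUnary : Bool → Bool → Flags → Symbol → Symbol → Result
    onUnary true  true  (_ , _ , md) p y = onConst true md p
    onUnary false false (_ , _ , md) p y = onConst false md p
    onUnary true  false (_ , _ , md) p y = onInput md p y
    onUnary false true  (_ , _ , md) nothing y =
      finish (just false ∷ just true ∷ just false ∷ nothing ∷ []) md
    onUnary false true  fl (just false) y = inj₂ (at wire fl , false , true , false)
    onUnary false true  fl (just true)  y = inj₁ false

    onLink : Fin N → Fin N → Fin (suc N) → Flags → Symbol → Result
    onLink i j zero    (_ , _ , md) p = onConst false md p
    onLink i j (suc c) (_ , _ , md) nothing =
      finish (just false ∷ just false ∷ just true ∷ nothing ∷ []) md
    onLink i j (suc c) fl (just true)  = inj₂ (at (link i j (inject₁ c)) fl , false , true , false)
    onLink i j (suc c) fl (just false) = inj₂ (at (both i j c) fl , false , true , false)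

    -- Once `n` is exhausted the comparison is final. Positions are counted from 0, so a position
    -- equal to `n` is already blank.
    onNode : Fin N → Fin N → Flags → Symbol → Symbol → Symbol → Result
    onNode i j fl             (just _) p y = onLink i j (fromℕ N) fl p
    onNode i j fl@(below , _) nothing  p y = onUnary (can i (just true) j) (can i (just false) j) fl p y
    onNode i j (same , _ , md)  nothing p y = onConst (can i nothing j) md p
    onNode i j (above , _ , md) nothing p y = onConst (can i nothing j) md p

    compare : Maybe Bool → Bool → Bool → Maybe Bool
    compare (just c) _     _     = just c
    compare same     false true  = below
    compare same     true  false = above
    compare same     _     _     = same

    -- Leading zeros of a position are absent from its label, so `y` is consumed only once the
    -- position is nonzero.
    match : Maybe Bool → Bool → Bool → Symbol → Maybe Bool × Bool
    match matching true true  (just true)  = matching , true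
    match matching true false (just false) = matching , true
    match matching true _     _            = failed , false
    match md       _    _     _            = md , false

    onBoth : Fin N → Fin N → Fin N → Flags → Symbol → Symbol → Symbol → Result
    onBoth i j m (_ , _ , md) n nothing y =
      finish (just false ∷ just false ∷ just false ∷ nothing ∷ []) md
    onBoth i j m _ nothing (just b) y = inj₁ false
    -- The path bit `b` selects the conjunct and is, by the same token, the next digit of the
    -- position.
    onBoth i j m (cmp , nz , md) (just a) (just b) y =
      inj₂ ( at (node (if b then m else i) (if b then j else m))
                (compare cmp b a , (nz ∨ b) , proj₁ (match md (nz ∨ b) b y))
           , true , true , proj₂ (match md (nz ∨ b) b y))

    -- Matched bits leave at the front while blanks enter at the back, so a blank in front marks the
    -- end of the label.
    onExpect : Vec Symbol 4 → Symbol → Result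
    onExpect (nothing ∷ v)    nothing      = inj₁ true
    onExpect (just true ∷ v)  (just true)  = inj₂ (expect (v ∷ʳ nothing) , false , false , true)
    onExpect (just false ∷ v) (just false) = inj₂ (expect (v ∷ʳ nothing) , false , false , true)
    onExpect _                _            = inj₁ false

    onBegin : Symbol → Result
    onBegin (just true) = inj₂ (at (node source target) (same , false , matching) , false , false , true)
    onBegin _           = inj₂ (at (node source target) (same , false , fixed) , false , false , false)

    transition : State → Symbol → Symbol → Symbol → Result
    transition begin               n p y = onBegin y
    transition (at (node i j) fl)   n p y = onNode i j fl n p y
    transition (at (link i j c) fl) n p y = onLink i j c fl p
    transition (at (both i j m) fl) n p y = onBoth i j m fl n p y
    transition (at wire (_ , _ , md)) n p y = onInput md p y
    transition (expect v)          n p y = onExpect v y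

    checker : OneWay
    checker = record { State = State ; finite = finite-State ; start = begin ; δ = transition }

    open OneWay.OneWay checker using (go; after; machine; runOn≡go)

    Compares : Maybe Bool → ℕ → ℕ → Set
    Compares same  o u = o ≡ u
    Compares below o u = o < u
    Compares above o u = u < o

    compares-⊳ : ∀ cmp {o u} b a → Compares cmp o u → Compares (compare cmp b a) (o ⊳ b) (u ⊳ a)
    compares-⊳ same  false false refl = refl
    compares-⊳ same  true  true  refl = refl
    compares-⊳ same  false true  refl = ≤-refl
    compares-⊳ same  true  false refl = ≤-refl
    compares-⊳ below b     a     l    = ⊳-mono-< b a l
    compares-⊳ above b     a     l    = ⊳-mono-< a b l

    Nonzero : Bool → ℕ → Set
    Nonzero true  o = 0 < o
    Nonzero false o = o ≡ 0

    nonzero-⊳ : ∀ nz {o} b → Nonzero nz o → Nonzero (nz ∨ b) (o ⊳ b)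
    nonzero-⊳ true  {suc o} false l    = z<s
    nonzero-⊳ true          true  l    = z<s
    nonzero-⊳ false         false refl = refl
    nonzero-⊳ false         true  refl = z<s

    module _ (n : ℕ) (y : List Bool) where

      -- `ys` is the unread part of `y`. Failure is permanent, because the digits of later positions
      -- extend those of `o`.
      Status : Maybe Bool → ℕ → List Bool → Set
      Status fixed    o ys = y ≡ ys × (∀ z → y ≢ true ∷ z)
      Status matching o ys = y ≡ true ∷ binary o ++ ys
      Status failed   o ys = ∃[ z ] y ≡ true ∷ z × (∀ z′ → z ≢ binary o ++ z′)

      adv : Bool → List Bool → List Bool
      adv = OneWay.OneWay.advance checker

      status-⊳ : ∀ md nz {o} b ys → Nonzero nz (o ⊳ b) → (nz ≡ false → o ⊳ b ≡ o) → Status md o ys →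
                 Status (proj₁ (match md nz b (head ys))) (o ⊳ b) (adv (proj₂ (match md nz b (head ys))) ys)
      status-⊳ fixed    nz    b ys _ _ st = st
      status-⊳ failed   false b ys _ e st rewrite e refl = st
      status-⊳ matching false b ys _ e st rewrite e refl = st
      status-⊳ failed   true {o} b ys l _ (z , e , h) = z , e , λ z′ e′ → h (b ∷ z′)
        (trans e′ (trans (cong (_++ z′) (binary-⊳ o b l)) (++-assoc (binary o) [ b ] z′)))
      status-⊳ matching true {o} b ys l _ st = matched b ys l st
        where
        next : ∀ b ys → 0 < o ⊳ b → binary (o ⊳ b) ++ ys ≡ binary o ++ b ∷ ys
        next b ys l = trans (cong (_++ ys) (binary-⊳ o b l)) (++-assoc (binary o) [ b ] ys)
        clash : ∀ b ys → 0 < o ⊳ b → (∀ z → ys ≢ b ∷ z) → ∀ z → binary o ++ ys ≢ binary (o ⊳ b) ++ z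
        clash b ys l h z e = h z (++-cancelˡ (binary o) ys (b ∷ z) (trans e (next b z l)))
        matched : ∀ b ys → 0 < o ⊳ b → y ≡ true ∷ binary o ++ ys →
                  Status (proj₁ (match matching true b (head ys))) (o ⊳ b)
                         (adv (proj₂ (match matching true b (head ys))) ys)
        matched true  (true ∷ ys)  l e = trans e (cong (true ∷_) (sym (next true ys l)))
        matched false (false ∷ ys) l e = trans e (cong (true ∷_) (sym (next false ys l)))
        matched true  []           l e = _ , e , clash true [] l λ _ ()
        matched true  (false ∷ ys) l e = _ , e , clash true (false ∷ ys) l λ _ ()
        matched false []           l e = _ , e , clash false [] l λ _ ()
        matched false (true ∷ ys)  l e = _ , e , clash false (true ∷ ys) l λ _ ()

      Decides : Maybe Bool → Set → Set
      Decides r X = ∃[ b ] r ≡ just b × (b ≡ true ⇔ X)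

      accepts : ∀ {X} → X → Decides (just true) X
      accepts x = true , refl , mk⇔ (λ _ → x) (λ _ → refl)

      rejects : ∀ {X} → ¬ X → Decides (just false) X
      rejects ¬x = false , refl , mk⇔ (λ ()) (⊥-elim ∘ ¬x)

      -- Every step except the entry into `expect` and the last one advances on the path or on the
      -- label, so what is left of them bounds the time up to a constant.
      Decided : Result → List Bool → List Bool → List Bool → Set → Set
      Decided r ns p ys X = ∀ k → suc (length p + length ys) ≤ k → Decides (after k r ns p ys) X

      reading : ∀ {k} → Vec Symbol k → List Bool
      reading []            = []
      reading (nothing ∷ v) = []
      reading (just b ∷ v)  = b ∷ reading v

      reading-∷ʳ : ∀ {k} (v : Vec Symbol k) → reading (v ∷ʳ nothing) ≡ reading v
      reading-∷ʳ []            = refl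
      reading-∷ʳ (nothing ∷ v) = refl
      reading-∷ʳ (just b ∷ v)  = cong (b ∷_) (reading-∷ʳ v)

      expect-decides : ∀ v ns ys k → length ys < k → Decides (go k (expect v) ns [] ys) (reading v ≡ ys)
      expect-decides (nothing ∷ v)    ns []           (suc k) _ = accepts refl
      expect-decides (nothing ∷ v)    ns (_ ∷ _)      (suc k) _ = rejects λ ()
      expect-decides (just true ∷ v)  ns []           (suc k) _ = rejects λ ()
      expect-decides (just false ∷ v) ns []           (suc k) _ = rejects λ ()
      expect-decides (just true ∷ v)  ns (false ∷ _)  (suc k) _ = rejects λ ()
      expect-decides (just false ∷ v) ns (true ∷ _)   (suc k) _ = rejects λ ()
      expect-decides (just true ∷ v)  ns (true ∷ ys)  (suc k) (s≤s l) =
        let b , e , h = expect-decides (v ∷ʳ nothing) ns ys k l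
        in b , e , mk⇔ (λ t → cong (true ∷_) (trans (sym (reading-∷ʳ v)) (to h t)))
                       (λ r → from h (trans (reading-∷ʳ v) (∷-injectiveʳ r)))
      expect-decides (just false ∷ v) ns (false ∷ ys) (suc k) (s≤s l) =
        let b , e , h = expect-decides (v ∷ʳ nothing) ns ys k l
        in b , e , mk⇔ (λ t → cong (false ∷_) (trans (sym (reading-∷ʳ v)) (to h t)))
                       (λ r → from h (trans (reading-∷ʳ v) (∷-injectiveʳ r)))

      Reaches : Form n → List Bool → Set
      Reaches F p = labelAt F p ≡ just y

      finish-decided : ∀ v md {o} ns ys → Status md o ys →
                       Decided (finish (just false ∷ v) md) ns [] ys (just (reading (just false ∷ v)) ≡ just y)
      finish-decided v fixed ns ys (refl , _) k l =
        let b , e , h = expect-decides (just false ∷ v) ns ys k l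
        in b , e , mk⇔ (cong just ∘ to h) (from h ∘ just-injective)
      finish-decided v matching ns ys refl         k l = rejects λ ()
      finish-decided v failed   ns ys (_ , refl , _) k l = rejects λ ()

      const-decided : ∀ b md {o} ns p ys → Status md o ys →
                      Decided (onConst b md (head p)) ns p ys (Reaches (const b) p)
      const-decided b md ns []          ys st = finish-decided _ md ns ys st
      const-decided b md ns (false ∷ p) ys st k l = rejects λ ()
      const-decided b md ns (true ∷ p)  ys st k l = rejects λ ()

      input-decided : ∀ i md ns p ys → Status md (toℕ i) ys →
                      Decided (onInput md (head p) (head ys)) ns p ys (Reaches (input i) p)
      input-decided i fixed    ns [] ys       (_ , h)       k l = rejects λ e → h _ (sym (just-injective e))
      input-decided i failed   ns [] ys       (z , refl , h) k l =
        rejects λ e → h [] (trans (sym (∷-injectiveʳ (just-injective e))) (sym (++-identityʳ _)))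
      input-decided i matching ns [] []       st            k l =
        accepts (cong just (trans (cong (true ∷_) (sym (++-identityʳ (binary (toℕ i))))) (sym st)))
      input-decided i matching ns [] (b ∷ ys) refl          k l = rejects λ e →
        case ++-cancelˡ (binary (toℕ i)) [] (b ∷ ys)
          (trans (++-identityʳ _) (∷-injectiveʳ (just-injective e))) of λ ()
      input-decided i fixed    ns (false ∷ p) ys st k l = rejects λ ()
      input-decided i fixed    ns (true ∷ p)  ys st k l = rejects λ ()
      input-decided i failed   ns (false ∷ p) ys st k l = rejects λ ()
      input-decided i failed   ns (true ∷ p)  ys st k l = rejects λ ()
      input-decided i matching ns (false ∷ p) ys st k l = rejects λ ()
      input-decided i matching ns (true ∷ p)  ys st k l = rejects λ ()

      unary-decided : ∀ a b cmp nz md i ns p ys → Status md (toℕ i) ys →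
                      Decided (onUnary a b (cmp , nz , md) (head p) (head ys)) ns p ys (Reaches (unary a b i) p)
      unary-decided true  true  cmp nz md i ns p ys st = const-decided true md ns p ys st
      unary-decided false false cmp nz md i ns p ys st = const-decided false md ns p ys st
      unary-decided true  false cmp nz md i ns p ys st = input-decided i md ns p ys st
      unary-decided false true  cmp nz md i ns []          ys st = finish-decided _ md ns ys st
      unary-decided false true  cmp nz md i ns (true ∷ p)  ys st k l = rejects λ ()
      unary-decided false true  cmp nz md i ns (false ∷ p) ys st (suc k) (s≤s l) =
        input-decided i md ns p ys st k l

      adv-length : ∀ b ys → length (adv b ys) ≤ length ys
      adv-length false ys       = ≤-refl
      adv-length true  []       = ≤-refl
      adv-length true  (_ ∷ ys) = n≤1+n _

      chain-suc : ∀ {k} (f : Fin k → Form n) c → chain f (suc c) ≡ disj (f c) (chain f (inject₁ c))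
      chain-suc {suc k} f c = cong (disj (f c)) (sym (chain-inject₁ f c))

      -- `u` is the number formed by the digits of `n` read so far, and `o` the position spelled out
      -- by the path with equally many digits.
      record Invariant (cmp : Maybe Bool) (nz : Bool) (md : Maybe Bool) (o u : ℕ)
                       (ns ys : List Bool) : Set where
        constructor inv
        field
          total    : value u ns ≡ n
          compares : Compares cmp o u
          nonzero  : Nonzero nz o
          status   : Status md o ys

      -- The depth of the current entry is the number of unread digits of `n`, so the leaves are met
      -- exactly at the end of `n`.
      node-decided : ∀ i j cmp nz md {o u} ns p ys → Invariant cmp nz md o u ns ys →
                     Decided (onNode i j (cmp , nz , md) (head ns) (head p) (head ys)) ns p ys
                             (Reaches (mat n (length ns) o i j) p)
      link-decided : ∀ i j c cmp nz md {o u} a ns p ys → Invariant cmp nz md o u (a ∷ ns) ys →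
                     Decided (onLink i j c (cmp , nz , md) (head p)) (a ∷ ns) p ys
                             (Reaches (chain (via n (length ns) o i j) c) p)
      both-decided : ∀ i j m cmp nz md {o u} a ns p ys → Invariant cmp nz md o u (a ∷ ns) ys →
                     Decided (onBoth i j m (cmp , nz , md) (just a) (head p) (head ys)) (a ∷ ns) p ys
                             (Reaches (via n (length ns) o i j m) p)

      node-decided i j cmp nz md (a ∷ ns) p ys I = link-decided i j (fromℕ N) cmp nz md a ns p ys I
      node-decided i j below nz md {o} [] p ys (inv refl l _ st) with o <? n
      ... | yes o<n = unary-decided (can i (just true) j) (can i (just false) j) below nz md (fromℕ< o<n) [] p ys
                        (subst (λ o → Status md o ys) (sym (toℕ-fromℕ< o<n)) st)
      ... | no o≮n  = ⊥-elim (o≮n l)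
      node-decided i j same  nz md {o} [] p ys (inv refl l _ st) with o <? n
      ... | yes o<n = ⊥-elim (<-irrefl l o<n)
      ... | no o≮n  = const-decided (can i nothing j) md [] p ys st
      node-decided i j above nz md {o} [] p ys (inv refl l _ st) with o <? n
      ... | yes o<n = ⊥-elim (<-asym l o<n)
      ... | no o≮n  = const-decided (can i nothing j) md [] p ys st

      link-decided i j zero cmp nz md a ns p ys I = const-decided false md (a ∷ ns) p ys (Invariant.status I)
      link-decided i j (suc c) cmp nz md {o} a ns p ys I
        rewrite chain-suc (via n (length ns) o i j) c = linked p
        where
        linked : ∀ p → Decided (onLink i j (suc c) (cmp , nz , md) (head p)) (a ∷ ns) p ys
                   (Reaches (disj (via n (length ns) o i j c) (chain (via n (length ns) o i j) (inject₁ c))) p)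
        linked []          = finish-decided _ md (a ∷ ns) ys (Invariant.status I)
        linked (true ∷ p)  (suc k) (s≤s l) = link-decided i j (inject₁ c) cmp nz md a ns p ys I k l
        linked (false ∷ p) (suc k) (s≤s l) = both-decided i j c cmp nz md a ns p ys I k l

      both-decided i j m cmp nz md a ns [] ys I = finish-decided _ md (a ∷ ns) ys (Invariant.status I)
      both-decided i j m cmp nz md {o} {u} a ns (b ∷ p) ys (inv t c z st) (suc k) (s≤s l) =
        subst (λ X → Decides _ X) (branch b)
          (node-decided (if b then m else i) (if b then j else m)
            (compare cmp b a) (nz ∨ b) (proj₁ (match md (nz ∨ b) b (head ys))) ns p
            (adv (proj₂ (match md (nz ∨ b) b (head ys))) ys)
            (inv t (compares-⊳ cmp b a c) z′ (status-⊳ md (nz ∨ b) b ys z′ (stays nz b z) st))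
            k (≤-trans (s≤s (+-monoʳ-≤ (length p) (adv-length (proj₂ (match md (nz ∨ b) b (head ys))) ys))) l))
        where
        z′ = nonzero-⊳ nz b z
        stays : ∀ nz b → Nonzero nz o → nz ∨ b ≡ false → o ⊳ b ≡ o
        stays false false refl _ = refl
        branch : ∀ b → Reaches (mat n (length ns) (o ⊳ b) (if b then m else i) (if b then j else m)) p ≡
                       Reaches (via n (length ns) o i j m) (b ∷ p)
        branch true  = refl
        branch false = refl

      -- Two steps precede the first result to which `Decided` applies, and its own bound adds one
      -- more.
      begin-decides : ∀ p k → 3 + (length p + length y) ≤ k →
                      Decides (go k begin (binary n) p y)
                              (Reaches (mat n (length (binary n)) 0 source target) p)
      begin-decides p k l = started y refl k l
        where
        started : ∀ ys → ys ≡ y → ∀ k → 3 + (length p + length ys) ≤ k →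
                  Decides (go k begin (binary n) p ys) (Reaches (mat n (length (binary n)) 0 source target) p)
        started []           e (suc (suc k)) (s≤s (s≤s l)) =
          node-decided source target same false fixed (binary n) p []
            (inv (value-binary n) refl refl (sym e , λ z e′ → case trans e e′ of λ ())) k l
        started (false ∷ ys) e (suc (suc k)) (s≤s (s≤s l)) =
          node-decided source target same false fixed (binary n) p (false ∷ ys)
            (inv (value-binary n) refl refl (sym e , λ z e′ → case trans e e′ of λ ())) k l
        started (true ∷ ys)  e (suc (suc k)) (s≤s (s≤s l)) =
          node-decided source target same false matching (binary n) p ys
            (inv (value-binary n) refl refl (sym e)) k
            (≤-trans (s≤s (+-monoʳ-≤ (length p) (n≤1+n _))) l)

open import Data.Fin.Base using (zero)
open import Data.List.Base using (List; length)
open import Data.Maybe.Base using (just)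
open import Data.Bool.Base using (Bool; true)
open import Data.Nat.Base using (ℕ; _+_; _*_; _≤_)
open import Data.Nat.Properties
  using (≤-trans; ≤-reflexive; +-comm; +-monoˡ-≤; m≤n+m; m≤n*m)
open import Data.Product.Base using (Σ-syntax; _,_)
open import Function.Bundles using (_⇔_)
open import Function.Construct.Composition using (_⇔-∘_)
open import Function.Construct.Symmetry using (⇔-sym)
open import Relation.Binary.PropositionalEquality using (_≡_; sym; trans; subst)
open Temporal using (module TypeAutomaton)
open Rewriting using (module RPR; module SecondOrder)
open Rows using (DFA; module Answers)
open Circuits using (labelFrom-compile)
open Matrix using (module FromDFA)
open OneWay using (module OneWay)
open Uniformity using (module Checker)

-- Uniformity of the circuit family, and the theorem.

module _ (A : DFA) where
  open FromDFA A
  open Checker N δ source target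

  uniform : Uniform family
  -- The additive 3 comes from `begin-decides`; `Uniform` uses the same constant as factor, where 1
  -- would do.
  uniform = OneWay.machine checker , 3 , decided
    where
    steps : List Bool → List Bool → List Bool → ℕ
    steps x p y = 3 * (length x + length p + length y) + 3

    enough : ∀ x p y → 3 + (length p + length y) ≤ steps x p y
    enough x p y = ≤-trans (≤-reflexive (+-comm 3 _)) (+-monoˡ-≤ 3 (≤-trans
      (+-monoˡ-≤ (length y) (m≤n+m (length p) (length x))) (m≤n*m (length x + length p + length y) 3)))

    decided : ∀ n p y → Σ[ b ∈ Bool ]
      Machine.runOn (OneWay.machine checker) (steps (binary n) p y) (binary n) p y ≡ just b ×
      (b ≡ true ⇔ labelFrom (Family.circuit family n) zero p ≡ just y)
    decided n p y =
      let b , e , h = begin-decides n y p (steps (binary n) p y) (enough (binary n) p y)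
      in b , trans (OneWay.runOn≡go checker (steps (binary n) p y) (binary n) p y) e ,
         subst (λ l → b ≡ true ⇔ l ≡ just y) (sym (labelFrom-compile [] (form n) p)) h

theorem8 : ExcludedMiddle 0ℓ → (q : OMIQ) →
    (FO[RPR] -rewritable q) × (MSO[<] -rewritable q) × (Answering q ∈ NC¹)
theorem8 em ⟨ 𝒪 , κ ⟩ =
  (RPR.formula automaton , λ 𝒜 ℓ → ⇔-sym (RPR.formula⇔ automaton 𝒜 ℓ _) ⇔-∘ ans⇔ 𝒜 ℓ) ,
  (SecondOrder.formula automaton , λ 𝒜 ℓ → ⇔-sym (SecondOrder.formula⇔ automaton em 𝒜 ℓ) ⇔-∘ ans⇔ 𝒜 ℓ) ,
  record
    { family     = family
    ; polySize   = polySize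
    ; logDepth   = logDepth
    ; uniform    = uniform dfa
    ; recognises = λ w → recognises w ⇔-∘ dfa-answers w
    }
  where
  open TypeAutomaton em 𝒪 κ using (automaton; ans⇔)
  open Answers em 𝒪 κ using (dfa; dfa-answers)
  open FromDFA dfa
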